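{- There is a global constant $c$ such that the following holds. Given a parameter $\ell\ge 1$, a pair $\langle G,V'\rangle$ where $G=(V,E)$ is a graph with tree-width $k$ and $V'\subseteq V$, and a nice tree decomposition of $G$ of width $k$ with $O(|V|)$ tree nodes, a minimum size set $S\subseteq V$ such that $V'\subseteq\mathcal{P}^{\ell}(S)$ can be obtained in time $O(c^{\,m_e+k\log\ell}\cdot|V|)$, where $m_e$ is the maximum number of edges that a bag can have, i.e. the maximum, over the bags $X_i$ of the tree decomposition, of the number of edges of the induced subgraph $G[X_i]$.
   Context: Let $G=(V,E)$ be an undirected graph, and let $N[u]$ denote the closed neighborhood of $u$ (the node $u$ together with its neighbors). For $S\subseteq V$, define recursively $\mathcal{P}^1(S)=\bigcup_{v\in S}N[v]$ and, for $r\geq 2$, $$\mathcal{P}^{r}(S)=\mathcal{P}^{r-1}(S)\cup\{v : \exists u,\ \{u,v\}\in E,\ N[u]\setminus\{v\}\subseteq \mathcal{P}^{r-1}(S)\}.$$ A tree decomposition of $G$ is a pair $\langle\{X_i\subseteq V: i\in I\},T=(I,F)\rangle$ with $T$ a tree such that $\bigcup_i X_i=V$, every edge of $G$ is contained in some bag $X_i$, and $X_i\cap X_h\subseteq X_j$ whenever $j$ lies on the path from $i$ to $h$ in $T$. Its width is $\max_i|X_i|-1$, and the tree-width of $G$ is the minimum width over all tree decompositions. A nice tree decomposition is one in which $T$ is rooted, every tree node has at most two children, a tree node $i$ with two children $j,h$ satisfies $X_i=X_j=X_h$, and a tree node $i$ with one child $j$ satisfies either $X_j\subset X_i$ with $|X_i\setminus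 X_j|=1$ or $X_i\subset X_j$ with $|X_j\setminus X_i|=1$.
   Formalization: log ℓ is read as max(1, ⌈log₂ ℓ⌉), since at ℓ = 1 the literal bound O(c^{m_e}·|V|) would solve vertex cover in polynomial time; time is counted on a uniform-cost RAM with addition and subtraction on unbounded integers. -}

module Defs where

open import Data.Bool using (Bool; true; false; if_then_else_)
open import Data.Empty using (⊥)
open import Data.Fin using (Fin; toℕ)
import Data.Fin as Fin
import Data.Fin.Properties as Fin
open import Data.Fin.Subset using (Subset; _∈_; _⊂_; _─_; ∣_∣)
open import Data.Fin.Subset.Properties using (_∈?_)
open import Data.List using (List; []; _∷_; _++_; length; filter; map; concatMap; allFin)
open import Data.List.Extrema.Nat using (max)
import Data.List.Membership.Propositional as List
open import Data.List.Relation.Unary.All using (All)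
open import Data.List.Relation.Unary.Unique.Propositional using (Unique)
open import Data.Nat using (ℕ; zero; suc; _+_; _∸_; _⊔_; _≤_; _≡ᵇ_; NonZero)
open import Data.Nat.Logarithm using (⌈log₂_⌉)
open import Data.Product using (∃; ∃-syntax; ∃!; _×_; _,_; proj₁; proj₂)
open import Data.Sum using (_⊎_)
open import Data.Unit using (⊤)
open import Data.Vec using (lookup; toList)
open import Relation.Binary.PropositionalEquality using (_≡_; _≢_)
open import Relation.Nullary.Decidable using (¬?; _×-dec_)

------------------------------------------------------------------------
-- Graphs

-- A finite simple undirected graph on the vertex set Fin n.  The edge
-- {u , v} is listed exactly once, as (u , v) with u < v; the order of the
-- list is arbitrary.
record Graph (n : ℕ) : Set where
  field
    edges   : List (Fin n × Fin n)
    ordered : All (λ e → proj₁ e Fin.< proj₂ e) edges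
    unique  : Unique edges

open Graph public

module _ {n : ℕ} (G : Graph n) where

  Adj : Fin n → Fin n → Set
  Adj u v = ((u , v) List.∈ edges G) ⊎ ((v , u) List.∈ edges G)

  -- N[ u ] v  means  v ∈ N[u].
  N[_] : Fin n → Fin n → Set
  N[ u ] v = v ≡ u ⊎ Adj u v

  -- 𝒫 r S v  means  v ∈ 𝒫ʳ(S).  Only r ≥ 1 is meaningful; the clause for
  -- zero is a filler that no other clause refers to.
  𝒫 : ℕ → Subset n → Fin n → Set
  𝒫 zero          S v = v ∈ S
  𝒫 (suc zero)    S v = ∃[ u ] u ∈ S × N[ u ] v
  𝒫 (suc (suc r)) S v =
    𝒫 (suc r) S v ⊎
    (∃[ u ] Adj u v × (∀ w → N[ u ] w → w ≢ v → 𝒫 (suc r) S w))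

  Dominates : ℕ → Subset n → Subset n → Set
  Dominates ℓ V′ S = ∀ v → v ∈ V′ → 𝒫 ℓ S v

  IsMinimumDominating : ℕ → Subset n → Subset n → Set
  IsMinimumDominating ℓ V′ S =
    Dominates ℓ V′ S × (∀ S′ → Dominates ℓ V′ S′ → ∣ S ∣ ≤ ∣ S′ ∣)

  inducedEdgeCount : Subset n → ℕ
  inducedEdgeCount X =
    length (filter (λ e → (proj₁ e ∈? X) ×-dec (proj₂ e ∈? X)) (edges G))

  data IsWalk : Fin n → List (Fin n) → Fin n → Set where
    stop : ∀ {i} → IsWalk i (i ∷ []) i
    step : ∀ {i j h vs} → Adj i j → IsWalk j vs h → IsWalk i (i ∷ vs) h

  IsPath : Fin n → Fin n → List (Fin n) → Set
  IsPath i h vs = IsWalk i vs h × Unique vs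

  OnPath : Fin n → Fin n → Fin n → Set
  OnPath i h j = ∃[ vs ] IsPath i h vs × j List.∈ vs

  IsTree : Set
  IsTree = NonZero n × (∀ i h → ∃! _≡_ (IsPath i h))

------------------------------------------------------------------------
-- Tree decompositions

record TreeDecomposition {n : ℕ} (G : Graph n) (m : ℕ) : Set where
  field
    tree       : Graph m
    isTree     : IsTree tree
    bag        : Fin m → Subset n
    coverV     : ∀ v → ∃[ i ] v ∈ bag i
    coverE     : ∀ u v → Adj G u v → ∃[ i ] u ∈ bag i × v ∈ bag i
    connected  : ∀ i h j → OnPath tree i h j →
                 ∀ v → v ∈ bag i → v ∈ bag h → v ∈ bag j

  maxBagSize : ℕ
  maxBagSize = max 0 (map (λ i → ∣ bag i ∣) (allFin m))

  maxBagEdges : ℕ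
  maxBagEdges = max 0 (map (λ i → inducedEdgeCount G (bag i)) (allFin m))

-- Written without truncated subtraction, so that the empty graph (whose
-- decompositions have width -1) has no width in ℕ.
HasWidth : ∀ {n m} {G : Graph n} → TreeDecomposition G m → ℕ → Set
HasWidth D k = TreeDecomposition.maxBagSize D ≡ suc k

HasTreeWidth : ∀ {n} → Graph n → ℕ → Set
HasTreeWidth G k =
  (∃[ m ] ∃ λ (D : TreeDecomposition G m) → HasWidth D k) ×
  (∀ {m} (D : TreeDecomposition G m) k′ → HasWidth D k′ → k ≤ k′)

NiceNode : ∀ {n m} → (Fin m → Subset n) → Fin m → List (Fin m) → Set
NiceNode X i []           = ⊤
NiceNode X i (j ∷ [])     = (X j ⊂ X i × ∣ X i ─ X j ∣ ≡ 1) ⊎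
                            (X i ⊂ X j × ∣ X j ─ X i ∣ ≡ 1)
NiceNode X i (j ∷ h ∷ []) = X i ≡ X j × X j ≡ X h
NiceNode X i (_ ∷ _ ∷ _ ∷ _) = ⊥

-- The rooting is given by the parent map: the parent of j ≢ root is the
-- neighbour of j on the path from j to the root.  The value of parent at
-- the root is irrelevant.
record NiceTreeDecomposition {n : ℕ} (G : Graph n) (m : ℕ) : Set where
  field
    decomposition : TreeDecomposition G m

  open TreeDecomposition decomposition public

  field
    root          : Fin m
    parent        : Fin m → Fin m
    parent-adj    : ∀ j → j ≢ root → Adj tree j (parent j)
    parent-onPath : ∀ j → j ≢ root → OnPath tree j root (parent j)

  children : Fin m → List (Fin m)
  children i =
    filter (λ j → ¬? (j Fin.≟ root) ×-dec (parent j Fin.≟ i)) (allFin m)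

  field
    nice : ∀ i → NiceNode bag i (children i)

------------------------------------------------------------------------
-- Computation model

-- Programs for the uniform-cost RAM with addition and truncated
-- subtraction (no multiplication), in structured form: every construct
-- corresponds to a bounded number of RAM instructions.  Registers are
-- addressed directly (reg x), memory cells indirectly (mem e).

data Exp : Set where
  lit     : ℕ → Exp
  reg     : ℕ → Exp
  mem     : Exp → Exp
  _⊕_ _⊖_ : Exp → Exp → Exp

data Cmd : Set where
  skip            : Cmd
  reg_≔_          : ℕ → Exp → Cmd
  mem_≔_          : Exp → Exp → Cmd
  _⨟_             : Cmd → Cmd → Cmd
  if≢0_then_else_ : Exp → Cmd → Cmd → Cmd
  while≢0_loop_   : Exp → Cmd → Cmd

record State : Set where
  constructor ⟨_,_⟩
  field
    regs  : ℕ → ℕ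
    cells : ℕ → ℕ

open State public

_[_↦_] : (ℕ → ℕ) → ℕ → ℕ → (ℕ → ℕ)
(f [ x ↦ a ]) y = if y ≡ᵇ x then a else f y

⟦_⟧ : Exp → State → ℕ
⟦ lit a   ⟧ σ = a
⟦ reg x   ⟧ σ = regs σ x
⟦ mem e   ⟧ σ = cells σ (⟦ e ⟧ σ)
⟦ e₁ ⊕ e₂ ⟧ σ = ⟦ e₁ ⟧ σ + ⟦ e₂ ⟧ σ
⟦ e₁ ⊖ e₂ ⟧ σ = ⟦ e₁ ⟧ σ ∸ ⟦ e₂ ⟧ σ

cost : Exp → ℕ
cost (lit _)   = 1
cost (reg _)   = 1
cost (mem e)   = 1 + cost e
cost (e₁ ⊕ e₂) = 1 + cost e₁ + cost e₂
cost (e₁ ⊖ e₂) = 1 + cost e₁ + cost e₂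

-- Run p σ σ′ t: started in σ, p halts in σ′ after exactly t time units.
data Run : Cmd → State → State → ℕ → Set where
  skip    : ∀ {σ} → Run skip σ σ 1
  setReg  : ∀ {σ x e} →
            Run (reg x ≔ e) σ ⟨ regs σ [ x ↦ ⟦ e ⟧ σ ] , cells σ ⟩
                (1 + cost e)
  setMem  : ∀ {σ a e} →
            Run (mem a ≔ e) σ ⟨ regs σ , cells σ [ ⟦ a ⟧ σ ↦ ⟦ e ⟧ σ ] ⟩
                (1 + cost a + cost e)
  seq     : ∀ {σ σ′ σ″ p q s t} →
            Run p σ σ′ s → Run q σ′ σ″ t → Run (p ⨟ q) σ σ″ (1 + s + t)
  ifTrue  : ∀ {σ σ′ e p q t} → ⟦ e ⟧ σ ≢ 0 → Run p σ σ′ t →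
            Run (if≢0 e then p else q) σ σ′ (1 + cost e + t)
  ifFalse : ∀ {σ σ′ e p q t} → ⟦ e ⟧ σ ≡ 0 → Run q σ σ′ t →
            Run (if≢0 e then p else q) σ σ′ (1 + cost e + t)
  again   : ∀ {σ σ′ σ″ e p s t} → ⟦ e ⟧ σ ≢ 0 →
            Run p σ σ′ s → Run (while≢0 e loop p) σ′ σ″ t →
            Run (while≢0 e loop p) σ σ″ (1 + cost e + s + t)
  exit    : ∀ {σ e p} → ⟦ e ⟧ σ ≡ 0 →
            Run (while≢0 e loop p) σ σ (1 + cost e)

------------------------------------------------------------------------
-- Input and output

fromList : List ℕ → ℕ → ℕ
fromList []       _       = 0
fromList (a ∷ as) zero    = a
fromList (a ∷ as) (suc i) = fromList as i

initial : List ℕ → State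
initial input = ⟨ (λ _ → 0) , fromList input ⟩

bit : Bool → ℕ
bit b = if b then 1 else 0

-- Cells 0 … n-1 of the final memory hold the characteristic vector of S.
OutputsWithin : ∀ {n} → Cmd → List ℕ → Subset n → ℕ → Set
OutputsWithin p input S T =
  ∃[ σ ] ∃[ t ] Run p (initial input) σ t × t ≤ T ×
  (∀ v → cells σ (toℕ v) ≡ bit (lookup S v))

encodeEdges : ∀ {n} → Graph n → List ℕ
encodeEdges G =
  length (edges G) ∷ concatMap (λ e → toℕ (proj₁ e) ∷ toℕ (proj₂ e) ∷ []) (edges G)

-- A bag is written as its size followed by its elements, and not as a
-- characteristic vector, whose length would make the input too long.
encodeBag : ∀ {n} → Subset n → List ℕ
encodeBag {n} X = ∣ X ∣ ∷ map toℕ (filter (_∈? X) (allFin n))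

encodeDecomposition : ∀ {n m} {G : Graph n} → NiceTreeDecomposition G m → List ℕ
encodeDecomposition {m = m} D =
  m ∷ toℕ root ∷ concatMap (λ i → toℕ (parent i) ∷ encodeBag (bag i)) (allFin m)
  where open NiceTreeDecomposition D

encode : ∀ {n m} → ℕ → (G : Graph n) → Subset n → NiceTreeDecomposition G m → List ℕ
encode {n} ℓ G V′ D =
  ℓ ∷ n ∷ map bit (toList V′) ++ encodeEdges G ++ encodeDecomposition D

-- The logarithm as it is meant inside O(·), that is, at least 1.  For
-- ℓ ≥ 2, log₂ ℓ ≤ log ℓ ≤ 2 log₂ ℓ, so rounding and the choice of base are
-- absorbed by the constant c.  At ℓ = 1 the value 0 would ask for time
-- O(c ^ maxBagEdges · |V|), less than it takes to read the bags when they are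
-- large but induce few edges.
log : ℕ → ℕ
log ℓ = 1 ⊔ ⌈log₂ ℓ ⌉

-- Certificates.  V′ ⊆ 𝒫ˡ(S) holds iff there are rounds t(v) ≤ l + 1 with
-- S = {t = 0} and t ≤ l on V′, and rounds g(u), such that
--   every v with 1 ≤ t(v) ≤ l has a neighbour u with g(u) = t(v), and
--   if g(u) ≠ 0, then t(u) < g(u), all neighbours w of u have t(w) ≤ g(u), and
--   if moreover g(u) ≥ 2, then t(w) = g(u) for at most one of them.
-- To check the two conditions on neighbours inside bags, each bag stores for
-- each of its vertices v the direction in the tree towards a bag with a suitable
-- neighbour of v, and the direction towards the bag owning the edge along which
-- v forces.  An edge is owned by the topmost bag that contains it; that these
-- directions are consistent along tree edges makes the forcing edge unique.
-- Two children per node suffice for a direction to have four values, so a bag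
-- has (l + 3) ^ (4 (k + 1)) labellings.
--
-- Optimisation.  What remains is to minimise a sum of node costs that depend on
-- the labellings of a node and of its parent.  The nodes are processed from the
-- leaves, by climbing from each node as long as all children are finished.  A
-- vertex v costs 2ⁿ + 2ᵛ at the topmost bag containing it, so that the optimal
-- value encodes an optimal set and no back-tracking is needed; violated
-- constraints cost more than all vertices together.  A graph without edges is
-- treated separately, since for k = 0 the time must not depend on l.
module Submission where

open import Defs
open import Data.Bool using (Bool; true; false; if_then_else_; _∨_; _∧_)
open import Data.Empty using (⊥)
open import Data.Fin using (Fin; zero; suc; toℕ; fromℕ<)
import Data.Fin as Fin
open import Data.Fin.Patterns
import Data.Fin.Properties as Fin
open import Data.Fin.Subset using (Subset; _∈_; _∉_; ∣_∣)
import Data.Fin.Subset as Subset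
open import Data.Fin.Subset.Properties using (_∈?_; ∈⊤; ∣p∣≤n; p⊆q⇒∣p∣≤∣q∣)
open import Data.List using (List; []; _∷_; _++_; length; map; filter; concatMap; allFin; drop; tabulate)
open import Data.List.Extrema.Nat using (max; xs≤max; max≤v⁺)
open import Data.List.Membership.Propositional using () renaming (_∈_ to _∈ₗ_)
open import Data.List.Membership.Propositional.Properties using (∈-filter⁺; ∈-filter⁻; ∈-map⁺; ∈-allFin)
import Data.List.Membership.DecPropositional as DecMembership
open import Data.List.Properties using (∷-injectiveʳ; length-map; length-tabulate; length-++)
open import Data.List.Relation.Unary.All as All using (All; []; _∷_)
open import Data.List.Relation.Unary.All.Properties using () renaming (map⁺ to All-map⁺)
open import Data.List.Relation.Unary.AllPairs using ([]; _∷_)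
open import Data.List.Relation.Unary.Any using (here; there)
open import Data.List.Relation.Unary.Unique.Propositional using (Unique)
open import Data.List.Relation.Unary.Unique.Propositional.Properties using (allFin⁺; filter⁺)
open import Data.Maybe using (Maybe; just; nothing)
open import Data.Nat
  using (ℕ; zero; suc; _+_; _*_; _∸_; _^_; _⊔_; _≤_; _<_; _≡ᵇ_; z≤n; s≤s; s≤s⁻¹;
         NonZero; nonZero; >-nonZero; _≤?_; _<?_; ⌈_/2⌉)
open import Data.Nat.DivMod
  using (_/_; _%_; [m+kn]%n≡m%n; m<n⇒m%n≡m; +-distrib-/; m<n⇒m/n≡0; m*n/n≡m; m*n%n≡0)
open import Data.Nat.Induction using (<-rec; <-wellFounded)
open import Data.Nat.Logarithm using (⌈log₂_⌉)
open import Data.Nat.Logarithm.Core using (⌈log2⌉)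
open import Data.Nat.Properties
open import Data.Nat.Tactic.RingSolver using (solve-∀)
open import Data.Product using (Σ; ∃; ∃-syntax; _×_; _,_; proj₁; proj₂)
open import Data.Product.Properties using (≡-dec)
open import Data.Sum using (_⊎_; inj₁; inj₂; [_,_]′)
open import Data.Unit using (⊤; tt)
open import Data.Vec using (Vec; []; _∷_; lookup; toList)
import Data.Vec as Vec
open import Data.Vec.Properties using (lookup∘tabulate; []=⇒lookup; lookup⇒[]=)
open import Function using (_∘_; id)
open import Induction.WellFounded using (Acc; acc)
open import Relation.Binary.Definitions using (tri<; tri≈; tri>)
open import Relation.Binary.PropositionalEquality
  using (_≡_; _≢_; refl; sym; trans; cong; cong₂; subst; subst₂)
open import Relation.Nullary using (¬_; Dec; yes; no; contradiction)
open import Relation.Nullary.Decidable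
  using (does; _×-dec_; _⊎-dec_; _→-dec_; ¬?; dec-true)

-- A language of bounded loops, compiled to the RAM

-- The number of edges in a bag does not enter the number of labellings; it only pays for reading
-- the input, since `E ≤ m * maxBagEdges`. Everything polynomial in the number of labellings is
-- absorbed by the constant base, so multiplication, division and the extraction of digits may be
-- loops of that length. What cannot be absorbed is a second factor n. Unit cost makes numbers as
-- large as n 2ⁿ available, which is why a single number can carry an optimal set.
--
-- The algorithm is written in a small language whose loops are bounded by parameters. Its compiler
-- is verified once, for values and time together. Time is then a function of the parameters alone,
-- and its degree in those that grow with the graph is found by evaluation.

iter : {A : Set} → ℕ → (ℕ → A → A) → A → A
iter zero    f a = a
iter (suc n) f a = f n (iter n f a)

caseZ : {A : Set} → ℕ → A → A → A
caseZ zero    a b = a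
caseZ (suc _) a b = b

data Param : Set where
  pn pm pE pb pD pℓ pB pK pTW pINF pIT : Param

register : Param → ℕ
register pn   = 1
register pm   = 2
register pE   = 3
register pb   = 4
register pD   = 5
register pℓ   = 6
register pB   = 7
register pK   = 8
register pTW  = 9
register pINF = 10
register pIT  = 11

data Tag : Set where
  BP PW MN ADJ NC SD TAB DONE DN CUR OUT : Tag

offset : Tag → ℕ
offset BP   = 0
offset PW   = 1
offset MN   = 2
offset ADJ  = 3
offset NC   = 4
offset SD   = 5
offset TAB  = 6
offset DONE = 7
offset DN   = 8
offset CUR  = 9
offset OUT  = 10

Params Mem : Set
Params = Param → ℕ
Mem    = Tag → ℕ → ℕ

-- fold P e b o  starts from e and, for i = 0, 1, …, P - 1, replaces the
-- accumulator a by o (a , b (i)).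
data Tm (k : ℕ) : Set where
  num     : ℕ → Tm k
  var     : Fin k → Tm k
  par     : Param → Tm k
  inp     : Tm k → Tm k
  arr     : Tag → Tm k → Tm k
  _⊞_ _⊟_ : Tm k → Tm k → Tm k
  ifz     : Tm k → Tm k → Tm k → Tm k
  bind    : Tm k → Tm (suc k) → Tm k
  fold    : Param → Tm k → Tm (suc k) → Tm 2 → Tm k

infixl 6 _⊞_ _⊟_

data Stmt (k : ℕ) : Set where
  store : Tag → Tm k → Tm k → Stmt k
  _⨾_   : Stmt k → Stmt k → Stmt k
  when  : Tm k → Stmt k → Stmt k → Stmt k
  bindS : Tm k → Stmt (suc k) → Stmt k
  for   : Param → Stmt (suc k) → Stmt k

infixr 4 _⨾_

data Instr : Set where
  assign  : Param → Tm 0 → Instr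
  perform : Stmt 0 → Instr

-- Tags are compared through their offsets, which is all that a concrete address retains of them.
write : Mem → Tag → ℕ → ℕ → Mem
write μ t i a t′ i′ =
  if offset t′ ≡ᵇ offset t then (if i′ ≡ᵇ i then a else μ t′ i′) else μ t′ i′

setParam : Params → Param → ℕ → Params
setParam π P a P′ = if register P′ ≡ᵇ register P then a else π P′

module Semantics (I : ℕ → ℕ) where

  eval : ∀ {k} → Tm k → Params → Mem → Vec ℕ k → ℕ
  eval (num a)        π μ ρ = a
  eval (var x)        π μ ρ = lookup ρ x
  eval (par P)        π μ ρ = π P
  eval (inp e)        π μ ρ = I (eval e π μ ρ)
  eval (arr t e)      π μ ρ = μ t (eval e π μ ρ)
  eval (e ⊞ e′)       π μ ρ = eval e π μ ρ + eval e′ π μ ρ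
  eval (e ⊟ e′)       π μ ρ = eval e π μ ρ ∸ eval e′ π μ ρ
  eval (ifz c a b)    π μ ρ = caseZ (eval c π μ ρ) (eval a π μ ρ) (eval b π μ ρ)
  eval (bind e b)     π μ ρ = eval b π μ (eval e π μ ρ ∷ ρ)
  eval (fold P e b o) π μ ρ =
    iter (π P) (λ i a → eval o π μ (a ∷ eval b π μ (i ∷ ρ) ∷ [])) (eval e π μ ρ)

  exec : ∀ {k} → Stmt k → Params → Vec ℕ k → Mem → Mem
  exec (store t i e) π ρ μ = write μ t (eval i π μ ρ) (eval e π μ ρ)
  exec (s ⨾ s′)      π ρ μ = exec s′ π ρ (exec s π ρ μ)
  exec (when c a b)  π ρ μ = caseZ (eval c π μ ρ) (exec a π ρ μ) (exec b π ρ μ)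
  exec (bindS e s)   π ρ μ = exec s π (eval e π μ ρ ∷ ρ) μ
  exec (for P s)     π ρ μ = iter (π P) (λ i → exec s π (i ∷ ρ)) μ

  exec₁ : Instr → Params × Mem → Params × Mem
  exec₁ (assign P e) (π , μ) = setParam π P (eval e π μ []) , μ
  exec₁ (perform s) (π , μ) = π , exec s π [] μ

-- Registers: 0 holds the end of the input area, 1 - 11 the parameters; from 16
-- on they are temporaries.

double16 : Exp → Exp
double16 e = d (d (d (d e)))
  where d : Exp → Exp
        d x = x ⊕ x

-- The arrays are interleaved with stride 16 behind the input area, so that none of them needs a
-- length. The RAM has no multiplication; sixteen-fold is four doublings.
cell : Tag → Exp → Exp
cell t e = reg 0 ⊕ (double16 e ⊕ lit (offset t))

-- A stack discipline: `r` names the registers of the variables, the result goes to register `d`,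
-- and registers below `d` are preserved.
compile : ∀ {k} → Tm k → Vec ℕ k → ℕ → Cmd
compile (num a)        r d = reg d ≔ lit a
compile (var x)        r d = reg d ≔ reg (lookup r x)
compile (par P)        r d = reg d ≔ reg (register P)
compile (inp e)        r d =
  compile e r d ⨟
  -- Beyond the input area lie the arrays, whereas the input reads as 0 there; hence the guard.
  (if≢0 (reg 0 ⊖ reg d) then (reg d ≔ mem (reg d)) else (reg d ≔ lit 0))
compile (arr t e)      r d = compile e r d ⨟ (reg d ≔ mem (cell t (reg d)))
compile (e ⊞ e′)       r d =
  compile e r d ⨟ (compile e′ r (suc d) ⨟ (reg d ≔ (reg d ⊕ reg (suc d))))
compile (e ⊟ e′)       r d =
  compile e r d ⨟ (compile e′ r (suc d) ⨟ (reg d ≔ (reg d ⊖ reg (suc d))))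
compile (ifz c a b)    r d =
  compile c r d ⨟ (if≢0 (reg d) then compile b r d else compile a r d)
compile (bind e b)     r d =
  compile e r d ⨟ (compile b (d ∷ r) (suc d) ⨟ (reg d ≔ reg (suc d)))
-- Registers `d` to `3 + d` hold the accumulator, the index, the element and the new accumulator.
compile (fold P e b o) r d =
  compile e r d ⨟ ((reg (1 + d) ≔ lit 0) ⨟
  (while≢0 (reg (register P) ⊖ reg (1 + d)) loop
    (compile b ((1 + d) ∷ r) (2 + d) ⨟
    (compile o (d ∷ (2 + d) ∷ []) (3 + d) ⨟
    ((reg d ≔ reg (3 + d)) ⨟
    (reg (1 + d) ≔ (reg (1 + d) ⊕ lit 1)))))))

compileS : ∀ {k} → Stmt k → Vec ℕ k → ℕ → Cmd
compileS (store t i e) r d =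
  compile i r d ⨟ (compile e r (suc d) ⨟ (mem cell t (reg d) ≔ reg (suc d)))
compileS (s ⨾ s′)      r d = compileS s r d ⨟ compileS s′ r d
compileS (when c a b)  r d =
  compile c r d ⨟ (if≢0 (reg d) then compileS b r d else compileS a r d)
compileS (bindS e s)   r d = compile e r d ⨟ compileS s (d ∷ r) (suc d)
compileS (for P s)     r d =
  (reg d ≔ lit 0) ⨟
  (while≢0 (reg (register P) ⊖ reg d) loop
    (compileS s (d ∷ r) (suc d) ⨟ (reg d ≔ (reg d ⊕ lit 1))))

compile₁ : Instr → Cmd
compile₁ (assign P e) = compile e [] 16 ⨟ (reg register P ≔ reg 16)
compile₁ (perform s) = compileS s [] 16

-- A test `reg ⊖ reg` has cost 3, so each round pays 4 for it, and so does the final failing test.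
loopTime : ℕ → ℕ → ℕ
loopTime N t = N * (4 + t) + 4

-- An upper bound that depends on the parameters but not on the memory; a case distinction is
-- charged for both branches.
time : ∀ {k} → Params → Tm k → ℕ
time π (num a)        = 2
time π (var x)        = 2
time π (par P)        = 2
time π (inp e)        = 1 + time π e + (1 + 3 + (2 + 3))
time π (arr t e)      = 1 + time π e + (1 + cost (mem (cell t (reg 0))))
time π (e ⊞ e′)       = 1 + time π e + (1 + time π e′ + 4)
time π (e ⊟ e′)       = 1 + time π e + (1 + time π e′ + 4)
time π (ifz c a b)    = 1 + time π c + (1 + 1 + (time π a + time π b))
time π (bind e b)     = 1 + time π e + (1 + time π b + 2)
time π (fold P e b o) =
  1 + time π e + (1 + 2 + loopTime (π P) (1 + time π b + (1 + time π o + (1 + 2 + 4))))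

timeS : ∀ {k} → Params → Stmt k → ℕ
timeS π (store t i e) =
  1 + time π i + (1 + time π e + (1 + cost (cell t (reg 0)) + 1))
timeS π (s ⨾ s′)      = 1 + timeS π s + timeS π s′
timeS π (when c a b)  = 1 + time π c + (1 + 1 + (timeS π a + timeS π b))
timeS π (bindS e s)   = 1 + time π e + timeS π s
timeS π (for P s)     = 1 + 2 + loopTime (π P) (1 + timeS π s + 4)

time₁ : Params → Instr → ℕ
time₁ π (assign P e) = 1 + time π e + 2
time₁ π (perform s) = timeS π s

-- Correctness of the compiler

≡ᵇ-refl : ∀ x → (x ≡ᵇ x) ≡ true
≡ᵇ-refl zero    = refl
≡ᵇ-refl (suc x) = ≡ᵇ-refl x

≢⇒≡ᵇ : ∀ {x y} → x ≢ y → (x ≡ᵇ y) ≡ false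
≢⇒≡ᵇ {zero}  {zero}  x≢y = contradiction refl x≢y
≢⇒≡ᵇ {zero}  {suc y} x≢y = refl
≢⇒≡ᵇ {suc x} {zero}  x≢y = refl
≢⇒≡ᵇ {suc x} {suc y} x≢y = ≢⇒≡ᵇ (x≢y ∘ cong suc)

update-same : ∀ f x a → (f [ x ↦ a ]) x ≡ a
update-same f x a rewrite ≡ᵇ-refl x = refl

update-other : ∀ f {x y} a → y ≢ x → (f [ x ↦ a ]) y ≡ f y
update-other f a y≢x rewrite ≢⇒≡ᵇ y≢x = refl

-- A judgement of total correctness with a time bound, so that values and times go through the same
-- induction.
Exec : Cmd → State → ℕ → (State → Set) → Set
Exec c σ T Q = ∃[ σ′ ] ∃[ t ] Run c σ σ′ t × t ≤ T × Q σ′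

weaken : ∀ {c σ s t Q R} → s ≤ t → (∀ {σ′} → Q σ′ → R σ′) → Exec c σ s Q → Exec c σ t R
weaken s≤t f (σ′ , _ , run , u≤s , q) = σ′ , _ , run , ≤-trans u≤s s≤t , f q

seqE : ∀ {p q σ s t Q R} → Exec p σ s Q → (∀ {σ′} → Q σ′ → Exec q σ′ t R) →
       Exec (p ⨟ q) σ (1 + s + t) R
seqE (_ , _ , run , s≤ , q) f with f q
... | σ″ , _ , run′ , t≤ , r = σ″ , _ , seq run run′ , s≤s (+-mono-≤ s≤ t≤) , r

setE : ∀ {σ x e} {Q : State → Set} → Q ⟨ regs σ [ x ↦ ⟦ e ⟧ σ ] , cells σ ⟩ →
       Exec (reg x ≔ e) σ (1 + cost e) Q
setE q = _ , _ , setReg , ≤-refl , q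

setMemE : ∀ {σ a e} {Q : State → Set} → Q ⟨ regs σ , cells σ [ ⟦ a ⟧ σ ↦ ⟦ e ⟧ σ ] ⟩ →
          Exec (mem a ≔ e) σ (1 + cost a + cost e) Q
setMemE q = _ , _ , setMem , ≤-refl , q

ifE : ∀ {σ e p q s t Q} → (⟦ e ⟧ σ ≡ 0 → Exec q σ s Q) →
      (⟦ e ⟧ σ ≢ 0 → Exec p σ t Q) →
      Exec (if≢0 e then p else q) σ (1 + cost e + (s + t)) Q
ifE {σ} {e} {s = s} {t} f g with ⟦ e ⟧ σ ≟ 0
... | yes z with f z
...   | _ , _ , run , t≤ , q =
        _ , _ , ifFalse z run , +-monoʳ-≤ (1 + cost e) (≤-trans t≤ (m≤m+n s t)) , q
ifE {σ} {e} {s = s} {t} f g | no nz with g nz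
...   | _ , _ , run , t≤ , q =
        _ , _ , ifTrue nz run , +-monoʳ-≤ (1 + cost e) (≤-trans t≤ (m≤n+m t s)) , q

loopE : ∀ {β x body σ} (N T : ℕ) (Inv : ℕ → State → Set) →
        (∀ {i σ} → Inv i σ → regs σ x ≡ i × regs σ β ≡ N) →
        (∀ {i σ} → i < N → Inv i σ → Exec body σ T (Inv (suc i))) →
        Inv 0 σ →
        Exec (while≢0 (reg β ⊖ reg x) loop body) σ (loopTime N T) (Inv N)
loopE {β} {x} {body} N T Inv counter iteration = go N 0 (+-identityʳ N)
  where
  go : ∀ j i {σ} → j + i ≡ N → Inv i σ →
       Exec (while≢0 (reg β ⊖ reg x) loop body) σ (loopTime j T) (Inv N)
  go zero i refl inv =
    _ , _ , exit z , ≤-refl , inv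
    where z = trans (cong₂ _∸_ (proj₂ (counter inv)) (proj₁ (counter inv))) (n∸n≡0 i)
  go (suc j) i {σ} eq inv with iteration (≤-trans (s≤s (m≤n+m i j)) (≤-reflexive eq)) inv
  ... | _ , _ , run , t≤ , inv′ with go j (suc i) (trans (+-suc j i) eq) inv′
  ...   | _ , _ , run′ , t≤′ , q =
          _ , _ , again nz run run′ ,
          ≤-trans (+-mono-≤ (+-monoʳ-≤ 4 t≤) t≤′)
                  (≤-reflexive (sym (+-assoc (4 + T) (j * (4 + T)) 4))) , q
    where
    nz : regs σ β ∸ regs σ x ≢ 0
    nz z = n≮n i (≤-trans (≤-trans (s≤s (m≤n+m i j)) (≤-reflexive eq))
      (m∸n≡0⇒m≤n (trans (cong₂ _∸_ (sym (proj₂ (counter inv))) (sym (proj₁ (counter inv)))) z)))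

twice : ℕ → ℕ
twice x = x + x

-- Spelled so that the evaluation of `double16` agrees with it definitionally.
double : ℕ → ℕ
double i = twice (twice (twice (twice i)))

double≡ : ∀ i → double i ≡ i * 16
double≡ i = trans (t≡ _ (t≡ _ (t≡ _ (t≡ i refl)))) (pow i)
  where
  twice≡ : ∀ x → x + x ≡ x * 2
  twice≡ = solve-∀
  t≡ : ∀ x {y} → x ≡ y → twice x ≡ y * 2
  t≡ x refl = twice≡ x
  pow : ∀ i → i * 2 * 2 * 2 * 2 ≡ i * 16
  pow = solve-∀

offset<16 : ∀ t → offset t < 16
offset<16 BP   = m≤m+n 1 15
offset<16 PW   = m≤m+n 2 14
offset<16 MN   = m≤m+n 3 13
offset<16 ADJ  = m≤m+n 4 12
offset<16 NC   = m≤m+n 5 11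
offset<16 SD   = m≤m+n 6 10
offset<16 TAB  = m≤m+n 7 9
offset<16 DONE = m≤m+n 8 8
offset<16 DN   = m≤m+n 9 7
offset<16 CUR  = m≤m+n 10 6
offset<16 OUT  = m≤m+n 11 5

register<16 : ∀ P → register P < 16
register<16 pn   = m≤m+n 2 14
register<16 pm   = m≤m+n 3 13
register<16 pE   = m≤m+n 4 12
register<16 pb   = m≤m+n 5 11
register<16 pD   = m≤m+n 6 10
register<16 pℓ   = m≤m+n 7 9
register<16 pB   = m≤m+n 8 8
register<16 pK   = m≤m+n 9 7
register<16 pTW  = m≤m+n 10 6
register<16 pINF = m≤m+n 11 5
register<16 pIT  = m≤m+n 12 4

0<register : ∀ P → register P ≢ 0
0<register pn   ()
0<register pm   ()
0<register pE   ()
0<register pb   ()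
0<register pD   ()
0<register pℓ   ()
0<register pB   ()
0<register pK   ()
0<register pTW  ()
0<register pINF ()
0<register pIT  ()

module Simulation (I : ℕ → ℕ) (base : ℕ) (I-end : ∀ a → base ≤ a → I a ≡ 0) where
  open Semantics I

  address : Tag → ℕ → ℕ
  address t i = base + (double i + offset t)

  -- The remainder modulo 16 recovers the offset of the tag; cancelling it leaves the index.
  address-injective : ∀ {t t′ i i′} → address t i ≡ address t′ i′ →
                      offset t ≡ offset t′ × i ≡ i′
  address-injective {t} {t′} {i} {i′} eq = o≡ , *-cancelʳ-≡ i i′ 16 (+-cancelʳ-≡ (offset t) _ _
      (trans eq″ (cong (i′ * 16 +_) (sym o≡))))
    where
    eq″ : i * 16 + offset t ≡ i′ * 16 + offset t′
    eq″ = trans (cong (_+ offset t) (sym (double≡ i)))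
         (trans (+-cancelˡ-≡ base _ _ eq) (cong (_+ offset t′) (double≡ i′)))
    mod : ∀ t i → (i * 16 + offset t) % 16 ≡ offset t
    mod t i = trans (cong (_% 16) (+-comm (i * 16) (offset t)))
              (trans ([m+kn]%n≡m%n (offset t) i 16) (m<n⇒m%n≡m (offset<16 t)))
    o≡ : offset t ≡ offset t′
    o≡ = trans (sym (mod t i)) (trans (cong (_% 16) eq″) (mod t′ i′))

  -- Temporary registers are left unconstrained, so that the relation survives the evaluation of any
  -- term.
  record Sim (π : Params) (μ : Mem) (σ : State) : Set where
    field
      base-reg : regs σ 0 ≡ base
      params   : ∀ P → regs σ (register P) ≡ π P
      input    : ∀ a → a < base → cells σ a ≡ I a
      arrays   : ∀ t i → cells σ (address t i) ≡ μ t i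
  open Sim

  record Keeps (d : ℕ) (σ σ′ : State) : Set where
    constructor keeping
    field keep : ∀ x → x < d → regs σ′ x ≡ regs σ x
  open Keeps

  record Result (σ : State) (d v : ℕ) (σ′ : State) : Set where
    field
      value : regs σ′ d ≡ v
      keeps : Keeps d σ σ′
      same  : cells σ′ ≡ cells σ
  open Result

  -- The bound `lookup r x < d` protects the environment from later writes, which all go to
  -- registers from `d` on.
  record Holds {k} (r : Vec ℕ k) (d : ℕ) (ρ : Vec ℕ k) (σ : State) : Set where
    constructor holding
    field held : ∀ x → lookup r x < d × regs σ (lookup r x) ≡ lookup ρ x
  open Holds

  holds-[] : ∀ {d σ} → Holds [] d [] σ
  holds-[] = holding λ ()

  holds-keep : ∀ {k} {r : Vec ℕ k} {d ρ σ σ′} → Keeps d σ σ′ → Holds r d ρ σ → Holds r d ρ σ′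
  holds-keep kp h = holding λ x →
    proj₁ (held h x) , trans (keep kp _ (proj₁ (held h x))) (proj₂ (held h x))

  holds-≤ : ∀ {k} {r : Vec ℕ k} {d e ρ σ} → d ≤ e → Holds r d ρ σ → Holds r e ρ σ
  holds-≤ d≤e h = holding λ x → <-≤-trans (proj₁ (held h x)) d≤e , proj₂ (held h x)

  holds-∷ : ∀ {k} {r : Vec ℕ k} {d x v ρ σ} → x < d → regs σ x ≡ v →
            Holds r d ρ σ → Holds (x ∷ r) d (v ∷ ρ) σ
  holds-∷ x<d eq h = holding λ { zero → x<d , eq ; (suc y) → held h y }

  sim-keep : ∀ {π μ d σ σ′} → 16 ≤ d → Keeps d σ σ′ → cells σ′ ≡ cells σ →
             Sim π μ σ → Sim π μ σ′
  sim-keep 16≤d kp refl s = record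
    { base-reg = trans (keep kp _ (≤-trans (s≤s z≤n) 16≤d)) (base-reg s)
    ; params   = λ P → trans (keep kp _ (<-≤-trans (register<16 P) 16≤d)) (params s P)
    ; input    = input s
    ; arrays   = arrays s }

  keeps-set : ∀ {d x σ} v → d ≤ x → Keeps d σ ⟨ regs σ [ x ↦ v ] , cells σ ⟩
  keeps-set {σ = σ} v d≤x = keeping λ y y<d → update-other (regs σ) v (<⇒≢ (<-≤-trans y<d d≤x))

  keeps-trans : ∀ {d e σ σ′ σ″} → d ≤ e → Keeps d σ σ′ → Keeps e σ′ σ″ → Keeps d σ σ″
  keeps-trans d≤e k k′ = keeping λ x x<d → trans (keep k′ x (<-≤-trans x<d d≤e)) (keep k x x<d)

  keeps-refl : ∀ {d σ} → Keeps d σ σ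
  keeps-refl = keeping λ _ _ → refl

  setResult : ∀ {σ σ′ d v} w → Keeps d σ σ′ → cells σ′ ≡ cells σ → w ≡ v →
              Result σ d v ⟨ regs σ′ [ d ↦ w ] , cells σ′ ⟩
  setResult {σ′ = σ′} {d} w kp same eq = record
    { value = trans (update-same (regs σ′) d w) eq
    ; keeps = keeps-trans ≤-refl kp (keeps-set {σ = σ′} w ≤-refl)
    ; same  = same }

  compile-correct : ∀ {k} (e : Tm k) {r d π μ ρ σ} → 16 ≤ d → Sim π μ σ → Holds r d ρ σ →
                    Exec (compile e r d) σ (time π e) (Result σ d (eval e π μ ρ))
  binary-correct : ∀ {k} (e e′ : Tm k) {r d π μ ρ σ} → 16 ≤ d → Sim π μ σ → Holds r d ρ σ →
                   (op : Exp → Exp → Exp) (f : ℕ → ℕ → ℕ) →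
                   (∀ {a b σ} → ⟦ op a b ⟧ σ ≡ f (⟦ a ⟧ σ) (⟦ b ⟧ σ)) →
                   (∀ {a b} → cost (op (reg a) (reg b)) ≡ 3) →
                   Exec (compile e r d ⨟ (compile e′ r (suc d) ⨟ (reg d ≔ op (reg d) (reg (suc d)))))
                        σ (1 + time π e + (1 + time π e′ + 4))
                        (Result σ d (f (eval e π μ ρ) (eval e′ π μ ρ)))
  binary-correct e e′ {d = d} {σ = σ} 16≤d s h op f ⟦op⟧ cost≡ =
    seqE (compile-correct e 16≤d s h) λ R →
    seqE (compile-correct e′ (m≤n⇒m≤1+n 16≤d) (sim-keep 16≤d (keeps R) (same R) s)
           (holds-≤ (n≤1+n d) (holds-keep (keeps R) h))) λ {σ″} R′ →
    weaken (≤-reflexive (cong suc (cost≡ {d} {suc d}))) id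
      (setE (setResult {σ = σ} {σ′ = σ″} _ (keeps-trans (n≤1+n d) (keeps R) (keeps R′))
              (trans (same R′) (same R))
              (trans (⟦op⟧ {reg d} {reg (suc d)}) (cong₂ f (trans (keep (keeps R′) d ≤-refl) (value R)) (value R′)))))
  compile-correct (num a) {σ = σ} 16≤d s h =
    setE (setResult {σ = σ} {σ′ = σ} a keeps-refl refl refl)
  compile-correct (var x) {σ = σ} 16≤d s h =
    setE (setResult {σ = σ} {σ′ = σ} _ keeps-refl refl (proj₂ (held h x)))
  compile-correct (par P) {σ = σ} 16≤d s h =
    setE (setResult {σ = σ} {σ′ = σ} _ keeps-refl refl (params s P))
  compile-correct (inp e) {d = d} {π} {μ} {ρ} {σ} 16≤d s h =
    seqE (compile-correct e 16≤d s h) λ {σ′} R →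
    (ifE {s = 2} {t = 3}
      (λ z → weaken ≤-refl id (setE (setResult {σ = σ} {σ′ = σ′} 0 (keeps R) (same R)
        (sym (I-end _ (≤-trans (≤-reflexive (sym (base≡ R)))
          (≤-trans (m∸n≡0⇒m≤n z) (≤-reflexive (value R)))))))))
      (λ nz → setE (setResult {σ = σ} {σ′ = σ′} _ (keeps R) (same R)
        (trans (cong₂ (λ c a → c a) (same R) (value R)) (input s _ (≰⇒> λ b≤v →
          nz (m≤n⇒m∸n≡0 (subst₂ _≤_ (sym (base≡ R)) (sym (value R)) b≤v))))))))
    where
    base≡ : ∀ {σ′ v} → Result σ d v σ′ → regs σ′ 0 ≡ base
    base≡ R = trans (keep (keeps R) 0 (≤-trans (s≤s z≤n) 16≤d)) (base-reg s)
  compile-correct (arr t e) {d = d} {π} {μ} {ρ} {σ} 16≤d s h =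
    seqE (compile-correct e 16≤d s h) λ {σ′} R →
    setE (setResult {σ = σ} {σ′ = σ′} _ (keeps R) (same R)
      (trans (cong₂ (λ c a → c a) (same R)
        (cong₂ (λ b i → b + (double i + offset t))
          (trans (keep (keeps R) 0 (≤-trans (s≤s z≤n) 16≤d)) (base-reg s)) (value R)))
        (arrays s t _)))
  compile-correct (e ⊞ e′) 16≤d s h =
    binary-correct e e′ 16≤d s h _⊕_ _+_ refl refl
  compile-correct (e ⊟ e′) 16≤d s h =
    binary-correct e e′ 16≤d s h _⊖_ _∸_ refl refl
  compile-correct (ifz c a b) {r} {d} {π} {μ} {ρ} {σ} 16≤d s h =
    seqE (compile-correct c 16≤d s h) λ {σ′} R →
    let s′ = sim-keep 16≤d (keeps R) (same R) s
        h′ = holds-keep (keeps R) h in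
    ifE (λ z → weaken ≤-refl
           (subst (λ v → Result σ d v _) (caseZ-zero (trans (sym (value R)) z)) ∘ chain R)
           (compile-correct a {μ = μ} 16≤d s′ h′))
        (λ nz → weaken ≤-refl
           (subst (λ v → Result σ d v _) (caseZ-suc (nz ∘ trans (value R))) ∘ chain R)
           (compile-correct b {μ = μ} 16≤d s′ h′))
    where
    caseZ-zero : ∀ {c a b} → c ≡ 0 → a ≡ caseZ c a b
    caseZ-zero refl = refl
    caseZ-suc : ∀ {c a b} → c ≢ 0 → b ≡ caseZ c a b
    caseZ-suc {zero}  nz = contradiction refl nz
    caseZ-suc {suc _} nz = refl
    chain : ∀ {σ′ σ″ v w} → Result σ d w σ′ → Result σ′ d v σ″ → Result σ d v σ″
    chain R R′ = record { value = value R′ ; keeps = keeps-trans ≤-refl (keeps R) (keeps R′)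
                        ; same = trans (same R′) (same R) }
  compile-correct (bind e b) {d = d} {μ = μ} {σ = σ} 16≤d s h =
    seqE (compile-correct e 16≤d s h) λ R →
    seqE (compile-correct b {μ = μ} (m≤n⇒m≤1+n 16≤d) (sim-keep 16≤d (keeps R) (same R) s)
           (holds-∷ ≤-refl (value R) (holds-≤ (n≤1+n d) (holds-keep (keeps R) h)))) λ {σ″} R′ →
    setE (setResult {σ = σ} {σ′ = σ″} _ (keeps-trans (n≤1+n d) (keeps R) (keeps R′))
           (trans (same R′) (same R)) (value R′))
  compile-correct (fold P e b o) {r} {d} {π} {μ} {ρ} {σ} 16≤d s h =
    seqE (compile-correct e 16≤d s h) λ {σ₁} R →
    seqE {s = 2} (setE {Q = Inv 0} record
      { total = trans (update-other (regs σ₁) 0 (<⇒≢ ≤-refl)) (value R)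
      ; idx  = update-same (regs σ₁) (1 + d) 0
      ; kept = keeps-trans (n≤1+n d) (keeps R) (keeps-set {σ = σ₁} 0 ≤-refl)
      ; cell≡ = same R }) λ inv →
    weaken ≤-refl (λ inv → record { value = total inv ; keeps = kept inv ; same = cell≡ inv })
      (loopE (π P) _ Inv
        (λ inv → idx inv , trans (keep (kept inv) _ (<-≤-trans (register<16 P) 16≤d)) (params s P))
        iteration inv)
    where
    value-at : ℕ → ℕ
    value-at i = iter i (λ i a → eval o π μ (a ∷ eval b π μ (i ∷ ρ) ∷ [])) (eval e π μ ρ)
    record Inv (i : ℕ) (σ′ : State) : Set where
      field
        total : regs σ′ d ≡ value-at i
        idx  : regs σ′ (1 + d) ≡ i
        kept : Keeps d σ σ′
        cell≡ : cells σ′ ≡ cells σ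
    open Inv
    iteration : ∀ {i σ′} → i < π P → Inv i σ′ →
                Exec _ σ′ (1 + time π b + (1 + time π o + (1 + 2 + 4))) (Inv (suc i))
    iteration {i} {σ′} _ inv =
      let s′ = sim-keep 16≤d (kept inv) (cell≡ inv) s in
      seqE (compile-correct b {μ = μ} 16≤2+d s′
             (holds-∷ ≤-refl (idx inv)
               (holds-≤ (≤-trans (n≤1+n d) (n≤1+n (1 + d))) (holds-keep (kept inv) h)))) λ {σ₂} R₂ →
      seqE (compile-correct o {μ = μ} (m≤n⇒m≤1+n 16≤2+d)
             (sim-keep 16≤2+d (keeps R₂) (same R₂) s′)
             (holds-∷ (m≤n⇒m≤1+n (n≤1+n (1 + d))) (trans (keep (keeps R₂) d (n≤1+n (1 + d))) (total inv))
               (holds-∷ ≤-refl (value R₂) holds-[]))) λ {σ₃} R₃ →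
      seqE {s = 2} (setE {Q = λ σ₄ → regs σ₄ d ≡ value-at (suc i) × regs σ₄ (1 + d) ≡ i ×
                                     Keeps d σ σ₄ × cells σ₄ ≡ cells σ}
             ( trans (update-same (regs σ₃) d _) (value R₃)
             , trans (update-other (regs σ₃) _ (<⇒≢ ≤-refl ∘ sym))
                 (trans (keep (keeps R₃) (1 + d) (n≤1+n (2 + d))) (trans (keep (keeps R₂) (1 + d) ≤-refl) (idx inv)))
             , keeps-trans {σ′ = σ₃} ≤-refl
                 (keeps-trans (≤-trans (n≤1+n d) (≤-trans (n≤1+n (1 + d)) (n≤1+n (2 + d))))
                    (keeps-trans (≤-trans (n≤1+n d) (n≤1+n (1 + d))) (kept inv) (keeps R₂)) (keeps R₃))
                 (keeps-set {σ = σ₃} _ ≤-refl)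
             , trans (same R₃) (trans (same R₂) (cell≡ inv)))) λ {σ₄} (p , q , kp , c) →
      setE record
        { total = trans (update-other (regs σ₄) _ (<⇒≢ ≤-refl)) p
        ; idx  = trans (update-same (regs σ₄) (1 + d) _) (trans (cong (_+ 1) q) (+-comm i 1))
        ; kept = keeps-trans {σ′ = σ₄} ≤-refl kp (keeps-set {σ = σ₄} _ (n≤1+n d))
        ; cell≡ = c }
      where
      16≤2+d : 16 ≤ 2 + d
      16≤2+d = m≤n⇒m≤1+n (m≤n⇒m≤1+n 16≤d)

-- Statements and whole programs

Program : Set
Program = List Instr

compileP : Program → Cmd
compileP []      = skip
compileP (i ∷ p) = compile₁ i ⨟ compileP p

module Execution (I : ℕ → ℕ) (base : ℕ) (I-end : ∀ a → base ≤ a → I a ≡ 0) where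
  open Semantics I
  open Simulation I base I-end
  open Sim
  open Result
  open Keeps

  execP : Program → Params × Mem → Params × Mem
  execP []      e = e
  execP (i ∷ p) e = execP p (exec₁ i e)

  timeP : Program → Params × Mem → ℕ
  timeP []      e = 1
  timeP (i ∷ p) e = 1 + time₁ (proj₁ e) i + timeP p (exec₁ i e)

  sim-store : ∀ {π μ σ} t i v → Sim π μ σ →
              Sim π (write μ t i v) ⟨ regs σ , cells σ [ address t i ↦ v ] ⟩
  sim-store {π} {μ} {σ} t i v s = record
    { base-reg = base-reg s
    ; params   = params s
    ; input    = λ a a<base → trans (update-other (cells σ) v
                   (<⇒≢ (<-≤-trans a<base (m≤m+n base _)))) (input s a a<base)
    ; arrays   = stored }
    where
    stored : ∀ t′ i′ → (cells σ [ address t i ↦ v ]) (address t′ i′) ≡ write μ t i v t′ i′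
    stored t′ i′ with offset t′ ≟ offset t
    ... | no t≢ = trans (update-other (cells σ) v (t≢ ∘ proj₁ ∘ address-injective {t′} {t} {i′} {i}))
                    (trans (arrays s t′ i′) (sym (cong (λ b → if b then (if i′ ≡ᵇ i then v else μ t′ i′) else μ t′ i′) (≢⇒≡ᵇ t≢))))
    ... | yes t≡ with i′ ≟ i
    ...   | no i≢ = trans (update-other (cells σ) v (i≢ ∘ proj₂ ∘ address-injective {t′} {t} {i′} {i}))
                    (trans (arrays s t′ i′) (sym (cong₂ (λ b c → if b then (if c then v else μ t′ i′) else μ t′ i′)
                      (trans (cong (_≡ᵇ offset t) t≡) (≡ᵇ-refl (offset t))) (≢⇒≡ᵇ i≢))))
    ...   | yes refl = trans (cong (cells σ [ address t i ↦ v ]) (cong (λ o → base + (double i + o)) t≡))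
                    (trans (update-same (cells σ) (address t i) v)
                     (sym (cong₂ (λ b c → if b then (if c then v else μ t′ i) else μ t′ i)
                      (trans (cong (_≡ᵇ offset t) t≡) (≡ᵇ-refl (offset t))) (≡ᵇ-refl i))))

  sim-set : ∀ {π μ σ d v} → 16 ≤ d → Sim π μ σ → Sim π μ ⟨ regs σ [ d ↦ v ] , cells σ ⟩
  sim-set {σ = σ} {v = v} 16≤d s = sim-keep 16≤d (keeps-set {σ = σ} v ≤-refl) refl s

  sim-result : ∀ {π μ σ σ′ d v} → 16 ≤ d → Sim π μ σ → Result σ d v σ′ → Sim π μ σ′
  sim-result 16≤d s R = sim-keep 16≤d (keeps R) (same R) s

  compileS-correct : ∀ {k} (s : Stmt k) {r d π μ ρ σ} → 16 ≤ d → Sim π μ σ → Holds r d ρ σ →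
    Exec (compileS s r d) σ (timeS π s) (λ σ′ → Sim π (exec s π ρ μ) σ′ × Keeps d σ σ′)
  compileS-correct (store t i e) {d = d} {π} {μ} {ρ} 16≤d s h =
    seqE (compile-correct i 16≤d s h) λ R →
    seqE (compile-correct e {μ = μ} (m≤n⇒m≤1+n 16≤d) (sim-result 16≤d s R)
           (holds-≤ (n≤1+n d) (holds-keep (keeps R) h))) λ {σ″} R′ →
    let s″ = sim-result (m≤n⇒m≤1+n 16≤d) (sim-result 16≤d s R) R′ in
    setMemE (subst₂ (λ a v → Sim π (write μ t (eval i π μ ρ) (eval e π μ ρ)) ⟨ regs σ″ , cells σ″ [ a ↦ v ] ⟩)
              (cong₂ (λ b x → b + (double x + offset t)) (sym (base-reg s″))
                (sym (trans (keep (keeps R′) d ≤-refl) (value R))))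
              (sym (value R′))
              (sim-store t (eval i π μ ρ) (eval e π μ ρ) s″)
            , keeping (keep (keeps-trans (n≤1+n d) (keeps R) (keeps R′))))
  compileS-correct (s₁ ⨾ s₂) 16≤d s h =
    seqE (compileS-correct s₁ 16≤d s h) λ (s′ , kp) →
    weaken ≤-refl (λ (s″ , kp′) → s″ , keeps-trans ≤-refl kp kp′)
      (compileS-correct s₂ 16≤d s′ (holds-keep kp h))
  compileS-correct (when c a b) {d = d} {π} {μ} {ρ} {σ} 16≤d s h =
    seqE (compile-correct c 16≤d s h) λ R →
    ifE (λ z → weaken ≤-refl (λ (s′ , kp) →
             subst (λ v → Sim π (caseZ v _ _) _) (trans (sym z) (value R)) s′
             , keeps-trans ≤-refl (keeps R) kp)
           (compileS-correct a 16≤d (sim-result 16≤d s R) (holds-keep (keeps R) h)))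
        (λ nz → weaken ≤-refl (λ (s′ , kp) →
             subst (λ μ′ → Sim π μ′ _) (caseZ-suc (nz ∘ trans (value R))) s′
             , keeps-trans ≤-refl (keeps R) kp)
           (compileS-correct b 16≤d (sim-result 16≤d s R) (holds-keep (keeps R) h)))
    where
    caseZ-suc : ∀ {A : Set} {c} {a b : A} → c ≢ 0 → b ≡ caseZ c a b
    caseZ-suc {c = zero}  nz = contradiction refl nz
    caseZ-suc {c = suc _} nz = refl
  compileS-correct (bindS e s₁) {d = d} 16≤d s h =
    seqE (compile-correct e 16≤d s h) λ R →
    weaken ≤-refl (λ (s″ , kp′) → s″ , keeps-trans (n≤1+n d) (keeps R) kp′)
      (compileS-correct s₁ (m≤n⇒m≤1+n 16≤d) (sim-result 16≤d s R)
        (holds-∷ ≤-refl (value R) (holds-≤ (n≤1+n d) (holds-keep (keeps R) h))))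
  compileS-correct (for P s₁) {d = d} {π} {μ} {ρ} {σ} 16≤d s h =
    seqE {s = 2} (setE {Q = Inv 0} (sim-set {σ = σ} 16≤d s
      , update-same (regs σ) d 0 , keeps-set {σ = σ} 0 ≤-refl)) λ inv →
    weaken ≤-refl (λ (s′ , _ , kp) → s′ , kp)
      (loopE (π P) _ Inv (λ (s′ , idx , kp) → idx , params s′ P)
        (λ {i} _ (s′ , idx , kp) →
          seqE (compileS-correct s₁ (m≤n⇒m≤1+n 16≤d) s′
                 (holds-∷ ≤-refl idx (holds-≤ (n≤1+n d) (holds-keep kp h)))) λ {σ″} (s″ , kp′) →
          setE (sim-set {σ = σ″} 16≤d s″
               , trans (update-same (regs σ″) d _)
                   (trans (cong (_+ 1) (trans (keep kp′ d ≤-refl) idx)) (+-comm i 1))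
               , keeps-trans ≤-refl (keeps-trans (n≤1+n d) kp kp′) (keeps-set {σ = σ″} _ ≤-refl)))
        inv)
    where
    Inv : ℕ → State → Set
    Inv i σ′ = Sim π (iter i (λ i → exec s₁ π (i ∷ ρ)) μ) σ′ × regs σ′ d ≡ i × Keeps d σ σ′

  compile₁-correct : ∀ i {e σ} → Sim (proj₁ e) (proj₂ e) σ →
    Exec (compile₁ i) σ (time₁ (proj₁ e) i) (λ σ′ → Sim (proj₁ (exec₁ i e)) (proj₂ (exec₁ i e)) σ′)
  compile₁-correct (assign P e) {σ = σ} s =
    seqE (compile-correct e ≤-refl s holds-[]) λ {σ′} R →
    let s′ = sim-result ≤-refl s R in
    setE record
      { base-reg = trans (update-other (regs σ′) _ (0<register P ∘ sym)) (base-reg s′)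
      ; params   = λ P′ → cong₂ (if register P′ ≡ᵇ register P then_else_) (value R) (params s′ P′)
      ; input    = input s′
      ; arrays   = arrays s′ }
  compile₁-correct (perform s₁) s =
    weaken ≤-refl proj₁ (compileS-correct s₁ ≤-refl s holds-[])

  compileP-correct : ∀ p {e σ} → Sim (proj₁ e) (proj₂ e) σ →
    Exec (compileP p) σ (timeP p e) (λ σ′ → Sim (proj₁ (execP p e)) (proj₂ (execP p e)) σ′)
  compileP-correct []      {σ = σ} s = σ , 1 , skip , ≤-refl , s
  compileP-correct (i ∷ p) s =
    seqE (compile₁-correct i s) (compileP-correct p)

-- Formulas as terms

infix  5 _≐_ _≼_
infixr 4 _∧′_
infixr 3 _⇒′_

-- A deep embedding gives each check two readings: as a term that the program executes and as a
-- proposition about the memory.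
data Fm (k : ℕ) : Set where
  _≐_ _≼_          : Tm k → Tm k → Fm k
  _∧′_ _∨′_ _⇒′_   : Fm k → Fm k → Fm k
  ¬′_              : Fm k → Fm k
  all′ ex′         : Param → Fm (suc k) → Fm k

-- A formula holds iff its term evaluates to 0.
term : ∀ {k} → Fm k → Tm k
term (a ≐ b)    = (a ⊟ b) ⊞ (b ⊟ a)
term (a ≼ b)    = a ⊟ b
term (φ ∧′ ψ)   = ifz (term φ) (term ψ) (num 1)
term (φ ∨′ ψ)   = ifz (term φ) (num 0) (term ψ)
term (φ ⇒′ ψ)   = ifz (term φ) (term ψ) (num 0)
term (¬′ φ)     = ifz (term φ) (num 1) (num 0)
term (all′ P φ) = fold P (num 0) (term φ) (ifz (var 1F) (var 0F) (num 1))
term (ex′ P φ)  = fold P (num 1) (term φ) (ifz (var 1F) (num 0) (var 0F))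

-- `a ∸ (a ∸ b)` is the minimum of `a` and `b`. The fold starts from `pINF`, which exceeds the
-- weight of every vertex set.
sumT minT : ∀ {k} → Param → Tm (suc k) → Tm k
sumT P e = fold P (num 0) e (var 0F ⊞ var 1F)
minT P e = fold P (par pINF) e (var 0F ⊟ (var 0F ⊟ var 1F))

∑ : ℕ → (ℕ → ℕ) → ℕ
∑ n f = iter n (λ i a → a + f i) 0

module Formulas (I : ℕ → ℕ) where
  open Semantics I

  ⟪_⟫ : ∀ {k} → Fm k → Params → Mem → Vec ℕ k → Set
  ⟪ a ≐ b ⟫    π μ ρ = eval a π μ ρ ≡ eval b π μ ρ
  ⟪ a ≼ b ⟫    π μ ρ = eval a π μ ρ ≤ eval b π μ ρ
  ⟪ φ ∧′ ψ ⟫   π μ ρ = ⟪ φ ⟫ π μ ρ × ⟪ ψ ⟫ π μ ρ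
  ⟪ φ ∨′ ψ ⟫   π μ ρ = ⟪ φ ⟫ π μ ρ ⊎ ⟪ ψ ⟫ π μ ρ
  ⟪ φ ⇒′ ψ ⟫   π μ ρ = ⟪ φ ⟫ π μ ρ → ⟪ ψ ⟫ π μ ρ
  ⟪ ¬′ φ ⟫     π μ ρ = ¬ ⟪ φ ⟫ π μ ρ
  ⟪ all′ P φ ⟫ π μ ρ = ∀ i → i < π P → ⟪ φ ⟫ π μ (i ∷ ρ)
  ⟪ ex′ P φ ⟫  π μ ρ = ∃[ i ] i < π P × ⟪ φ ⟫ π μ (i ∷ ρ)

  private
    case-true : ∀ {c a b : ℕ} → c ≡ 0 → caseZ c a b ≡ a
    case-true refl = refl

    all-sound : ∀ n {f : ℕ → ℕ} → iter n (λ i a → caseZ (f i) a 1) 0 ≡ 0 →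
                ∀ i → i < n → f i ≡ 0
    all-sound (suc n) {f} eq i i<n with f n in fn
    ... | zero with m≤n⇒m<n∨m≡n (s≤s⁻¹ i<n)
    ...   | inj₁ i<n′ = all-sound n eq i i<n′
    ...   | inj₂ refl = fn

    all-complete : ∀ n {f : ℕ → ℕ} → (∀ i → i < n → f i ≡ 0) →
                   iter n (λ i a → caseZ (f i) a 1) 0 ≡ 0
    all-complete zero    h = refl
    all-complete (suc n) h =
      trans (case-true (h n ≤-refl)) (all-complete n (λ i i<n → h i (m≤n⇒m≤1+n i<n)))

    ex-sound : ∀ n {f : ℕ → ℕ} → iter n (λ i a → caseZ (f i) 0 a) 1 ≡ 0 →
               ∃[ i ] i < n × f i ≡ 0
    ex-sound (suc n) {f} eq with f n in fn
    ... | zero  = n , ≤-refl , fn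
    ... | suc _ with ex-sound n eq
    ...   | i , i<n , fi = i , m≤n⇒m≤1+n i<n , fi

    ex-complete : ∀ n {f : ℕ → ℕ} i → i < n → f i ≡ 0 →
                  iter n (λ i a → caseZ (f i) 0 a) 1 ≡ 0
    ex-complete (suc n) {f} i i<n fi with f n in fn
    ... | zero  = refl
    ... | suc _ with m≤n⇒m<n∨m≡n (s≤s⁻¹ i<n)
    ...   | inj₁ i<n′ = ex-complete n i i<n′ fi
    ...   | inj₂ refl = contradiction (trans (sym fn) fi) λ ()

  -- The two directions are mutual, because implication and negation are contravariant in their
  -- premise.
  sound    : ∀ {k} (φ : Fm k) {π μ ρ} → eval (term φ) π μ ρ ≡ 0 → ⟪ φ ⟫ π μ ρ
  complete : ∀ {k} (φ : Fm k) {π μ ρ} → ⟪ φ ⟫ π μ ρ → eval (term φ) π μ ρ ≡ 0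

  sound (a ≐ b) {π} {μ} {ρ} eq =
    ≤-antisym (m∸n≡0⇒m≤n (m+n≡0⇒m≡0 _ eq))
              (m∸n≡0⇒m≤n (m+n≡0⇒n≡0 (eval a π μ ρ ∸ eval b π μ ρ) eq))
  sound (a ≼ b) eq = m∸n≡0⇒m≤n eq
  sound (φ ∧′ ψ) {π} {μ} {ρ} eq with eval (term φ) π μ ρ in z
  ... | zero = sound φ z , sound ψ eq
  sound (φ ∨′ ψ) {π} {μ} {ρ} eq with eval (term φ) π μ ρ in z
  ... | zero  = inj₁ (sound φ z)
  ... | suc _ = inj₂ (sound ψ eq)
  sound (φ ⇒′ ψ) eq h = sound ψ (trans (sym (case-true (complete φ h))) eq)
  sound (¬′ φ) eq h = contradiction (trans (sym eq) (case-true (complete φ h))) λ ()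
  sound (all′ P φ) {π} eq i i<n = sound φ (all-sound (π P) eq i i<n)
  sound (ex′ P φ) {π} eq with ex-sound (π P) eq
  ... | i , i<n , z = i , i<n , sound φ z

  complete (a ≐ b) {π} {μ} {ρ} eq = cong₂ _+_ (m≤n⇒m∸n≡0 (≤-reflexive eq)) (m≤n⇒m∸n≡0 (≤-reflexive (sym eq)))
  complete (a ≼ b) le = m≤n⇒m∸n≡0 le
  complete (φ ∧′ ψ) (p , q) = trans (case-true (complete φ p)) (complete ψ q)
  complete (φ ∨′ ψ) (inj₁ p) = case-true (complete φ p)
  complete (φ ∨′ ψ) {π} {μ} {ρ} (inj₂ q) with eval (term φ) π μ ρ
  ... | zero  = refl
  ... | suc _ = complete ψ q
  complete (φ ⇒′ ψ) {π} {μ} {ρ} h with eval (term φ) π μ ρ in z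
  ... | zero  = complete ψ (h (sound φ z))
  ... | suc _ = refl
  complete (¬′ φ) {π} {μ} {ρ} h with eval (term φ) π μ ρ in z
  ... | zero  = contradiction (sound φ z) h
  ... | suc _ = refl
  complete (all′ P φ) {π} h = all-complete (π P) (λ i i<n → complete φ (h i i<n))
  complete (ex′ P φ) {π} (i , i<n , p) = ex-complete (π P) i i<n (complete φ p)

-- The algorithm

module _ {k : ℕ} where
  -- The input consists of ℓ, n, the n bits of the target set, the number E of edges, their 2E
  -- endpoints, m, the root, and one record per node; so the root is at address 4 + n + 2E.
  rootT : Tm k
  rootT = inp (num 4 ⊞ par pn ⊞ par pE ⊞ par pE)

  -- The stored parent of the root is arbitrary. It is replaced by the sentinel `m`, so that the
  -- root delivers its table to a parent like any other node.
  parT sizeT : Fin k → Tm k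
  parT x  = ifz (term (var x ≐ rootT)) (par pm) (inp (arr BP (var x)))
  sizeT x = inp (num 1 ⊞ arr BP (var x))

  vertexT : Fin k → Fin k → Tm k
  vertexT x q = inp (num 2 ⊞ arr BP (var x) ⊞ var q)

  timesT : Param → Fin k → Tm k
  timesT P x = fold P (num 0) (var (suc x)) (var 0F ⊞ var 1F)

-- Division by `pB` by counting: the accumulator grows as long as its successor times `pB` is at
-- most `s`. A state is below `pK`, so `pK` rounds suffice. The operation of a fold sees only
-- accumulator and element, hence `s` is passed as the element.
quotT : ∀ {k} → Fin k → Tm k
quotT s = fold pK (num 0) (var (suc s))
  (bind (num 1 ⊞ var 0F) (ifz (timesT pB 0F ⊟ var 2F) (var 0F) (var 1F)))

-- The state s of a bag is a number with D = 4 b digits to the base B; the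
-- digits 4 q, …, 4 q + 3 of s label the q-th vertex of the bag.
digitT : ∀ {k} → ℕ → Fin k → Fin k → Tm k
digitT f s q =
  bind (fold pD (var s)
         (num 1 ⊞ var 0F ⊟ (num f ⊞ (var (suc q) ⊞ var (suc q) ⊞ var (suc q) ⊞ var (suc q))))
         (ifz (var 1F) (quotT 0F) (var 0F)))
       (bind (quotT 0F) (var 1F ⊟ timesT pB 0F))

module _ {k : ℕ} where
  stepT forceT inT outT : Fin k → Fin k → Tm k
  stepT  = digitT 0
  forceT = digitT 1
  inT    = digitT 2
  outT   = digitT 3

  ∀slot ∃slot : Fin k → Fm (suc k) → Fm k
  ∀slot i φ = all′ pb ((num 1 ⊞ var 0F) ≼ sizeT (suc i) ⇒′ φ)
  ∃slot i φ = ex′ pb ((num 1 ⊞ var 0F) ≼ sizeT (suc i) ∧′ φ)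

  -- At the root the parent is the sentinel with its empty bag, so that every vertex of the root is
  -- at its top.
  topF : Fin k → Fin k → Fin k → Fm k
  topF i p q = ¬′ (∃slot p (vertexT (suc i) (suc q) ≐ vertexT (suc p) 0F))

  -- Entry u n + v of an adjacency matrix; the multiples of n are tabulated in `MN` for want of
  -- multiplication.
  adjF : Fin k → Fin k → Fin k → Fm k
  adjF i q q′ = num 1 ≼ arr ADJ (arr MN (vertexT i q) ⊞ vertexT i q′)

-- In the following formulas, variable 3 is a node, variable 2 its parent, and
-- variables 0 and 1 are states of the node and of its parent.
compatF downF localF checkF : Fm 5
compatF =
  ∀slot 3F (∀slot 3F (vertexT 5F 1F ≐ vertexT 4F 0F ⇒′
    stepT 2F 1F ≐ stepT 3F 0F ∧′
    forceT 2F 1F ≐ forceT 3F 0F ∧′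
    (¬′ (outT 2F 1F ≐ num 0) ⇒′ outT 3F 0F ≐ num 2 ⊞ arr SD (var 5F))))
downF =
  ∀slot 2F (inT 2F 0F ≐ num 2 ⊞ arr SD (var 4F) ⇒′
    ∃slot 4F (vertexT 5F 0F ≐ vertexT 4F 1F ∧′ ¬′ (inT 2F 0F ≐ num 0)))
localF =
  ∀slot 3F
    ( (num 1 ⊞ inT 1F 0F) ≼ num 2 ⊞ arr NC (var 4F)
    ∧′ (inT 1F 0F ≐ num 1 ⇒′
         ∃slot 4F (adjF 5F 1F 0F ∧′ forceT 2F 0F ≐ stepT 2F 1F))
    ∧′ (topF 4F 3F 0F ⇒′ num 1 ≼ stepT 1F 0F ⇒′ stepT 1F 0F ≼ par pℓ ⇒′
         ¬′ (inT 1F 0F ≐ num 0))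
    ∧′ (num 1 ≼ inp (num 2 ⊞ vertexT 4F 0F) ⇒′ stepT 1F 0F ≼ par pℓ)
    ∧′ (¬′ (forceT 1F 0F ≐ num 0) ⇒′ (num 1 ⊞ stepT 1F 0F) ≼ forceT 1F 0F)
    ∧′ ∀slot 4F (adjF 5F 1F 0F ⇒′
        ((¬′ (forceT 2F 1F ≐ num 0) ⇒′ stepT 2F 0F ≼ forceT 2F 1F)
      ∧′ (topF 5F 4F 1F ∨′ topF 5F 4F 0F ⇒′ num 2 ≼ forceT 2F 1F ⇒′
          stepT 2F 0F ≐ forceT 2F 1F ⇒′
          outT 2F 1F ≐ num 1
        ∧′ ∀slot 5F (adjF 6F 2F 0F ⇒′ stepT 3F 0F ≐ forceT 3F 2F ⇒′
             vertexT 6F 0F ≐ vertexT 6F 1F)))))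
checkF = compatF ∧′ downF ∧′ localF

weightT nodeCostT : Tm 5
weightT = sumT pb
  (ifz (term ((num 1 ⊞ var 0F) ≼ sizeT 4F ∧′ topF 4F 3F 0F ∧′ stepT 1F 0F ≐ num 0))
       (par pTW ⊞ arr PW (vertexT 4F 0F)) (num 0))
nodeCostT = ifz (term checkF) weightT (par pINF)

bagPointers powers multiples adjacency siblings dynamic output : Stmt 0

-- Records of nodes vary in length, so their addresses are tabulated. The last round sets the entry
-- of the sentinel.
bagPointers =
  store BP (num 0) (num 5 ⊞ par pn ⊞ par pE ⊞ par pE) ⨾
  for pm (store BP (num 1 ⊞ var 0F) (num 2 ⊞ arr BP (var 0F) ⊞ sizeT 0F))

powers =
  store PW (num 0) (num 1) ⨾
  for pn (store PW (num 1 ⊞ var 0F) (arr PW (var 0F) ⊞ arr PW (var 0F)))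

multiples =
  for pn (store MN (num 1 ⊞ var 0F) (par pn ⊞ arr MN (var 0F)))

adjacency =
  for pE
    (bindS (inp (num 3 ⊞ par pn ⊞ var 0F ⊞ var 0F))
    (bindS (inp (num 4 ⊞ par pn ⊞ var 1F ⊞ var 1F))
    ( store ADJ (arr MN (var 1F) ⊞ var 0F) (num 1)
    ⨾ store ADJ (arr MN (var 0F) ⊞ var 1F) (num 1))))

-- The running count of the children of the parent, read before it is incremented, numbers each
-- child among its siblings.
siblings =
  for pm
    (bindS (parT 0F)
    ( store SD (var 1F) (arr NC (var 0F))
    ⨾ store NC (var 0F) (num 1 ⊞ arr NC (var 0F))))

-- The first conjunct matters because the cursor can stand at the sentinel or beyond.
readyF : Fm 2
readyF = (num 1 ⊞ var 0F) ≼ par pm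
       ∧′ arr DONE (var 0F) ≐ num 0
       ∧′ arr DN (var 0F) ≐ arr NC (var 0F)

messageT : Tm 4
messageT = minT pK (nodeCostT ⊞ arr TAB (timesT pK 3F ⊞ var 0F))

-- Abstracted over the message `e`, so that the main loop is verified from the specification
-- `Delivers` without unfolding `messageT`.
addToTable : Tm 4 → Stmt 4
addToTable e = store TAB (timesT pK 1F ⊞ var 0F) (arr TAB (timesT pK 1F ⊞ var 0F) ⊞ e)

absorbWith : Tm 4 → Stmt 3
absorbWith e = for pK (addToTable e)
             ⨾ store DONE (var 1F) (num 1)
             ⨾ store DN (var 0F) (num 1 ⊞ arr DN (var 0F))
             ⨾ store CUR (num 0) (var 0F)

absorb : Stmt 2
absorb = bindS (parT 0F) (absorbWith messageT)

-- `CUR 0` is the current node, `CUR 1` the next one in the numbering from which a climb will start.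
advance : Stmt 2
advance = store CUR (num 0) (arr CUR (num 1))
        ⨾ store CUR (num 1) (num 1 ⊞ arr CUR (num 1))

-- Every round finishes a node or advances. At most m rounds finish one, so that `1 + m + m` rounds
-- include m + 1 advances, which carry the scan past all nodes.
dynamic = for pIT (bindS (arr CUR (num 0)) (when (term readyF) absorb advance))

output =
  when (par pE)
    (for pn (store OUT (var 0F) (inp (num 2 ⊞ var 0F))))
    ( store CUR (num 2)
        -- The optimum is in the table of the sentinel at state 0. Reducing it modulo 2ⁿ takes one
        -- subtraction per vertex of the set, hence at most n rounds.
        (fold pn (bind (par pm) (arr TAB (timesT pK 0F))) (par pTW)
          (ifz (var 1F ⊟ var 0F) (var 0F ⊟ var 1F) (var 0F)))
    -- The binary expansion of the remainder, from the highest bit down.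
    ⨾ for pn (bindS (par pn ⊟ (num 1 ⊞ var 0F))
        (when (arr PW (var 0F) ⊟ arr CUR (num 2))
          ( store OUT (var 0F) (num 1)
          ⨾ store CUR (num 2) (arr CUR (num 2) ⊟ arr PW (var 0F)))
          (store OUT (var 0F) (num 0)))))

program : Program
program =
    perform bagPointers
  ∷ assign pb (fold pm (num 0) (sizeT 0F) (var 0F ⊞ (var 1F ⊟ var 0F)))
  ∷ assign pD (par pb ⊞ par pb ⊞ par pb ⊞ par pb)
  ∷ assign pℓ (inp (num 0))
  -- Base 1 leaves a single state, so that the main loop is cheap on a graph without edges, where
  -- `output` copies the target set instead.
  ∷ assign pB (ifz (par pE) (num 1) (num 3 ⊞ par pℓ))
  ∷ assign pK (fold pD (num 1) (num 0) (timesT pB 0F))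
  ∷ perform powers
  ∷ assign pTW (arr PW (par pn))
  -- (n + 1) 2ⁿ exceeds the weight of the set of all vertices, which is n 2ⁿ plus a number below 2ⁿ.
  ∷ assign pINF (fold pn (par pTW) (par pTW) (var 0F ⊞ var 1F))
  ∷ perform multiples
  ∷ perform adjacency
  ∷ perform siblings
  ∷ assign pIT (num 1 ⊞ par pm ⊞ par pm)
  ∷ perform dynamic
  ∷ perform output
  ∷ []

prelude postlude algorithm : Cmd

-- Besides n, E and m, register 0 receives a bound on the length of the input. A record has at most
-- 2 + n entries, so the bound is found without parsing the bags.
prelude =
  (reg (register pn) ≔ mem (lit 1)) ⨟
  ((reg (register pE) ≔ mem (lit 2 ⊕ reg (register pn))) ⨟
  ((reg (register pm) ≔ mem (((lit 3 ⊕ reg (register pn)) ⊕ reg (register pE)) ⊕ reg (register pE))) ⨟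
  ((reg 0 ≔ (((lit 5 ⊕ reg (register pn)) ⊕ reg (register pE)) ⊕ reg (register pE))) ⨟
  (while≢0 (reg (register pm) ⊖ reg 16) loop
    ((reg 0 ≔ (reg 0 ⊕ (lit 2 ⊕ reg (register pn)))) ⨟
     (reg 16 ≔ (reg 16 ⊕ lit 1)))))))

-- Copying is safe because the arrays start at an address of at least n, so that only input cells
-- are overwritten.
postlude =
  (reg 16 ≔ lit 0) ⨟
  (while≢0 (reg (register pn) ⊖ reg 16) loop
    ((mem reg 16 ≔ mem (cell OUT (reg 16))) ⨟
     (reg 16 ≔ (reg 16 ⊕ lit 1))))

algorithm = prelude ⨟ (compileP program ⨟ postlude)

-- Paths and tops in a rooted tree decomposition

adj-sym : ∀ {n} (H : Graph n) {u v} → Adj H u v → Adj H v u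
adj-sym H (inj₁ e) = inj₂ e
adj-sym H (inj₂ e) = inj₁ e

adj-irrefl : ∀ {n} (H : Graph n) {u v} → Adj H u v → u ≢ v
adj-irrefl H (inj₁ e) refl = Fin.<-irrefl refl (All.lookup (ordered H) e)
adj-irrefl H (inj₂ e) refl = Fin.<-irrefl refl (All.lookup (ordered H) e)

module _ {n} {H : Graph n} where

  walk-head : ∀ {i h vs} → IsWalk H i vs h → ∃[ ws ] vs ≡ i ∷ ws
  walk-head stop       = [] , refl
  walk-head (step _ w) = _ , refl

  walk-start : ∀ {i j h vs} → IsWalk H i vs h → IsWalk H j vs h → i ≡ j
  walk-start w w′ with walk-head w | walk-head w′
  ... | _ , refl | _ , refl = refl

  walk-start∈ : ∀ {i h vs} → IsWalk H i vs h → i ∈ₗ vs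
  walk-start∈ stop       = here refl
  walk-start∈ (step _ _) = here refl

  suffix : ∀ {i h x vs} → IsWalk H i vs h → Unique vs → x ∈ₗ vs →
           ∃[ ws ] IsPath H x h ws × (∀ {y} → y ∈ₗ ws → y ∈ₗ vs)
  suffix stop       u       (here refl) = _ , (stop , u) , id
  suffix (step a w) u       (here refl) = _ , (step a w , u) , id
  suffix (step a w) (_ ∷ u) (there x∈)  with suffix w u x∈
  ... | ws , p , sub = ws , p , there ∘ sub

  -- A path on which a neighbour `x` of its start lies can be cut short by stepping to `x` at once.
  -- Where paths are unique, `x` must then be its second node.
  suffix-extend : ∀ {i h x vs} → IsPath H i h vs → Adj H i x → x ∈ₗ vs →
                  ∃[ ws ] IsPath H x h ws × IsPath H i h (i ∷ ws)
  suffix-extend (stop , _) a (here refl) = contradiction refl (adj-irrefl H a)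
  suffix-extend (step _ _ , _) a (here refl) = contradiction refl (adj-irrefl H a)
  suffix-extend (step _ w , i∉ ∷ u) a (there x∈) with suffix w u x∈
  ... | ws , (w′ , u′) , sub =
        ws , (w′ , u′) , (step a w′ , All.tabulate (All.lookup i∉ ∘ sub) ∷ u′)

module TreeFacts {n m} {G : Graph n} (D : NiceTreeDecomposition G m) where
  open NiceTreeDecomposition D
  open DecMembership (Fin._≟_ {m}) using () renaming (_∈?_ to _∈ₗ?_)

  -- The list of ancestors, starting with the node itself; `c ∈ₗ up o` serves as the ancestor
  -- relation.
  up : Fin m → List (Fin m)
  up i = proj₁ (proj₂ isTree i root)

  up-path : ∀ i → IsPath tree i root (up i)
  up-path i = proj₁ (proj₂ (proj₂ isTree i root))

  up-unique : ∀ {i vs} → IsPath tree i root vs → up i ≡ vs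
  up-unique {i} = proj₂ (proj₂ (proj₂ isTree i root))

  up-root : up root ≡ root ∷ []
  up-root = up-unique (stop , [] ∷ [])

  up-refl : ∀ i → i ∈ₗ up i
  up-refl i with walk-head (proj₁ (up-path i))
  ... | ws , eq = subst (i ∈ₗ_) (sym eq) (here refl)

  up-parent : ∀ {j} → j ≢ root → up j ≡ j ∷ up (parent j)
  up-parent {j} j≢ with parent-onPath j j≢
  ... | vs , p , par∈ with suffix-extend p (parent-adj j j≢) par∈
  ...   | ws , p′ , p″ = trans (up-unique p″) (cong (j ∷_) (sym (up-unique p′)))

  up-neighbour : ∀ {i x} → Adj tree x i → i ∈ₗ up x → up x ≡ x ∷ up i
  up-neighbour {i} {x} a i∈ with suffix-extend (up-path x) a i∈
  ... | ws , p′ , p″ = trans (up-unique p″) (cong (x ∷_) (sym (up-unique p′)))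

  up-injective : ∀ {i j} → up i ≡ up j → i ≡ j
  up-injective {i} {j} eq =
    walk-start (proj₁ (up-path i)) (subst (λ vs → IsWalk tree j vs root) (sym eq) (proj₁ (up-path j)))

  ∷up≢up-root : ∀ {x i} → up x ≡ x ∷ up i → x ≢ root
  ∷up≢up-root {i = i} eq refl with walk-head (proj₁ (up-path i)) | trans (sym up-root) eq
  ... | ws , up≡ | eq′ with trans (∷-injectiveʳ eq′) up≡
  ...   | ()

  parent-of : ∀ {x i} → up x ≡ x ∷ up i → x ≢ root × parent x ≡ i
  parent-of eq =
    x≢ , up-injective (∷-injectiveʳ (trans (sym (up-parent x≢)) eq))
    where x≢ = ∷up≢up-root eq

  -- Either `i` lies on the path from `x` to the root and is its second node, or putting `i` in
  -- front of that path gives the path of `i`.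
  adjacent-parent : ∀ {i x} → Adj tree i x →
                    (i ≢ root × parent i ≡ x) ⊎ (x ≢ root × parent x ≡ i)
  adjacent-parent {i} {x} a with i ∈ₗ? up x
  ... | yes i∈ = inj₂ (parent-of (up-neighbour (adj-sym tree a) i∈))
  ... | no i∉ = inj₁ (parent-of (up-unique
          (step a (proj₁ (up-path x)) ,
           All.tabulate (λ y∈ i≡y → i∉ (subst (_∈ₗ up x) (sym i≡y) y∈)) ∷ proj₂ (up-path x))))

  rank : Fin m → ℕ
  rank i = length (up i)

  rank-parent : ∀ {j} → j ≢ root → rank j ≡ suc (rank (parent j))
  rank-parent j≢ = cong length (up-parent j≢)

  rank-parent-< : ∀ {j} → j ≢ root → rank (parent j) < rank j
  rank-parent-< j≢ = ≤-reflexive (sym (rank-parent j≢))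

  climb : (P : Fin m → Set) → (∀ i → (i ≢ root → P (parent i)) → P i) → ∀ i → P i
  climb P f i = <-rec (λ r → ∀ i → rank i ≡ r → P i)
    (λ r ih i eq → f i λ i≢ → ih (subst (rank (parent i) <_) eq (rank-parent-< i≢)) (parent i) refl)
    (rank i) i refl

  up-cases : ∀ {c o} → c ∈ₗ up o → c ≡ o ⊎ (o ≢ root × c ∈ₗ up (parent o))
  up-cases {c} {o} c∈ with o Fin.≟ root
  ... | yes refl with subst (c ∈ₗ_) up-root c∈
  ...   | here c≡ = inj₁ c≡
  up-cases {c} {o} c∈ | no o≢ with subst (c ∈ₗ_) (up-parent o≢) c∈
  ... | here c≡  = inj₁ c≡
  ... | there c∈′ = inj₂ (o≢ , c∈′)

  up-step : ∀ {c o} → o ≢ root → c ∈ₗ up (parent o) → c ∈ₗ up o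
  up-step {c} o≢ c∈ = subst (c ∈ₗ_) (sym (up-parent o≢)) (there c∈)

  up-trans : ∀ {a b c} → a ∈ₗ up b → b ∈ₗ up c → a ∈ₗ up c
  up-trans {a} {b} {c} a∈ = climb (λ c → b ∈ₗ up c → a ∈ₗ up c)
    (λ c ih b∈ → [ (λ b≡c → subst (λ c → a ∈ₗ up c) b≡c a∈)
                 , (λ (c≢ , b∈′) → up-step c≢ (ih c≢ b∈′)) ]′ (up-cases b∈)) c

  parent∈up : ∀ {j} → j ≢ root → parent j ∈ₗ up j
  parent∈up j≢ = up-step j≢ (up-refl _)

  up-rank : ∀ {c o} → c ∈ₗ up o → c ≡ o ⊎ rank c < rank o
  up-rank {c} {o} = climb (λ o → c ∈ₗ up o → c ≡ o ⊎ rank c < rank o)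
    (λ o ih c∈ → [ inj₁ , (λ (o≢ , c∈′) → inj₂
        ([ (λ c≡ → subst (λ x → rank x < rank o) (sym c≡) (rank-parent-< o≢))
         , (λ c< → <-trans c< (rank-parent-< o≢)) ]′ (ih o≢ c∈′))) ]′ (up-cases c∈)) o

  up-antisym : ∀ {i j} → i ∈ₗ up j → j ∈ₗ up i → i ≡ j
  up-antisym i∈ j∈ with up-rank i∈ | up-rank j∈
  ... | inj₁ eq | _       = eq
  ... | inj₂ _  | inj₁ eq = sym eq
  ... | inj₂ <₁ | inj₂ <₂ = contradiction <₁ (<-asym <₂)

  up-same-rank : ∀ {c c′ o} → c ∈ₗ up o → c′ ∈ₗ up o → rank c ≡ rank c′ → c ≡ c′
  up-same-rank {c} {c′} {o} = climb (λ o → c ∈ₗ up o → c′ ∈ₗ up o → rank c ≡ rank c′ → c ≡ c′) go o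
    where
    go : ∀ o → (o ≢ root → c ∈ₗ up (parent o) → c′ ∈ₗ up (parent o) → rank c ≡ rank c′ → c ≡ c′) →
         c ∈ₗ up o → c′ ∈ₗ up o → rank c ≡ rank c′ → c ≡ c′
    go o ih c∈ c′∈ eq with up-cases c∈ | up-cases c′∈
    ... | inj₂ (o≢ , p) | inj₂ (_ , q) = ih o≢ p q eq
    ... | inj₁ refl | _ with up-rank c′∈
    ...   | inj₁ eq′ = sym eq′
    ...   | inj₂ c′< = contradiction (sym eq) (<⇒≢ c′<)
    go o ih c∈ c′∈ eq | _ | inj₁ refl with up-rank c∈
    ...   | inj₁ eq′ = eq′
    ...   | inj₂ c<  = contradiction eq (<⇒≢ c<)

  child-unique : ∀ {c c′ o} → c ≢ root → c′ ≢ root → parent c ≡ parent c′ →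
                 c ∈ₗ up o → c′ ∈ₗ up o → c ≡ c′
  child-unique c≢ c′≢ eq c∈ c′∈ =
    up-same-rank c∈ c′∈ (trans (rank-parent c≢) (trans (cong (suc ∘ rank) eq) (sym (rank-parent c′≢))))

  -- Produces the path that the connectivity condition of the decomposition asks for, together with
  -- the fact that it meets every node between `o` and its ancestor `p`.
  segment : ∀ {p} o → p ∈ₗ up o →
            ∃[ vs ] IsPath tree o p vs × (∀ {y} → y ∈ₗ vs → y ∈ₗ up o) ×
                    (∀ {j} → j ∈ₗ up o → p ∈ₗ up j → j ∈ₗ vs)
  segment {p} = climb (λ o → p ∈ₗ up o → Segment o) go
    where
    Segment : Fin m → Set
    Segment o = ∃[ vs ] IsPath tree o p vs × (∀ {y} → y ∈ₗ vs → y ∈ₗ up o) ×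
                        (∀ {j} → j ∈ₗ up o → p ∈ₗ up j → j ∈ₗ vs)
    go : ∀ o → (o ≢ root → p ∈ₗ up (parent o) → Segment (parent o)) → p ∈ₗ up o → Segment o
    go o ih p∈ with up-cases p∈
    ... | inj₁ refl = o ∷ [] , (stop , [] ∷ []) , (λ { (here refl) → up-refl o })
                    , λ j∈ o∈ → here (up-antisym j∈ o∈)
    ... | inj₂ (o≢ , p∈′) with ih o≢ p∈′
    ...   | vs , (w , u) , sub , between =
            o ∷ vs
            , (step (parent-adj o o≢) w , All.tabulate (λ y∈ o≡y → o∉ (subst (_∈ₗ up (parent o)) (sym o≡y) (sub y∈))) ∷ u)
            , (λ { (here refl) → up-refl o ; (there y∈) → up-step o≢ (sub y∈) })
            , λ j∈ p∈j → [ here , (λ (_ , j∈′) → there (between j∈′ p∈j)) ]′ (up-cases j∈)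
      where
      o∉ : ¬ (o ∈ₗ up (parent o))
      o∉ o∈ with up-rank o∈
      ... | inj₁ o≡ = <⇒≢ (rank-parent-< o≢) (cong rank (sym o≡))
      ... | inj₂ o< = <-asym o< (rank-parent-< o≢)

  connected-up : ∀ {o p j v} → v ∈ bag o → v ∈ bag p → j ∈ₗ up o → p ∈ₗ up j → v ∈ bag j
  connected-up {o} {p} {j} {v} v∈o v∈p j∈ p∈ with segment o (up-trans p∈ j∈)
  ... | vs , path , _ , between = connected o p j (vs , path , between j∈ p∈) v v∈o v∈p

  Top : Fin m → Fin n → Set
  Top i v = i ≢ root → v ∉ bag (parent i)

  top-exists : ∀ {v} i → v ∈ bag i → ∃[ z ] v ∈ bag z × Top z v × z ∈ₗ up i
  top-exists {v} = climb (λ i → v ∈ bag i → ∃[ z ] v ∈ bag z × Top z v × z ∈ₗ up i) go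
    where
    go : ∀ i → (i ≢ root → v ∈ bag (parent i) → ∃[ z ] v ∈ bag z × Top z v × z ∈ₗ up (parent i)) →
         v ∈ bag i → ∃[ z ] v ∈ bag z × Top z v × z ∈ₗ up i
    go i ih v∈ with i Fin.≟ root
    ... | yes i≡ = i , v∈ , (λ i≢ → contradiction i≡ i≢) , up-refl i
    ... | no i≢ with v ∈? bag (parent i)
    ...   | no v∉ = i , v∈ , (λ _ → v∉) , up-refl i
    ...   | yes v∈′ with ih i≢ v∈′
    ...     | z , v∈z , top , z∈ = z , v∈z , top , up-step i≢ z∈

  -- A path that has gone down cannot turn upwards again, since it would return to the node it came
  -- from.
  descend : ∀ {i x h vs} → x ≢ root → parent x ≡ i → IsWalk tree x vs h → Unique (i ∷ vs) → i ∈ₗ up h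
  descend x≢ refl stop u = parent∈up x≢
  descend {x = x} x≢ refl (step {j = y} a w) ((_ ∷ i∉) ∷ u) with adjacent-parent a
  ... | inj₁ (_ , refl) = contradiction refl (All.lookup i∉ (walk-start∈ w))
  ... | inj₂ (y≢ , py≡x) = up-trans (parent∈up x≢) (descend y≢ py≡x w u)

  -- If the path from `i` to `h` began upwards, connectivity would put `v` into the bag of the
  -- parent of `i`; so it begins downwards and stays below `i`.
  top-above : ∀ {i h v} → v ∈ bag i → v ∈ bag h → Top i v → i ∈ₗ up h
  top-above {i} {h} {v} v∈i v∈h top = go (proj₁ (proj₂ (proj₂ isTree i h)))
    where
    go : ∀ {vs} → IsPath tree i h vs → i ∈ₗ up h
    go (stop , _) = up-refl i
    go path@(step a w , u) with adjacent-parent a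
    ... | inj₂ (x≢ , px≡i) = descend x≢ px≡i w u
    ... | inj₁ (i≢ , refl) =
      contradiction (connected i h (parent i) (_ , path , there (walk-start∈ w)) v v∈i v∈h) (top i≢)

  top-unique : ∀ {i h v} → v ∈ bag i → v ∈ bag h → Top i v → Top h v → i ≡ h
  top-unique v∈i v∈h ti th = up-antisym (top-above v∈i v∈h ti) (top-above v∈h v∈i th)

  -- The topmost bag that contains both vertices is one where at least one of them has its top.
  Owns : Fin m → Fin n → Fin n → Set
  Owns i u w = u ∈ bag i × w ∈ bag i × (Top i u ⊎ Top i w)

  owner-exists : ∀ {u w} i → u ∈ bag i → w ∈ bag i → ∃[ z ] Owns z u w
  owner-exists {u} {w} = climb (λ i → u ∈ bag i → w ∈ bag i → ∃[ z ] Owns z u w) go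
    where
    go : ∀ i → (i ≢ root → u ∈ bag (parent i) → w ∈ bag (parent i) → ∃[ z ] Owns z u w) →
         u ∈ bag i → w ∈ bag i → ∃[ z ] Owns z u w
    go i ih u∈ w∈ with i Fin.≟ root
    ... | yes i≡ = i , u∈ , w∈ , inj₁ λ i≢ → contradiction i≡ i≢
    ... | no i≢ with u ∈? bag (parent i) | w ∈? bag (parent i)
    ...   | no u∉  | _      = i , u∈ , w∈ , inj₁ λ _ → u∉
    ...   | yes _  | no w∉  = i , u∈ , w∈ , inj₂ λ _ → w∉
    ...   | yes u∈′ | yes w∈′ = ih i≢ u∈′ w∈′

  -- If different vertices have their tops at `i` and `j`, each of the two nodes is above the other.
  owner-unique : ∀ {i j u w} → Owns i u w → Owns j u w → i ≡ j
  owner-unique (u∈i , w∈i , inj₁ tu) (u∈j , w∈j , inj₁ tu′) = top-unique u∈i u∈j tu tu′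
  owner-unique (u∈i , w∈i , inj₂ tw) (u∈j , w∈j , inj₂ tw′) = top-unique w∈i w∈j tw tw′
  owner-unique (u∈i , w∈i , inj₁ tu) (u∈j , w∈j , inj₂ tw) =
    up-antisym (top-above u∈i u∈j tu) (top-above w∈j w∈i tw)
  owner-unique (u∈i , w∈i , inj₂ tw) (u∈j , w∈j , inj₁ tu) =
    up-antisym (top-above w∈i w∈j tw) (top-above u∈j u∈i tu)

-- Local labels

bounded : ∀ {m} (f : Fin m → ℕ) → ∃[ R ] ∀ i → f i ≤ R
bounded {zero}  f = 0 , λ ()
bounded {suc m} f with bounded (f ∘ suc)
... | R , h = f zero + R , λ { zero → m≤m+n _ _ ; (suc i) → ≤-trans (h i) (m≤n+m R _) }

subsetOf : ∀ {n} {P : Fin n → Set} → (∀ v → Dec (P v)) → Subset n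
subsetOf P? = Vec.tabulate (does ∘ P?)

∈-subsetOf⁺ : ∀ {n} {P : Fin n → Set} (P? : ∀ v → Dec (P v)) {v} → P v → v ∈ subsetOf P?
∈-subsetOf⁺ P? {v} p =
  lookup⇒[]= v _ (trans (lookup∘tabulate (does ∘ P?) v) (dec-true (P? v) p))

∈-subsetOf⁻ : ∀ {n} {P : Fin n → Set} (P? : ∀ v → Dec (P v)) {v} → v ∈ subsetOf P? → P v
∈-subsetOf⁻ P? {v} v∈ with P? v | trans (sym (lookup∘tabulate (does ∘ P?) v)) ([]=⇒lookup v∈)
... | yes p | _ = p

-- A bounded search with default value `N`; the property is claimed for the result only if it is
-- below `N`.
least : ∀ {P : ℕ → Set} → (∀ r → Dec (P r)) → ∀ N →
        ∃[ r ] r ≤ N × (∀ s → s < r → ¬ P s) × (r < N → P r)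
least P? zero    = 0 , z≤n , (λ _ ()) , λ ()
least P? (suc N) with P? 0
... | yes p = 0 , z≤n , (λ _ ()) , λ _ → p
... | no ¬p with least (P? ∘ suc) N
...   | r , r≤ , below , at = suc r , s≤s r≤
        , (λ { zero _ → ¬p ; (suc s) s< → below s (s≤s⁻¹ s<) }) , at ∘ s≤s⁻¹

module Labels {n m} {G : Graph n} (ℓ : ℕ) (V′ : Subset n) (D : NiceTreeDecomposition G m)
  (side arity : Fin m → ℕ) where
  open NiceTreeDecomposition D
  open TreeFacts D
  open DecMembership (Fin._≟_ {m}) using () renaming (_∈?_ to _∈ₗ?_)

  -- At the node i, a vertex v of its bag carries
  --   τ i v, the round in which v is dominated, or ℓ + 1 if it never is;
  --   γ i v, the round in which v dominates neighbours, or 0;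
  --   ε i v, the direction, seen from i, of a bag with a forcer of v;
  --   δ i v, the direction of the bag owning the edge along which v forces
  --          in a round ≥ 2.
  -- A direction is 0 for none or upwards, 1 for here, and 2 + c for the
  -- subtree of the child with number c.
  record Valid (τ γ ε δ : Fin m → Fin n → ℕ) : Set where
    field
      τ-parent : ∀ {j} → j ≢ root → ∀ {v} → v ∈ bag j → v ∈ bag (parent j) →
                 τ j v ≡ τ (parent j) v
      γ-parent : ∀ {j} → j ≢ root → ∀ {v} → v ∈ bag j → v ∈ bag (parent j) →
                 γ j v ≡ γ (parent j) v
      δ-parent : ∀ {j} → j ≢ root → ∀ {v} → v ∈ bag j → v ∈ bag (parent j) →
                 δ j v ≢ 0 → δ (parent j) v ≡ 2 + side j
      ε-child  : ∀ {j} → j ≢ root → ∀ {v} → v ∈ bag (parent j) →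
                 ε (parent j) v ≡ 2 + side j → v ∈ bag j × ε j v ≢ 0
      ε-range  : ∀ {i v} → v ∈ bag i → ε i v < 2 + arity i
      ε-here   : ∀ {i v} → v ∈ bag i → ε i v ≡ 1 →
                 ∃[ u ] u ∈ bag i × Adj G v u × γ i u ≡ τ i v
      ε-top    : ∀ {i v} → v ∈ bag i → Top i v → 1 ≤ τ i v → τ i v ≤ ℓ → ε i v ≢ 0
      τ-target : ∀ {i v} → v ∈ bag i → v ∈ V′ → τ i v ≤ ℓ
      γ-self   : ∀ {i v} → v ∈ bag i → γ i v ≢ 0 → τ i v < γ i v
      γ-bound  : ∀ {i u w} → u ∈ bag i → w ∈ bag i → Adj G u w → γ i u ≢ 0 → τ i w ≤ γ i u
      δ-here   : ∀ {i u w} → u ∈ bag i → w ∈ bag i → Adj G u w → Top i u ⊎ Top i w →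
                 2 ≤ γ i u → τ i w ≡ γ i u → δ i u ≡ 1
      γ-unique : ∀ {i u w w′} → u ∈ bag i → w ∈ bag i → w′ ∈ bag i →
                 Adj G u w → Adj G u w′ → Top i u ⊎ Top i w → 2 ≤ γ i u →
                 τ i w ≡ γ i u → τ i w′ ≡ γ i u → w′ ≡ w

  -- Induction from the leaves, on the distance of the depth from an upper bound of all depths.
  descending : (P : Fin m → Set) →
               (∀ i → (∀ j → j ≢ root → parent j ≡ i → P j) → P i) → ∀ i → P i
  descending P f i = <-rec (λ r → ∀ i → R ∸ rank i ≡ r → P i)
    (λ r ih i eq → f i λ j j≢ pj≡ → ih (subst (R ∸ rank j <_) eq
      (∸-monoʳ-< (subst (λ p → rank p < rank j) pj≡ (rank-parent-< j≢)) (proj₂ (bounded rank) j))) j refl)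
    (R ∸ rank i) i refl
    where R = proj₁ (bounded rank)

  -- From valid labels to a dominating set

  module Soundness
    (side-injective : ∀ {j j′} → j ≢ root → j′ ≢ root → parent j ≡ parent j′ →
                      side j ≡ side j′ → j ≡ j′)
    (child-at : ∀ {i c} → c < arity i → ∃[ j ] j ≢ root × parent j ≡ i × side j ≡ c)
    {τ γ ε δ : Fin m → Fin n → ℕ} (valid : Valid τ γ ε δ) where
    open Valid valid

    -- Climbing from both bags leads to the unique topmost bag of `v`, and the value is preserved on
    -- the way.
    consistent : (f : Fin m → Fin n → ℕ) →
                 (∀ {j} → j ≢ root → ∀ {v} → v ∈ bag j → v ∈ bag (parent j) → f j v ≡ f (parent j) v) →
                 ∀ {v i i′} → v ∈ bag i → v ∈ bag i′ → f i v ≡ f i′ v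
    consistent f f-parent {v} {i} {i′} v∈ v∈′ with toTop i v∈ | toTop i′ v∈′
      where
      toTop : ∀ i → v ∈ bag i → ∃[ z ] v ∈ bag z × Top z v × f i v ≡ f z v
      toTop = climb (λ i → v ∈ bag i → ∃[ z ] v ∈ bag z × Top z v × f i v ≡ f z v) λ i ih v∈ → ascend i ih v∈ (i Fin.≟ root) (v ∈? bag (parent i))
        where
        ascend : ∀ i → (i ≢ root → v ∈ bag (parent i) → ∃[ z ] v ∈ bag z × Top z v × f (parent i) v ≡ f z v) →
               v ∈ bag i → Dec (i ≡ root) → Dec (v ∈ bag (parent i)) →
               ∃[ z ] v ∈ bag z × Top z v × f i v ≡ f z v
        ascend i ih v∈ (yes i≡) _ = i , v∈ , (λ i≢ → contradiction i≡ i≢) , refl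
        ascend i ih v∈ (no i≢) (no v∉) = i , v∈ , (λ _ → v∉) , refl
        ascend i ih v∈ (no i≢) (yes v∈p) with ih i≢ v∈p
        ... | z , v∈z , top , eq = z , v∈z , top , trans (f-parent i≢ v∈ v∈p) eq
    ... | z , v∈z , top , eq | z′ , v∈z′ , top′ , eq′ with top-unique v∈z v∈z′ top top′
    ...   | refl = trans eq (sym eq′)

    home : Fin n → Fin m
    home v = proj₁ (coverV v)

    t g : Fin n → ℕ
    t v = τ (home v) v
    g v = γ (home v) v

    τ≡t : ∀ {i v} → v ∈ bag i → τ i v ≡ t v
    τ≡t v∈ = consistent τ τ-parent v∈ (proj₂ (coverV _))

    γ≡g : ∀ {i v} → v ∈ bag i → γ i v ≡ g v
    γ≡g v∈ = consistent γ γ-parent v∈ (proj₂ (coverV _))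

    -- A nonzero direction `ε` is 1 or names an existing child. Following it therefore only goes
    -- down and must end at a bag with a forcer.
    forcer-below : ∀ i {v} → v ∈ bag i → ε i v ≢ 0 → ∃[ u ] Adj G v u × g u ≡ t v
    forcer-below i {v} = descending (λ i → v ∈ bag i → ε i v ≢ 0 → ∃[ u ] Adj G v u × g u ≡ t v) go i
      where
      go : ∀ i → (∀ j → j ≢ root → parent j ≡ i → v ∈ bag j → ε j v ≢ 0 → ∃[ u ] Adj G v u × g u ≡ t v) →
           v ∈ bag i → ε i v ≢ 0 → ∃[ u ] Adj G v u × g u ≡ t v
      go i ih v∈ ε≢ with ε i v in eq | ε-range {i} {v} v∈
      ... | zero        | _ = contradiction refl ε≢
      ... | suc zero    | _ with ε-here v∈ eq
      ...   | u , u∈ , a , γ≡ = u , a , trans (sym (γ≡g u∈)) (trans γ≡ (τ≡t v∈))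
      go i ih v∈ ε≢ | suc (suc c) | range with child-at (s≤s⁻¹ (s≤s⁻¹ range))
      ... | j , j≢ , refl , refl with ε-child j≢ v∈ eq
      ...   | v∈j , ε≢′ = ih j j≢ refl v∈j ε≢′

    forcer : ∀ {v} → 1 ≤ t v → t v ≤ ℓ → ∃[ u ] Adj G v u × g u ≡ t v
    forcer {v} 1≤ ≤ℓ with top-exists (home v) (proj₂ (coverV v))
    ... | z , v∈z , top , _ = forcer-below z v∈z
      (ε-top v∈z top (subst (1 ≤_) (sym (τ≡t v∈z)) 1≤) (subst (_≤ ℓ) (sym (τ≡t v∈z)) ≤ℓ))

    -- Built from its upper end, so that two descents from the same top can be compared step by
    -- step.
    data Down (u : Fin n) : Fin m → Fin m → Set where
      nil  : ∀ {z} → Down u z z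
      cons : ∀ {c i} → c ≢ root → u ∈ bag c → u ∈ bag (parent c) → Down u c i → Down u (parent c) i

    snoc : ∀ {u z i} → i ≢ root → u ∈ bag i → u ∈ bag (parent i) → Down u z (parent i) → Down u z i
    snoc i≢ u∈ u∈′ nil              = cons i≢ u∈ u∈′ nil
    snoc i≢ u∈ u∈′ (cons c≢ p q d) = cons c≢ p q (snoc i≢ u∈ u∈′ d)

    down-from-top : ∀ {u} i → u ∈ bag i → ∃[ z ] u ∈ bag z × Top z u × Down u z i
    down-from-top {u} = climb (λ i → u ∈ bag i → ∃[ z ] u ∈ bag z × Top z u × Down u z i) λ i ih u∈ → ascend i ih u∈ (i Fin.≟ root) (u ∈? bag (parent i))
      where
      ascend : ∀ i → (i ≢ root → u ∈ bag (parent i) → ∃[ z ] u ∈ bag z × Top z u × Down u z (parent i)) →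
             u ∈ bag i → Dec (i ≡ root) → Dec (u ∈ bag (parent i)) →
             ∃[ z ] u ∈ bag z × Top z u × Down u z i
      ascend i ih u∈ (yes i≡) _ = i , u∈ , (λ i≢ → contradiction i≡ i≢) , nil
      ascend i ih u∈ (no i≢) (no u∉) = i , u∈ , (λ _ → u∉) , nil
      ascend i ih u∈ (no i≢) (yes u∈p) with ih i≢ u∈p
      ... | z , u∈z , top , d = z , u∈z , top , snoc i≢ u∈ u∈p d

    2+≢0 : ∀ {x c} → x ≡ 2 + c → x ≢ 0
    2+≢0 refl ()

    1≢2+ : ∀ {x c} → x ≡ 1 → x ≢ 2 + c
    1≢2+ refl ()

    1≢0 : ∀ {x} → x ≡ 1 → x ≢ 0
    1≢0 refl ()

    δ-down : ∀ {u z i} → Down u z i → δ i u ≢ 0 → δ z u ≢ 0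
    δ-down nil              δ≢ = δ≢
    δ-down (cons c≢ p q d) δ≢ = 2+≢0 (δ-parent c≢ p q (δ-down d δ≢))

    δ-first : ∀ {u c i} → c ≢ root → u ∈ bag c → u ∈ bag (parent c) → Down u c i → δ i u ≡ 1 →
              δ (parent c) u ≡ 2 + side c
    δ-first c≢ p q d δ₁ = δ-parent c≢ p q (δ-down d (1≢0 δ₁))

    -- Where two descents to bags with `δ` equal to 1 part, the single value of `δ` would have to
    -- name two different children, or a child and the node itself.
    down-unique : ∀ {u z z′ i i′} → z ≡ z′ → Down u z i → Down u z′ i′ → δ i u ≡ 1 → δ i′ u ≡ 1 → i ≡ i′
    down-unique eq nil nil _ _ = eq
    down-unique {u} eq nil (cons c≢ p q d) δ₁ δ₂ =
      contradiction (δ-first c≢ p q d δ₂) (1≢2+ (trans (cong (λ z → δ z u) (sym eq)) δ₁))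
    down-unique {u} eq (cons c≢ p q d) nil δ₁ δ₂ =
      contradiction (δ-first c≢ p q d δ₁) (1≢2+ (trans (cong (λ z → δ z u) eq) δ₂))
    down-unique {u} eq (cons c≢ p q d) (cons c≢′ p′ q′ d′) δ₁ δ₂ =
      down-unique (side-injective c≢ c≢′ eq (suc-injective (suc-injective
        (trans (sym (δ-first c≢ p q d δ₁))
        (trans (cong (λ z → δ z u) eq) (δ-first c≢′ p′ q′ d′ δ₂))))))
        d d′ δ₁ δ₂

    δ-unique : ∀ {u i i′} → u ∈ bag i → u ∈ bag i′ → δ i u ≡ 1 → δ i′ u ≡ 1 → i ≡ i′
    δ-unique u∈ u∈′ with down-from-top _ u∈ | down-from-top _ u∈′
    ... | z , u∈z , top , d | z′ , u∈z′ , top′ , d′ =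
      down-unique (top-unique u∈z u∈z′ top top′) d d′

    -- Both forcing edges are owned by bags where `δ` is 1. These bags coincide, and inside one bag
    -- `γ-unique` decides.
    target-unique : ∀ {u w w′} → Adj G u w → Adj G u w′ → 2 ≤ g u → t w ≡ g u → t w′ ≡ g u → w′ ≡ w
    target-unique {u} {w} {w′} a a′ 2≤ eq eq′ =
      let i , u∈ , w∈ = coverE u w a
          i′ , u∈′ , w∈′ = coverE u w′ a′
          z , u∈z , w∈z , own = owner-exists i u∈ w∈
          z′ , u∈z′ , w∈z′ , own′ = owner-exists i′ u∈′ w∈′
      in same-bag (δ-unique u∈z u∈z′ (here-at u∈z w∈z a own eq) (here-at u∈z′ w∈z′ a′ own′ eq′))
                  u∈z w∈z w∈z′ own
      where
      at : ∀ {i w} → u ∈ bag i → w ∈ bag i → t w ≡ g u → τ i w ≡ γ i u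
      at u∈ w∈ eq = trans (τ≡t w∈) (trans eq (sym (γ≡g u∈)))
      here-at : ∀ {i w} → u ∈ bag i → w ∈ bag i → Adj G u w → Top i u ⊎ Top i w → t w ≡ g u → δ i u ≡ 1
      here-at u∈ w∈ a own eq = δ-here u∈ w∈ a own (subst (2 ≤_) (sym (γ≡g u∈)) 2≤) (at u∈ w∈ eq)
      same-bag : ∀ {z z′} → z ≡ z′ → u ∈ bag z → w ∈ bag z → w′ ∈ bag z′ → Top z u ⊎ Top z w → w′ ≡ w
      same-bag refl u∈ w∈ w∈′ own =
        γ-unique u∈ w∈ w∈′ a a′ own (subst (2 ≤_) (sym (γ≡g u∈)) 2≤) (at u∈ w∈ eq) (at u∈ w∈′ eq′)

    S : Subset n
    S = subsetOf λ v → t v ≟ 0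

    t-self : ∀ {u} → g u ≢ 0 → t u < g u
    t-self {u} = γ-self (proj₂ (coverV u))

    ∈S⁺ : ∀ {v} → t v ≡ 0 → v ∈ S
    ∈S⁺ = ∈-subsetOf⁺ (λ v → t v ≟ 0)

    ∈S⁻ : ∀ {v} → v ∈ S → t v ≡ 0
    ∈S⁻ = ∈-subsetOf⁻ (λ v → t v ≟ 0)

    -- The premise of a propagation step. For a neighbour `w`, `γ-bound` excludes later rounds, and
    -- the same round would make `w` a second target of `u`.
    earlier : ∀ {u v w r} → Adj G v u → g u ≡ t v → t v ≡ 2 + r → N[_] G u w → w ≢ v → t w < 2 + r
    earlier {u} {v} {w} {r} a g≡ t≡ (inj₁ refl) w≢ =
      subst (t w <_) (trans g≡ t≡) (t-self (2+≢0 (trans g≡ t≡)))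
    earlier {u} {v} {w} {r} a g≡ t≡ (inj₂ a′) w≢ =
      let i , u∈ , w∈ = coverE u w a′
          gu≡ = trans g≡ t≡
      in ≤∧≢⇒< (subst₂ _≤_ (τ≡t w∈) (trans (γ≡g u∈) gu≡)
                 (γ-bound u∈ w∈ a′ (2+≢0 (trans (γ≡g u∈) gu≡))))
               (λ tw≡ → w≢ (target-unique (adj-sym G a) a′
                 (subst (2 ≤_) (sym gu≡) (s≤s (s≤s z≤n))) (sym g≡) (trans tw≡ (sym gu≡))))

    dominated : ∀ r v → t v ≤ suc r → suc r ≤ ℓ → 𝒫 G (suc r) S v
    dominated zero v t≤ ≤ℓ = first (t v ≟ 0)
      where
      first : Dec (t v ≡ 0) → 𝒫 G 1 S v
      first (yes t≡0) = v , ∈S⁺ t≡0 , inj₁ refl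
      first (no t≢0) =
        let u , a , g≡ = forcer (n≢0⇒n>0 t≢0) (≤-trans t≤ ≤ℓ)
        -- `t u < g u` and `g u = t v ≤ 1`, hence `u` has round 0.
        in u , ∈S⁺ (n<1⇒n≡0 (<-≤-trans (t-self (t≢0 ∘ trans (sym g≡))) (≤-trans (≤-reflexive g≡) t≤)))
             , inj₂ (adj-sym G a)
    dominated (suc r) v t≤ ≤ℓ = next (m≤n⇒m<n∨m≡n t≤)
      where
      next : t v < 2 + r ⊎ t v ≡ 2 + r → 𝒫 G (2 + r) S v
      next (inj₁ t<) = inj₁ (dominated r v (s≤s⁻¹ t<) (<⇒≤ ≤ℓ))
      next (inj₂ t≡) =
        let u , a , g≡ = forcer {v} (subst (1 ≤_) (sym t≡) (s≤s z≤n)) (subst (_≤ ℓ) (sym t≡) ≤ℓ)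
        in inj₂ (u , adj-sym G a , λ w w∈ w≢ →
             dominated r w (s≤s⁻¹ (earlier a g≡ t≡ w∈ w≢)) (<⇒≤ ≤ℓ))

    dominates : 1 ≤ ℓ → Dominates G ℓ V′ S
    dominates 1≤ℓ v v∈V′ = go ℓ refl 1≤ℓ
      where
      go : ∀ k → k ≡ ℓ → 1 ≤ k → 𝒫 G k S v
      go (suc r) refl _ = dominated r v (τ-target (proj₂ (coverV v)) v∈V′) ≤-refl

-- From a dominating set to rounds and forcing vertices

module _ {n} (G : Graph n) where
  open DecMembership (≡-dec (Fin._≟_ {n}) (Fin._≟_ {n})) using () renaming (_∈?_ to _∈ₑ?_)

  adj? : ∀ u v → Dec (Adj G u v)
  adj? u v = ((u , v) ∈ₑ? edges G) ⊎-dec ((v , u) ∈ₑ? edges G)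

  N? : ∀ u v → Dec (N[_] G u v)
  N? u v = (v Fin.≟ u) ⊎-dec adj? u v

  𝒫? : ∀ r S v → Dec (𝒫 G r S v)
  𝒫? zero          S v = v ∈? S
  𝒫? (suc zero)    S v = Fin.any? λ u → (u ∈? S) ×-dec N? u v
  𝒫? (suc (suc r)) S v = 𝒫? (suc r) S v ⊎-dec
    Fin.any? λ u → adj? u v ×-dec
      Fin.all? λ w → N? u w →-dec (¬? (w Fin.≟ v) →-dec 𝒫? (suc r) S w)

  𝒫-suc : ∀ r {S v} → 𝒫 G r S v → 𝒫 G (suc r) S v
  𝒫-suc zero    p = _ , p , inj₁ refl
  𝒫-suc (suc r) p = inj₁ p

  𝒫-mono : ∀ {r s S v} → r ≤ s → 𝒫 G r S v → 𝒫 G s S v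
  𝒫-mono {r} {s} {S} {v} r≤s p = subst (λ s → 𝒫 G s S v) (m∸n+n≡m r≤s) (go (s ∸ r))
    where
    go : ∀ k → 𝒫 G (k + r) S v
    go zero    = p
    go (suc k) = 𝒫-suc (k + r) (go k)

module Canonical {n} (G : Graph n) (ℓ : ℕ) (S : Subset n) where

  private
    -- The filler clause of `𝒫` at 0 makes round 0 the set itself; the default `suc ℓ` marks
    -- vertices that are not reached within ℓ rounds.
    round : ∀ v → ∃[ r ] r ≤ suc ℓ × (∀ s → s < r → ¬ 𝒫 G s S v) × (r < suc ℓ → 𝒫 G r S v)
    round v = least (λ r → 𝒫? G r S v) (suc ℓ)

  opaque
    t : Fin n → ℕ
    t v = proj₁ (round v)

    t≤1+ℓ : ∀ v → t v ≤ suc ℓ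
    t≤1+ℓ v = proj₁ (proj₂ (round v))

    t-minimal : ∀ {v s} → 𝒫 G s S v → t v ≤ s
    t-minimal {v} {s} p = ≮⇒≥ λ s<t → proj₁ (proj₂ (proj₂ (round v))) s s<t p

    t-reached : ∀ {v} → t v ≤ ℓ → 𝒫 G (t v) S v
    t-reached {v} t≤ = proj₂ (proj₂ (proj₂ (round v))) (s≤s t≤)

  t-source : ∀ {u v} → u ∈ S → N[_] G u v → t v ≤ 1
  t-source u∈ n = t-minimal {s = 1} (_ , u∈ , n)

  t≡0⁺ : ∀ {v} → v ∈ S → t v ≡ 0
  t≡0⁺ v∈ = n≤0⇒n≡0 (t-minimal {s = 0} v∈)

  t≡0⁻ : ∀ {v} → t v ≡ 0 → v ∈ S
  t≡0⁻ {v} eq = subst (λ r → 𝒫 G r S v) eq (t-reached (subst (_≤ ℓ) (sym eq) z≤n))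

  Forces : Fin n → Fin n → Set
  Forces u v = Adj G u v × 2 ≤ t v × t v ≤ ℓ × (∀ w → N[_] G u w → w ≢ v → t w < t v)

  forces? : ∀ u v → Dec (Forces u v)
  forces? u v = adj? G u v ×-dec (2 ≤? t v) ×-dec (t v ≤? ℓ) ×-dec
    Fin.all? λ w → N? G u w →-dec (¬? (w Fin.≟ v) →-dec (t w <? t v))

  -- One role per vertex suffices. Neighbours of a source have round at most 1, so a source never
  -- forces in a later round; and of two vertices forced by `u`, each would have to precede the
  -- other.
  data Role (u : Fin n) : Set where
    idle   : Role u
    source : u ∈ S → Role u
    force  : ∀ v → Forces u v → Role u

  strength : ∀ {u} → Role u → ℕ
  strength idle        = 0
  strength (source _)  = 1
  strength (force v _) = t v

  chooseRole : ∀ {u} → Dec (u ∈ S) → Dec (∃[ v ] Forces u v) → Role u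
  chooseRole (yes u∈) _             = source u∈
  chooseRole (no _)   (yes (v , f)) = force v f
  chooseRole (no _)   (no _)        = idle

  opaque
    role : ∀ u → Role u
    role u = chooseRole (u ∈? S) (Fin.any? (forces? u))

    role-source : ∀ {u} → u ∈ S → strength (role u) ≡ 1
    role-source {u} u∈ = go (u ∈? S)
      where
      go : ∀ d {d′} → strength (chooseRole {u} d d′) ≡ 1
      go (yes _) = refl
      go (no u∉) = contradiction u∈ u∉

    role-force : ∀ {u v} → u ∉ S → Forces u v → strength (role u) ≡ t v
    role-force {u} {v} u∉ f@(a , _ , _ , others) = go (u ∈? S) (Fin.any? (forces? u))
      where
      go : ∀ d d′ → strength (chooseRole {u} d d′) ≡ t v
      go (yes u∈) _ = contradiction u∈ u∉
      go (no _) (no none) = contradiction (v , f) none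
      go (no _) (yes (v′ , a′ , _ , _ , others′)) = same (v′ Fin.≟ v)
        where
        same : Dec (v′ ≡ v) → t v′ ≡ t v
        same (yes refl) = refl
        same (no v′≢v)  = contradiction (others v′ (inj₂ a′) v′≢v)
                            (<-asym (others′ v (inj₂ a) (v′≢v ∘ sym)))

  g : Fin n → ℕ
  g u = strength (role u)

  g≤ : 1 ≤ ℓ → ∀ u → g u ≤ ℓ
  g≤ 1≤ℓ u with role u
  ... | idle                  = z≤n
  ... | source _              = 1≤ℓ
  ... | force v (_ , _ , ≤ℓ , _) = ≤ℓ

  g-self : ∀ {u} → g u ≢ 0 → t u < g u
  g-self {u} g≢ with role u
  ... | idle                     = contradiction refl g≢
  ... | source u∈                = ≤-reflexive (cong suc (t≡0⁺ u∈))
  ... | force v (a , _ , _ , h) = h u (inj₁ refl) (adj-irrefl G a)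

  g-bound : ∀ {u w} → Adj G u w → g u ≢ 0 → t w ≤ g u
  g-bound {u} {w} a g≢ with role u
  ... | idle      = contradiction refl g≢
  ... | source u∈ = t-source u∈ (inj₂ a)
  ... | force v (_ , _ , _ , h) with w Fin.≟ v
  ...   | yes refl = ≤-refl
  ...   | no w≢    = <⇒≤ (h w (inj₂ a) w≢)

  g-target : ∀ {u w} → Adj G u w → 2 ≤ g u → t w ≡ g u → Σ (Forces u w) λ f → role u ≡ force w f
  g-target {u} {w} a 2≤ eq with role u
  ... | source u∈ = contradiction 2≤ (<⇒≱ ≤-refl)
  ... | force v f@(_ , _ , _ , h) with w Fin.≟ v
  ...   | yes refl = f , refl
  ...   | no w≢    = contradiction eq (<⇒≢ (h w (inj₂ a) w≢))

  -- Minimality of `t v` excludes membership in an earlier stage, so the defining clause of stage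
  -- `t v` itself provides the vertex.
  forcer : ∀ {v} → 1 ≤ t v → t v ≤ ℓ → ∃[ u ] Adj G u v × g u ≡ t v
  forcer {v} 1≤ ≤ℓ = go (t v) refl 1≤
    where
    at : ∀ {r} → t v ≡ r → 𝒫 G r S v
    at eq = subst (λ r → 𝒫 G r S v) eq (t-reached ≤ℓ)
    go : ∀ r → t v ≡ r → 1 ≤ r → ∃[ u ] Adj G u v × g u ≡ t v
    go (suc zero) eq _ with at eq
    ... | u , u∈ , inj₁ refl = contradiction (trans (sym (t≡0⁺ u∈)) eq) λ ()
    ... | u , u∈ , inj₂ a    = u , a , trans (role-source u∈) (sym eq)
    go (suc (suc r)) eq _ with at eq
    ... | inj₁ p = contradiction (subst (_≤ suc r) eq (t-minimal {s = suc r} p)) 1+n≰n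
    ... | inj₂ (u , a , h) = u , a , role-force u∉
            (a , subst (2 ≤_) (sym eq) (s≤s (s≤s z≤n)) , ≤ℓ
            , λ w w∈ w≢ → subst (t w <_) (sym eq) (s≤s (t-minimal {s = suc r} (h w w∈ w≢))))
      where
      u∉ : u ∉ S
      u∉ u∈ = contradiction (subst (_≤ 1) eq (t-source u∈ (inj₂ a))) λ { (s≤s ()) }

-- Directions towards a bag, and the labels of a dominating set

module Pointers {n m} {G : Graph n} (D : NiceTreeDecomposition G m)
  (side arity : Fin m → ℕ)
  (side-injective : ∀ {j j′} → j ≢ NiceTreeDecomposition.root D → j′ ≢ NiceTreeDecomposition.root D →
                    NiceTreeDecomposition.parent D j ≡ NiceTreeDecomposition.parent D j′ →
                    side j ≡ side j′ → j ≡ j′)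
  (side<arity : ∀ {j} → j ≢ NiceTreeDecomposition.root D →
                side j < arity (NiceTreeDecomposition.parent D j)) where
  open NiceTreeDecomposition D
  open TreeFacts D
  open DecMembership (Fin._≟_ {m}) using () renaming (_∈?_ to _∈ₗ?_)

  Towards : Fin m → Fin m → Fin m → Set
  Towards o i c = c ≢ root × parent c ≡ i × c ∈ₗ up o

  towards? : ∀ o i → Dec (∃ (Towards o i))
  towards? o i = Fin.any? λ c → ¬? (c Fin.≟ root) ×-dec (parent c Fin.≟ i) ×-dec (c ∈ₗ? up o)

  toNumber : ∀ {o i} → Dec (o ≡ i) → Dec (∃ (Towards o i)) → ℕ
  toNumber (yes _) _             = 1
  toNumber (no _)  (yes (c , _)) = 2 + side c
  toNumber (no _)  (no _)        = 0

  data PointerAt (o i : Fin m) : ℕ → Set where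
    at-here   : o ≡ i → PointerAt o i 1
    at-child  : ∀ c → Towards o i c → PointerAt o i (2 + side c)
    at-up     : ¬ (i ∈ₗ up o) → PointerAt o i 0

  towards-exists : ∀ {i} o → i ∈ₗ up o → o ≢ i → ∃ (Towards o i)
  towards-exists {i} = climb (λ o → i ∈ₗ up o → o ≢ i → ∃ (Towards o i)) go
    where
    go : ∀ o → (o ≢ root → i ∈ₗ up (parent o) → parent o ≢ i → ∃ (Towards (parent o) i)) →
         i ∈ₗ up o → o ≢ i → ∃ (Towards o i)
    go o ih i∈ o≢i = below (up-cases i∈)
      where
      below : i ≡ o ⊎ (o ≢ root × i ∈ₗ up (parent o)) → ∃ (Towards o i)
      below (inj₁ i≡o) = contradiction (sym i≡o) o≢i
      below (inj₂ (o≢ , i∈′)) = next (parent o Fin.≟ i)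
        where
        next : Dec (parent o ≡ i) → ∃ (Towards o i)
        next (yes eq) = o , o≢ , eq , up-refl o
        next (no ne) = let c , c≢ , eq , c∈ = ih o≢ i∈′ ne in c , c≢ , eq , up-step o≢ c∈

  opaque
    pointer : Maybe (Fin m) → Fin m → ℕ
    pointer nothing  i = 0
    pointer (just o) i = toNumber (o Fin.≟ i) (towards? o i)

    pointer-nothing : ∀ i → pointer nothing i ≡ 0
    pointer-nothing i = refl

    pointer-view : ∀ o i → PointerAt o i (pointer (just o) i)
    pointer-view o i = go (o Fin.≟ i) (towards? o i)
      where
      go : (d : Dec (o ≡ i)) (d′ : Dec (∃ (Towards o i))) → PointerAt o i (toNumber d d′)
      go (yes eq) _               = at-here eq
      go (no _)   (yes (c , tow)) = at-child c tow
      go (no o≢)  (no none)       = at-up λ i∈ → none (towards-exists o i∈ o≢)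

  pointer-above : ∀ {o i} → i ∈ₗ up o → pointer (just o) i ≢ 0
  pointer-above {o} {i} i∈ eq with pointer (just o) i | pointer-view o i
  ... | _ | at-up i∉ = i∉ i∈

  above-pointer : ∀ {o i} → pointer (just o) i ≢ 0 → i ∈ₗ up o
  above-pointer {o} {i} ≢0 with pointer (just o) i | pointer-view o i
  ... | _ | at-here refl               = up-refl o
  ... | _ | at-child c (c≢ , refl , c∈) = up-trans (parent∈up c≢) c∈
  ... | _ | at-up _                    = contradiction refl ≢0

  pointer-here : ∀ {o i} → pointer (just o) i ≡ 1 → o ≡ i
  pointer-here {o} {i} eq with pointer (just o) i | pointer-view o i
  ... | _ | at-here o≡ = o≡

  pointer-self : ∀ o → pointer (just o) o ≡ 1
  pointer-self o with pointer (just o) o | pointer-view o o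
  ... | _ | at-here _ = refl
  ... | _ | at-up o∉  = contradiction (up-refl o) o∉
  ... | _ | at-child c (c≢ , refl , c∈) with up-rank c∈
  ...   | inj₁ c≡ = contradiction (cong rank (sym c≡)) (<⇒≢ (rank-parent-< c≢))
  ...   | inj₂ c< = contradiction c< (<-asym (rank-parent-< c≢))

  pointer-parent : ∀ {o j} → j ≢ root → j ∈ₗ up o → pointer (just o) (parent j) ≡ 2 + side j
  pointer-parent {o} {j} j≢ j∈ with pointer (just o) (parent j) | pointer-view o (parent j)
  ... | _ | at-child c (c≢ , eq , c∈) = cong (λ x → 2 + side x) (child-unique c≢ j≢ eq c∈ j∈)
  ... | _ | at-up p∉ = contradiction (up-trans (parent∈up j≢) j∈) p∉
  ... | _ | at-here refl with up-rank j∈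
  ...   | inj₁ j≡ = contradiction (cong rank (sym j≡)) (<⇒≢ (rank-parent-< j≢))
  ...   | inj₂ j< = contradiction j< (<-asym (rank-parent-< j≢))

  pointer-child : ∀ {o j} → j ≢ root → pointer (just o) (parent j) ≡ 2 + side j → j ∈ₗ up o
  pointer-child {o} {j} j≢ eq with pointer (just o) (parent j) | pointer-view o (parent j)
  ... | _ | at-child c (c≢ , p≡ , c∈) =
        subst (_∈ₗ up o) (side-injective c≢ j≢ p≡ (suc-injective (suc-injective eq))) c∈

  pointer-range : ∀ w i → pointer w i < 2 + arity i
  pointer-range nothing i = subst (_< 2 + arity i) (sym (pointer-nothing i)) (s≤s z≤n)
  pointer-range (just o) i with pointer (just o) i | pointer-view o i
  ... | _ | at-here _ = s≤s (s≤s z≤n)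
  ... | _ | at-up _   = s≤s z≤n
  ... | _ | at-child c (c≢ , refl , _) = s≤s (s≤s (side<arity c≢))

module Completeness {n m} {G : Graph n} (ℓ : ℕ) (V′ : Subset n) (D : NiceTreeDecomposition G m)
  (side arity : Fin m → ℕ)
  (side-injective : ∀ {j j′} → j ≢ NiceTreeDecomposition.root D → j′ ≢ NiceTreeDecomposition.root D →
                    NiceTreeDecomposition.parent D j ≡ NiceTreeDecomposition.parent D j′ →
                    side j ≡ side j′ → j ≡ j′)
  (side<arity : ∀ {j} → j ≢ NiceTreeDecomposition.root D →
                side j < arity (NiceTreeDecomposition.parent D j))
  (S : Subset n) (dominates : Dominates G ℓ V′ S) where
  open NiceTreeDecomposition D
  open TreeFacts D
  open Labels ℓ V′ D side arity
  open Canonical G ℓ S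
  open Pointers D side arity side-injective side<arity

  -- For `ε` any bag with `v` and a forcer will do. For `δ` the bag must own the forcing edge,
  -- because the uniqueness of the edge is read off from the uniqueness of that bag.
  InWitness OutWitness : Fin n → Maybe (Fin m) → Set
  InWitness v nothing  = ¬ (1 ≤ t v × t v ≤ ℓ)
  InWitness v (just o) = ∃[ u ] v ∈ bag o × u ∈ bag o × Adj G v u × g u ≡ t v
  OutWitness u nothing  = ∀ {v} {f : Forces u v} → role u ≢ force v f
  OutWitness u (just o) = ∃[ v ] Owns o u v × Σ (Forces u v) λ f → role u ≡ force v f

  opaque
    inWitness : ∀ v → ∃ (InWitness v)
    inWitness v = go ((1 ≤? t v) ×-dec (t v ≤? ℓ))
      where
      go : Dec (1 ≤ t v × t v ≤ ℓ) → ∃ (InWitness v)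
      go (no ¬p) = nothing , ¬p
      go (yes (1≤ , ≤ℓ)) =
        let u , a , g≡ = forcer 1≤ ≤ℓ
            o , u∈ , v∈ = coverE u v a
        in just o , u , v∈ , u∈ , adj-sym G a , g≡

    outWitness : ∀ u → ∃ (OutWitness u)
    outWitness u = go (role u) refl
      where
      go : ∀ r → role u ≡ r → ∃ (OutWitness u)
      go idle       eq = nothing , λ eq′ → contradiction (trans (sym eq) eq′) λ ()
      go (source _) eq = nothing , λ eq′ → contradiction (trans (sym eq) eq′) λ ()
      go (force v f) eq =
        let o , u∈ , v∈ = coverE u v (proj₁ f)
            z , own = owner-exists o u∈ v∈
        in just z , v , own , f , eq

  ε δ : Fin m → Fin n → ℕ
  ε i v = pointer (proj₁ (inWitness v)) i
  δ i v = pointer (proj₁ (outWitness v)) i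

  valid : Valid (λ _ → t) (λ _ → g) ε δ
  valid = record
    { τ-parent = λ _ _ _ → refl
    ; γ-parent = λ _ _ _ → refl
    ; δ-parent = λ {j} j≢ {v} v∈ v∈p → δ-parent j≢ (proj₁ (outWitness v))
    ; ε-child  = λ {j} j≢ {v} v∈p → ε-child j≢ v∈p (proj₁ (inWitness v)) (proj₂ (inWitness v))
    ; ε-range  = λ {i} {v} _ → pointer-range (proj₁ (inWitness v)) i
    ; ε-here   = λ {i} {v} _ → ε-here (proj₁ (inWitness v)) (proj₂ (inWitness v))
    ; ε-top    = λ {i} {v} v∈ top 1≤ ≤ℓ → ε-top v∈ top (1≤ , ≤ℓ) (proj₁ (inWitness v)) (proj₂ (inWitness v))
    ; τ-target = λ {i} {v} _ v∈V′ → t-minimal (dominates v v∈V′)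
    ; γ-self   = λ _ → g-self
    ; γ-bound  = λ _ _ → g-bound
    ; δ-here   = λ {i} {u} u∈ w∈ a own 2≤ eq →
        δ-here (u∈ , w∈ , own) (g-target a 2≤ eq) (proj₁ (outWitness u)) (proj₂ (outWitness u))
    ; γ-unique = λ _ _ _ a a′ _ 2≤ eq eq′ → same-target (g-target a 2≤ eq) (g-target a′ 2≤ eq′)
    }
    where
    δ-parent : ∀ {j} → j ≢ root → ∀ w → pointer w j ≢ 0 → pointer w (parent j) ≡ 2 + side j
    δ-parent {j} j≢ nothing  ≢0 = contradiction (pointer-nothing j) ≢0
    δ-parent {j} j≢ (just o) ≢0 = pointer-parent j≢ (above-pointer ≢0)

    ε-child : ∀ {j} → j ≢ root → ∀ {v} → v ∈ bag (parent j) → ∀ w → InWitness v w →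
              pointer w (parent j) ≡ 2 + side j → v ∈ bag j × pointer w j ≢ 0
    ε-child {j} j≢ v∈p nothing _ eq = contradiction (trans (sym (pointer-nothing (parent j))) eq) λ ()
    ε-child {j} j≢ v∈p (just o) (u , v∈o , _) eq =
      -- The child lies between its parent and the bag `o` of the witness, and `v` is in both.
      connected-up v∈o v∈p j∈ (parent∈up j≢) , pointer-above j∈
      where j∈ = pointer-child j≢ eq

    ε-here : ∀ {i v} w → InWitness v w → pointer w i ≡ 1 → ∃[ u ] u ∈ bag i × Adj G v u × g u ≡ t v
    ε-here {i} nothing _ eq = contradiction (trans (sym (pointer-nothing i)) eq) λ ()
    ε-here {i} {v} (just o) (u , v∈o , u∈o , a , g≡) eq =
      u , subst (λ o → u ∈ bag o) (pointer-here eq) u∈o , a , g≡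

    ε-top : ∀ {i v} → v ∈ bag i → Top i v → 1 ≤ t v × t v ≤ ℓ → ∀ w → InWitness v w → pointer w i ≢ 0
    ε-top v∈ top range nothing ¬range = contradiction range ¬range
    ε-top v∈ top range (just o) (_ , v∈o , _) = pointer-above (top-above v∈ v∈o top)

    force-injective : ∀ {u v v′} {f : Forces u v} {f′ : Forces u v′} → force v f ≡ force v′ f′ → v ≡ v′
    force-injective refl = refl

    same-target : ∀ {u w w′} → Σ (Forces u w) (λ f → role u ≡ force w f) →
             Σ (Forces u w′) (λ f → role u ≡ force w′ f) → w′ ≡ w
    same-target (_ , eq) (_ , eq′) = force-injective (trans (sym eq′) eq)

    δ-here : ∀ {i u v} → Owns i u v → Σ (Forces u v) (λ f → role u ≡ force v f) →
             ∀ w → OutWitness u w → pointer w i ≡ 1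
    δ-here own (f , eq) nothing none = contradiction eq none
    δ-here {i} {u} own target (just o) (v , own′ , target′) =
      subst (λ i → pointer (just o) i ≡ 1)
        (owner-unique (subst (λ v → Owns o u v) (same-target target target′) own′) own) (pointer-self o)

-- The encoding of the input

fromList-++ : ∀ xs {ys} i → fromList (xs ++ ys) (length xs + i) ≡ fromList ys i
fromList-++ []       i = refl
fromList-++ (x ∷ xs) i = fromList-++ xs i

fromList-end : ∀ xs i → length xs ≤ i → fromList xs i ≡ 0
fromList-end []       i       _ = refl
fromList-end (x ∷ xs) (suc i) p = fromList-end xs i (s≤s⁻¹ p)

module _ {A : Set} (f : A → ℕ) where

  fromList-map⁻ : ∀ xs {ys} q → q < length xs → ∃[ x ] x ∈ₗ xs × fromList (map f xs ++ ys) q ≡ f x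
  fromList-map⁻ (x ∷ xs) zero    _ = x , here refl , refl
  fromList-map⁻ (x ∷ xs) (suc q) p =
    let y , y∈ , eq = fromList-map⁻ xs q (s≤s⁻¹ p) in y , there y∈ , eq

  fromList-map⁺ : ∀ {x xs} → x ∈ₗ xs → ∀ {ys} → ∃[ q ] q < length xs × fromList (map f xs ++ ys) q ≡ f x
  fromList-map⁺ (here refl) = 0 , s≤s z≤n , refl
  fromList-map⁺ (there x∈)  = let q , q< , eq = fromList-map⁺ x∈ in suc q , s≤s q< , eq

  fromList-injective : (∀ {x y} → f x ≡ f y → x ≡ y) → ∀ {xs ys} → Unique xs → ∀ q q′ →
    q < length xs → q′ < length xs → fromList (map f xs ++ ys) q ≡ fromList (map f xs ++ ys) q′ → q ≡ q′
  fromList-injective inj u zero zero _ _ _ = refl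
  fromList-injective inj {x ∷ xs} {ys} (x∉ ∷ u) zero (suc q′) _ q′< eq =
    let y , y∈ , eq′ = fromList-map⁻ xs {ys} q′ (s≤s⁻¹ q′<) in
    contradiction (inj (trans eq eq′)) (All.lookup x∉ y∈)
  fromList-injective inj {x ∷ xs} {ys} (x∉ ∷ u) (suc q) zero q< _ eq =
    let y , y∈ , eq′ = fromList-map⁻ xs {ys} q (s≤s⁻¹ q<) in
    contradiction (inj (trans (sym eq) eq′)) (All.lookup x∉ y∈)
  fromList-injective inj (x∉ ∷ u) (suc q) (suc q′) q< q′< eq =
    cong suc (fromList-injective inj u q q′ (s≤s⁻¹ q<) (s≤s⁻¹ q′<) eq)

fromList-bits : ∀ {n} (V : Vec Bool n) {ys} v →
                fromList (map bit (toList V) ++ ys) (toℕ v) ≡ bit (lookup V v)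
fromList-bits (x ∷ V) zero    = refl
fromList-bits (x ∷ V) (suc v) = fromList-bits V v

length-bits : ∀ {n} (V : Vec Bool n) → length (map bit (toList V)) ≡ n
length-bits []      = refl
length-bits (x ∷ V) = cong suc (length-bits V)

does-∈? : ∀ {n} (X : Subset n) i → does (i ∈? X) ≡ lookup X i
does-∈? (true ∷ X)  zero    = refl
does-∈? (false ∷ X) zero    = refl
does-∈? (x ∷ X)     (suc i) = does-∈? X i

length-filter-tabulate : ∀ {n} {A : Set} (X : Subset n) {P : A → Set} (P? : ∀ a → Dec (P a)) (g : Fin n → A) →
  (∀ i → does (P? (g i)) ≡ lookup X i) → length (filter P? (tabulate g)) ≡ ∣ X ∣
length-filter-tabulate []      P? g h = refl
length-filter-tabulate (x ∷ X) P? g h with does (P? (g zero)) | h zero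
... | true  | refl = cong suc (length-filter-tabulate X P? (g ∘ suc) (h ∘ suc))
... | false | refl = length-filter-tabulate X P? (g ∘ suc) (h ∘ suc)

members : ∀ {n} → Subset n → List (Fin n)
members {n} X = filter (_∈? X) (allFin n)

length-members : ∀ {n} (X : Subset n) → length (members X) ≡ ∣ X ∣
length-members X = length-filter-tabulate X (_∈? X) id (does-∈? X)

drop-tabulate : ∀ {m} {A : Set} (g : Fin m → A) i →
                drop (toℕ i) (tabulate g) ≡ g i ∷ drop (suc (toℕ i)) (tabulate g)
drop-tabulate g zero    = refl
drop-tabulate g (suc i) = drop-tabulate (g ∘ suc) i

drop-all : ∀ {A : Set} (xs : List A) → drop (length xs) xs ≡ []
drop-all []       = refl
drop-all (x ∷ xs) = drop-all xs

module _ {n : ℕ} where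

  encodePair : Fin n × Fin n → List ℕ
  encodePair e = toℕ (proj₁ e) ∷ toℕ (proj₂ e) ∷ []

  length-pairs : ∀ es → length (concatMap encodePair es) ≡ length es + length es
  length-pairs []       = refl
  length-pairs (e ∷ es) = cong suc (trans (cong suc (length-pairs es)) (sym (+-suc _ _)))

  pairs⁻ : ∀ es {ys} i → i < length es → ∃[ e ] e ∈ₗ es ×
    fromList (concatMap encodePair es ++ ys) (i + i) ≡ toℕ (proj₁ e) ×
    fromList (concatMap encodePair es ++ ys) (1 + (i + i)) ≡ toℕ (proj₂ e)
  pairs⁻ (e ∷ es) zero    _ = e , here refl , refl , refl
  pairs⁻ (e ∷ es) {ys} (suc i) p =
    let e′ , e∈ , eq , eq′ = pairs⁻ es {ys} i (s≤s⁻¹ p) in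
    e′ , there e∈ , trans (cong (fromList (concatMap encodePair (e ∷ es) ++ ys) ∘ suc) (+-suc i i)) eq
    , trans (cong (fromList (concatMap encodePair (e ∷ es) ++ ys) ∘ (2 +_)) (+-suc i i)) eq′

  pairs⁺ : ∀ {e es} → e ∈ₗ es → ∀ {ys} → ∃[ i ] i < length es ×
    fromList (concatMap encodePair es ++ ys) (i + i) ≡ toℕ (proj₁ e) ×
    fromList (concatMap encodePair es ++ ys) (1 + (i + i)) ≡ toℕ (proj₂ e)
  pairs⁺ (here refl) = 0 , s≤s z≤n , refl , refl
  pairs⁺ {es = e₀ ∷ es} (there e∈) {ys} =
    let i , i< , eq , eq′ = pairs⁺ e∈ {ys} in
    suc i , s≤s i< , trans (cong (fromList (concatMap encodePair (e₀ ∷ es) ++ ys) ∘ suc) (+-suc i i)) eq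
    , trans (cong (fromList (concatMap encodePair (e₀ ∷ es) ++ ys) ∘ (2 +_)) (+-suc i i)) eq′

length-concatMap-≤ : ∀ {A : Set} (f : A → List ℕ) B → (∀ x → length (f x) ≤ B) →
                     ∀ xs → length (concatMap f xs) ≤ length xs * B
length-concatMap-≤ f B h []       = z≤n
length-concatMap-≤ f B h (x ∷ xs) =
  ≤-trans (≤-reflexive (length-++ (f x))) (+-mono-≤ (h x) (length-concatMap-≤ f B h xs))

module Encoding {n m} (ℓ : ℕ) (G : Graph n) (V′ : Subset n) (D : NiceTreeDecomposition G m) where
  open NiceTreeDecomposition D

  private
    bits rest nodes : List ℕ
    bits  = map bit (toList V′)
    nodes = encodeDecomposition D
    rest  = encodeEdges G ++ nodes

    node : Fin m → List ℕ
    node i = toℕ (parent i) ∷ encodeBag (bag i)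

  I : ℕ → ℕ
  I = fromList (encode ℓ G V′ D)

  E : ℕ
  E = length (edges G)

  private
    I-rest : ∀ a → I (2 + n + a) ≡ fromList rest a
    I-rest a = trans (cong (λ k → fromList (bits ++ rest) (k + a)) (sym (length-bits V′))) (fromList-++ bits a)

    I-nodes : ∀ a → I (3 + n + E + E + a) ≡ fromList nodes a
    I-nodes a = trans (cong I (shift n E a)) (trans (I-rest _)
      (trans (cong (λ k → fromList (concatMap encodePair (edges G) ++ nodes) (k + a)) (sym (length-pairs (edges G))))
        (fromList-++ (concatMap encodePair (edges G)) a)))
      where shift : ∀ n E a → 3 + n + E + E + a ≡ 2 + n + suc (E + E + a)
            shift = solve-∀

  I-target : ∀ v → I (2 + toℕ v) ≡ bit (lookup V′ v)
  I-target v = fromList-bits V′ v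

  I-edgeCount : I (2 + n) ≡ E
  I-edgeCount = trans (cong I (sym (+-identityʳ (2 + n)))) (I-rest 0)

  I-nodeCount : I (3 + n + E + E) ≡ m
  I-nodeCount = trans (cong I (sym (+-identityʳ (3 + n + E + E)))) (I-nodes 0)

  I-root : I (4 + n + E + E) ≡ toℕ root
  I-root = trans (cong I (sym (+-comm (3 + n + E + E) 1))) (I-nodes 1)

  private
    I-edges : ∀ i a → I (3 + n + i + i + a) ≡ fromList (concatMap encodePair (edges G) ++ nodes) (a + (i + i))
    I-edges i a = trans (cong I (shift n i a)) (I-rest _)
      where shift : ∀ n i a → 3 + n + i + i + a ≡ 2 + n + suc (a + (i + i))
            shift = solve-∀

    first : ∀ i → I (3 + n + i + i) ≡ fromList (concatMap encodePair (edges G) ++ nodes) (i + i)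
    first i = trans (cong I (sym (+-identityʳ (3 + n + i + i)))) (I-edges i 0)

    second : ∀ i → I (4 + n + i + i) ≡ fromList (concatMap encodePair (edges G) ++ nodes) (1 + (i + i))
    second i = trans (cong I (sym (+-comm (3 + n + i + i) 1))) (I-edges i 1)

  I-edge⁻ : ∀ i → i < E → ∃[ e ] e ∈ₗ edges G × I (3 + n + i + i) ≡ toℕ (proj₁ e) × I (4 + n + i + i) ≡ toℕ (proj₂ e)
  I-edge⁻ i i< = let e , e∈ , eq , eq′ = pairs⁻ (edges G) {nodes} i i< in
    e , e∈ , trans (first i) eq , trans (second i) eq′

  I-edge⁺ : ∀ {e} → e ∈ₗ edges G → ∃[ i ] i < E × I (3 + n + i + i) ≡ toℕ (proj₁ e) × I (4 + n + i + i) ≡ toℕ (proj₂ e)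
  I-edge⁺ e∈ = let i , i< , eq , eq′ = pairs⁺ e∈ {nodes} in
    i , i< , trans (first i) eq , trans (second i) eq′

  start : ℕ
  start = 5 + n + E + E

  bagPointer : ℕ → ℕ
  bagPointer zero    = start
  bagPointer (suc i) = 2 + bagPointer i + I (1 + bagPointer i)

  private
    I-start : ∀ a → I (start + a) ≡ fromList (concatMap node (allFin m)) a
    I-start a = trans (cong I (shift n E a)) (I-nodes (2 + a))
      where shift : ∀ n E a → 5 + n + E + E + a ≡ 3 + n + E + E + (2 + a)
            shift = solve-∀

    -- The input from address `p` on reads as the records of `xs`. As memory is 0 past the input,
    -- this makes sense for the empty list, too.
    At : ℕ → List (Fin m) → Set
    At p xs = ∀ a → I (p + a) ≡ fromList (concatMap node xs) a

    at-size : ∀ {p i xs} → At p (i ∷ xs) → I (1 + p) ≡ ∣ bag i ∣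
    at-size {p} at = trans (cong I (+-comm 1 p)) (at 1)

    at-next : ∀ {p i xs} → At p (i ∷ xs) → At (2 + p + I (1 + p)) xs
    at-next {p} {i} {xs} at a = trans (cong I eq) (trans (at _) (fromList-++ (node i) a))
      where
      eq : 2 + p + I (1 + p) + a ≡ p + (length (node i) + a)
      eq = trans (cong (λ s → 2 + p + s + a) (trans (at-size {p} {i} {xs} at)
             (trans (sym (length-members (bag i))) (sym (length-map toℕ (members (bag i)))))))
           (shift p (length (map toℕ (members (bag i)))) a)
        where shift : ∀ p s a → 2 + p + s + a ≡ p + (2 + s + a)
              shift = solve-∀

    at-pointer : ∀ k → k ≤ m → At (bagPointer k) (drop k (allFin m))
    at-pointer zero    _  = I-start
    at-pointer (suc k) k< = at-next {bagPointer k} {fromℕ< k<} {drop (suc k) (allFin m)}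
      (subst (At (bagPointer k)) (trans (cong (λ j → drop j (allFin m)) (sym (Fin.toℕ-fromℕ< k<)))
        (trans (drop-tabulate id (fromℕ< k<)) (cong (λ j → fromℕ< k< ∷ drop (suc j) (allFin m)) (Fin.toℕ-fromℕ< k<))))
        (at-pointer k (<⇒≤ k<)))

    at-node : ∀ i → At (bagPointer (toℕ i)) (i ∷ drop (suc (toℕ i)) (allFin m))
    at-node i = subst (At (bagPointer (toℕ i))) (drop-tabulate id i) (at-pointer (toℕ i) (Fin.toℕ≤n i))

  I-parent : ∀ i → I (bagPointer (toℕ i)) ≡ toℕ (parent i)
  I-parent i = trans (cong I (sym (+-identityʳ (bagPointer (toℕ i))))) (at-node i 0)

  I-size : ∀ i → I (1 + bagPointer (toℕ i)) ≡ ∣ bag i ∣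
  I-size i = at-size {bagPointer (toℕ i)} {i} {drop (suc (toℕ i)) (allFin m)} (at-node i)

  -- The record of the sentinel would lie past the end of the input, so its bag is empty.
  I-last-size : I (1 + bagPointer m) ≡ 0
  I-last-size = trans (cong I (+-comm 1 (bagPointer m))) (subst (At (bagPointer m))
    (trans (cong (λ k → drop k (allFin m)) (sym (length-tabulate {n = m} id))) (drop-all (allFin m)))
    (at-pointer m ≤-refl) 1)

  slot : Fin m → ℕ → ℕ
  slot i q = I (2 + bagPointer (toℕ i) + q)

  private
    slot≡ : ∀ i q → slot i q ≡ fromList (map toℕ (members (bag i)) ++ concatMap node (drop (suc (toℕ i)) (allFin m))) q
    slot≡ i q = trans (cong I (shift (bagPointer (toℕ i)) q)) (at-node i (2 + q))
      where shift : ∀ p q → 2 + p + q ≡ p + (2 + q)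
            shift = solve-∀

    <-members : ∀ {q} i → q < ∣ bag i ∣ → q < length (members (bag i))
    <-members i = subst (_ <_) (sym (length-members (bag i)))

  slot⁻ : ∀ i q → q < ∣ bag i ∣ → ∃[ v ] v ∈ bag i × slot i q ≡ toℕ v
  slot⁻ i q q< = let v , v∈ , eq = fromList-map⁻ toℕ (members (bag i)) q (<-members i q<) in
    v , proj₂ (∈-filter⁻ (_∈? bag i) {xs = allFin n} v∈) , trans (slot≡ i q) eq

  slot⁺ : ∀ i {v} → v ∈ bag i → ∃[ q ] q < ∣ bag i ∣ × slot i q ≡ toℕ v
  slot⁺ i {v} v∈ =
    let q , q< , eq = fromList-map⁺ toℕ (∈-filter⁺ (_∈? bag i) (∈-allFin v) v∈) in
    q , subst (q <_) (length-members (bag i)) q< , trans (slot≡ i q) eq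

  slot-injective : ∀ i {q q′} → q < ∣ bag i ∣ → q′ < ∣ bag i ∣ → slot i q ≡ slot i q′ → q ≡ q′
  slot-injective i {q} {q′} q< q′< eq =
    fromList-injective toℕ Fin.toℕ-injective (filter⁺ (_∈? bag i) (allFin⁺ n)) q q′
      (<-members i q<) (<-members i q′<) (trans (sym (slot≡ i q)) (trans eq (slot≡ i q′)))

  base : ℕ
  base = start + m * (2 + n)

  n≤base : n ≤ base
  n≤base = ≤-trans (m≤n+m n 5) (≤-trans (m≤m+n (5 + n) E) (≤-trans (m≤m+n (5 + n + E) E) (m≤m+n start _)))

  I-end : ∀ a → base ≤ a → I a ≡ 0
  I-end a base≤a = trans (cong I (sym (m+[n∸m]≡n start≤a))) (trans (I-start (a ∸ start))
    (fromList-end (concatMap node (allFin m)) (a ∸ start) (≤-trans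
      (subst (λ k → length (concatMap node (allFin m)) ≤ k * (2 + n)) (length-tabulate {n = m} id)
        (length-concatMap-≤ node (2 + n) (λ i → s≤s (s≤s (subst (_≤ n)
          (trans (sym (length-members (bag i))) (sym (length-map toℕ (members (bag i))))) (∣p∣≤n (bag i))))) (allFin m)))
      (subst (_≤ a ∸ start) (m+n∸m≡n start (m * (2 + n))) (∸-monoˡ-≤ start base≤a)))))
    where start≤a = ≤-trans (m≤m+n start (m * (2 + n))) base≤a

-- Dynamic programming on a tree

∑-cong : ∀ n {f g : ℕ → ℕ} → (∀ i → i < n → f i ≡ g i) → ∑ n f ≡ ∑ n g
∑-cong zero    h = refl
∑-cong (suc n) h = cong₂ _+_ (∑-cong n λ i i< → h i (m≤n⇒m≤1+n i<)) (h n ≤-refl)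

∑-mono : ∀ n {f g : ℕ → ℕ} → (∀ i → i < n → f i ≤ g i) → ∑ n f ≤ ∑ n g
∑-mono zero    h = z≤n
∑-mono (suc n) h = +-mono-≤ (∑-mono n λ i i< → h i (m≤n⇒m≤1+n i<)) (h n ≤-refl)

∑-0 : ∀ n {f : ℕ → ℕ} → (∀ i → i < n → f i ≡ 0) → ∑ n f ≡ 0
∑-0 zero    h = refl
∑-0 (suc n) h = cong₂ _+_ (∑-0 n λ i i< → h i (m≤n⇒m≤1+n i<)) (h n ≤-refl)

∑-+ : ∀ n (f g : ℕ → ℕ) → ∑ n (λ i → f i + g i) ≡ ∑ n f + ∑ n g
∑-+ zero    f g = refl
∑-+ (suc n) f g = trans (cong (_+ (f n + g n)) (∑-+ n f g)) (shuffle (∑ n f) (∑ n g) (f n) (g n))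
  where shuffle : ∀ a b c d → a + b + (c + d) ≡ a + c + (b + d)
        shuffle = solve-∀

∑-swap : ∀ m n (f : ℕ → ℕ → ℕ) → ∑ m (λ i → ∑ n (f i)) ≡ ∑ n (λ j → ∑ m (λ i → f i j))
∑-swap zero    n f = sym (∑-0 n λ _ _ → refl)
∑-swap (suc m) n f = trans (cong (_+ ∑ n (f m)) (∑-swap m n f)) (sym (∑-+ n _ (f m)))

term≤∑ : ∀ n (f : ℕ → ℕ) i → i < n → f i ≤ ∑ n f
term≤∑ (suc n) f i i< with m≤n⇒m<n∨m≡n (s≤s⁻¹ i<)
... | inj₁ i<n  = ≤-trans (term≤∑ n f i i<n) (m≤m+n _ _)
... | inj₂ refl = m≤n+m (f n) _

∑-≡⇒≡ : ∀ n (f g : ℕ → ℕ) → (∀ i → i < n → f i ≤ g i) → ∑ n f ≡ ∑ n g → ∀ i → i < n → f i ≡ g i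
∑-≡⇒≡ (suc n) f g h eq i i< with m≤n⇒m<n∨m≡n (s≤s⁻¹ i<)
... | inj₁ i<n  = ∑-≡⇒≡ n f g (λ i i< → h i (m≤n⇒m≤1+n i<)) front i i<n
  where
  ∑≤ = ∑-mono n {f} {g} λ i i< → h i (m≤n⇒m≤1+n i<)
  front : ∑ n f ≡ ∑ n g
  front = ≤-antisym ∑≤ (≮⇒≥ λ lt → <⇒≢ (+-mono-<-≤ lt (h n ≤-refl)) eq)
... | inj₂ refl = ≤-antisym (h n ≤-refl) (≮⇒≥ λ lt →
    <⇒≢ (+-mono-≤-< (∑-mono n {f} {g} λ i i< → h i (m≤n⇒m≤1+n i<)) lt) eq)

only : ℕ → ℕ → ℕ → ℕ
only j a i = if i ≡ᵇ j then a else 0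

only-≡ : ∀ j a → only j a j ≡ a
only-≡ j a rewrite ≡ᵇ-refl j = refl

only-≢ : ∀ {i j} a → i ≢ j → only j a i ≡ 0
only-≢ a i≢j rewrite ≢⇒≡ᵇ i≢j = refl

∑-only : ∀ n j a → j < n → ∑ n (only j a) ≡ a
∑-only (suc n) j a j< with m≤n⇒m<n∨m≡n (s≤s⁻¹ j<)
... | inj₁ j<n  = trans (cong₂ _+_ (∑-only n j a j<n) (only-≢ a (<⇒≢ j<n ∘ sym))) (+-identityʳ a)
... | inj₂ refl = cong₂ _+_ (∑-0 n λ i i<n → only-≢ a (<⇒≢ i<n)) (only-≡ n a)

minimum : ℕ → ℕ → (ℕ → ℕ) → ℕ
minimum n a f = iter n (λ i a → a ∸ (a ∸ f i)) a

min-cases : ∀ a b → (a ∸ (a ∸ b) ≡ a × a ≤ b) ⊎ (a ∸ (a ∸ b) ≡ b × b ≤ a)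
min-cases a b with ≤-total a b
... | inj₁ a≤b = inj₁ (cong (a ∸_) (m≤n⇒m∸n≡0 a≤b) , a≤b)
... | inj₂ b≤a = inj₂ (m∸[m∸n]≡n b≤a , b≤a)

minimum-≤ : ∀ n a f i → i < n → minimum n a f ≤ f i
minimum-≤ (suc n) a f i i< with min-cases (minimum n a f) (f n) | m≤n⇒m<n∨m≡n (s≤s⁻¹ i<)
... | inj₁ (eq , _)  | inj₁ i<n  = ≤-trans (≤-reflexive eq) (minimum-≤ n a f i i<n)
... | inj₁ (eq , le) | inj₂ refl = ≤-trans (≤-reflexive eq) le
... | inj₂ (eq , le) | inj₁ i<n  = ≤-trans (≤-reflexive eq) (≤-trans le (minimum-≤ n a f i i<n))
... | inj₂ (eq , _)  | inj₂ refl = ≤-reflexive eq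

minimum-attained : ∀ n a f → minimum n a f < a → ∃[ i ] i < n × minimum n a f ≡ f i
minimum-attained zero    a f lt = contradiction lt (n≮n a)
minimum-attained (suc n) a f lt with min-cases (minimum n a f) (f n)
... | inj₁ (eq , _) =
      let i , i< , eq′ = minimum-attained n a f (subst (_< a) eq lt) in i , m≤n⇒m≤1+n i< , trans eq eq′
... | inj₂ (eq , _) = n , ≤-refl , eq

minimum-cong : ∀ n a {f g} → (∀ i → i < n → f i ≡ g i) → minimum n a f ≡ minimum n a g
minimum-cong zero    a h = refl
minimum-cong (suc n) a h =
  cong₂ (λ x y → x ∸ (x ∸ y)) (minimum-cong n a λ i i< → h i (m≤n⇒m≤1+n i<)) (h n ≤-refl)

-- The node m is a sentinel: the parent of the root.
module TreeOptimisation (m K INF : ℕ) (parent : ℕ → ℕ) (nodeCost : ℕ → ℕ → ℕ → ℕ)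
  (nodeCost-m : ∀ x y → nodeCost m x y ≡ 0) where

  Bounded : (ℕ → ℕ) → Set
  Bounded σ = ∀ i → σ i < K

  Total : (ℕ → ℕ) → ℕ
  Total σ = ∑ (suc m) (λ i → nodeCost i (σ i) (σ (parent i)))

  -- A p s is the least contribution of the finished children of p if p has
  -- state s.  Finishing a node j moves the minimum over the states of j into
  -- the table of its parent, so the minimum of the potential never changes.
  module _ (done : ℕ → ℕ) (A : ℕ → ℕ → ℕ) where
    remaining : (ℕ → ℕ) → ℕ → ℕ
    remaining σ i = caseZ (done i) (nodeCost i (σ i) (σ (parent i)) + A i (σ i)) 0

    Potential : (ℕ → ℕ) → ℕ
    Potential σ = ∑ (suc m) (remaining σ)

    -- Equality of the minima of potential and total, below `INF`: the minimum defining a message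
    -- starts from `INF` and is attained only below it.
    record Exact : Set where
      field
        below    : ∀ σ → Bounded σ → Potential σ ≤ Total σ
        attained : ∀ σ → Bounded σ → Potential σ < INF →
                   ∃[ σ′ ] Bounded σ′ × Total σ′ ≤ Potential σ

  open Exact

  exact-start : ∀ {done A} → (∀ i → done i ≡ 0) → (∀ i s → A i s ≡ 0) → Exact done A
  exact-start {done} {A} undone A≡0 = record
    { below = λ σ _ → ≤-reflexive (same σ)
    ; attained = λ σ b _ → σ , b , ≤-reflexive (sym (same σ)) }
    where
    same : ∀ σ → Potential done A σ ≡ Total σ
    same σ = ∑-cong (suc m) λ i _ → trans (cong (λ d → caseZ d _ 0) (undone i))
      (trans (cong (_ +_) (A≡0 i (σ i))) (+-identityʳ _))

  record Step (j : ℕ) (done done′ : ℕ → ℕ) (A A′ : ℕ → ℕ → ℕ) : Set where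
    field
      message        : ℕ → ℕ
      j<m            : j < m
      parent≤m       : parent j ≤ m
      parent≢        : parent j ≢ j
      undone         : done j ≡ 0
      parent-undone  : done (parent j) ≡ 0
      children-done  : ∀ i → i < m → parent i ≡ j → done i ≢ 0
      done-j         : done′ j ≢ 0
      done-other     : ∀ i → i ≢ j → done′ i ≡ done i
      A-parent       : ∀ s → s < K → A′ (parent j) s ≡ A (parent j) s + message s
      A-other        : ∀ i → i ≤ m → i ≢ parent j → ∀ s → s < K → A′ i s ≡ A i s
      message-below  : ∀ s x → s < K → x < K → message s ≤ nodeCost j x s + A j x
      message-attained : ∀ s → s < K → message s < INF →
                         ∃[ x ] x < K × message s ≡ nodeCost j x s + A j x

  module _ {j done done′ A A′} (step : Step j done done′ A A′) where
    open Step step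

    private
      p : ℕ
      p = parent j

      own : (ℕ → ℕ) → ℕ
      own σ = nodeCost j (σ j) (σ p) + A j (σ j)

      caseZ-≢ : ∀ {c a b : ℕ} → c ≢ 0 → caseZ c a b ≡ b
      caseZ-≢ {zero}  c≢ = contradiction refl c≢
      caseZ-≢ {suc _} c≢ = refl

      -- Only two summands change: that of `j` disappears and that of its parent gains the message.
      -- Both sides are sums to avoid truncated subtraction.
      exchange : ∀ σ → Bounded σ → Potential done′ A′ σ + own σ ≡ Potential done A σ + message (σ p)
      exchange σ b = trans (cong (Potential done′ A′ σ +_) (sym (∑-only (suc m) j (own σ) (m≤n⇒m≤1+n j<m))))
        (trans (sym (∑-+ (suc m) (remaining done′ A′ σ) (only j (own σ))))
        (trans (∑-cong (suc m) pointwise)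
        (trans (∑-+ (suc m) (remaining done A σ) (only p (message (σ p))))
          (cong (Potential done A σ +_) (∑-only (suc m) p (message (σ p)) (s≤s parent≤m))))))
        where
        pointwise : ∀ i → i < suc m → remaining done′ A′ σ i + only j (own σ) i ≡
                                      remaining done A σ i + only p (message (σ p)) i
        pointwise i i≤ with i ≟ j | i ≟ p
        ... | yes refl | yes eq = contradiction (sym eq) parent≢
        ... | yes refl | no i≢p =
              trans (cong₂ _+_ (caseZ-≢ done-j) (only-≡ i (own σ)))
                (sym (trans (cong₂ _+_ (cong (λ d → caseZ d (own σ) 0) undone) (only-≢ (message (σ p)) i≢p))
                  (+-identityʳ _)))
        ... | no i≢j | yes refl =
              trans (cong₂ _+_ (cong₂ (λ d a → caseZ d (nodeCost i (σ i) (σ (parent i)) + a) 0)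
                      (trans (done-other i i≢j) parent-undone) (A-parent (σ i) (b i))) (only-≢ (own σ) i≢j))
                (trans (trans (+-identityʳ _) (sym (+-assoc (nodeCost i (σ i) (σ (parent i))) (A i (σ i)) (message (σ i)))))
                  (sym (cong₂ _+_ (cong (λ d → caseZ d (nodeCost i (σ i) (σ (parent i)) + A i (σ i)) 0) parent-undone)
                                  (only-≡ i (message (σ i))))))
        ... | no i≢j | no i≢p =
              cong₂ _+_ (cong₂ (λ d a → caseZ d (nodeCost i (σ i) (σ (parent i)) + a) 0)
                          (done-other i i≢j) (A-other i (s≤s⁻¹ i≤) i≢p (σ i) (b i)))
                        (trans (only-≢ (own σ) i≢j) (sym (only-≢ (message (σ p)) i≢p)))

      module _ (σ : ℕ → ℕ) (x : ℕ) where
        σ[j] : ℕ → ℕ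
        σ[j] i = if i ≡ᵇ j then x else σ i

        σ[j]-≡ : σ[j] j ≡ x
        σ[j]-≡ rewrite ≡ᵇ-refl j = refl

        σ[j]-≢ : ∀ {i} → i ≢ j → σ[j] i ≡ σ i
        σ[j]-≢ i≢ rewrite ≢⇒≡ᵇ i≢ = refl

        σ[j]-bounded : Bounded σ → x < K → Bounded σ[j]
        σ[j]-bounded b x<K i with i ≡ᵇ j
        ... | true  = x<K
        ... | false = b i

        -- The state of `j` occurs only in the terms of `j` and of its children, and all of these
        -- are finished.
        independent : Potential done′ A′ σ[j] ≡ Potential done′ A′ σ
        independent = ∑-cong (suc m) pointwise
          where
          pointwise : ∀ i → i < suc m → remaining done′ A′ σ[j] i ≡ remaining done′ A′ σ i
          pointwise i i≤ with i ≟ j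
          ... | yes refl = trans (caseZ-≢ done-j) (sym (caseZ-≢ done-j))
          ... | no i≢j with m≤n⇒m<n∨m≡n (s≤s⁻¹ i≤)
          -- The parent of the sentinel may be any number, even `j`; its cost is 0 whatever the
          -- states are.
          ...   | inj₂ refl = cong₂ (λ c a → caseZ (done′ i) (c + a) 0)
                    (trans (nodeCost-m _ _) (sym (nodeCost-m _ _))) (cong (A′ i) (σ[j]-≢ i≢j))
          ...   | inj₁ i<m with parent i ≟ j
          ...     | no pi≢j = cong₂ (λ s s′ → caseZ (done′ i) (nodeCost i s s′ + A′ i s) 0)
                      (σ[j]-≢ i≢j) (σ[j]-≢ pi≢j)
          ...     | yes pi≡j = trans (caseZ-≢ i-done) (sym (caseZ-≢ i-done))
            where i-done : done′ i ≢ 0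
                  i-done = children-done i i<m pi≡j ∘ trans (sym (done-other i i≢j))

    exact-step : Exact done A → Exact done′ A′
    exact-step ex = record { below = below′ ; attained = attained′ }
      where
      decreases : ∀ σ → Bounded σ → Potential done′ A′ σ ≤ Potential done A σ
      decreases σ b = +-cancelʳ-≤ (own σ) _ _ (≤-trans (≤-reflexive (exchange σ b))
        (+-monoʳ-≤ (Potential done A σ) (message-below (σ p) (σ j) (b p) (b j))))

      below′ : ∀ σ → Bounded σ → Potential done′ A′ σ ≤ Total σ
      below′ σ b = ≤-trans (decreases σ b) (below ex σ b)

      -- The message is part of the summand of the unfinished parent, so a potential below `INF`
      -- forces the message below `INF`.
      message≤ : ∀ σ → Bounded σ → message (σ p) ≤ Potential done′ A′ σ
      message≤ σ b = ≤-trans (≤-trans (m≤n+m _ (A p (σ p))) (≤-trans (≤-reflexive (sym (A-parent (σ p) (b p))))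
        (≤-trans (m≤n+m _ (nodeCost p (σ p) (σ (parent p)))) (≤-reflexive (sym (cong (λ d → caseZ d (nodeCost p (σ p) (σ (parent p)) + A′ p (σ p)) 0)
          (trans (done-other p parent≢) parent-undone)))))))
        (term≤∑ (suc m) (remaining done′ A′ σ) p (s≤s parent≤m))

      attained′ : ∀ σ → Bounded σ → Potential done′ A′ σ < INF →
                  ∃[ σ′ ] Bounded σ′ × Total σ′ ≤ Potential done′ A′ σ
      attained′ σ b lt =
        -- Moving `j` to a state where its message is attained makes the old potential equal to the
        -- new one, so that the old claim applies.
        let x , x<K , eq = message-attained (σ p) (b p) (≤-<-trans (message≤ σ b) lt)
            σ₂  = σ[j] σ x
            b₂  = σ[j]-bounded σ x b x<K
            own≡ : own σ₂ ≡ message (σ₂ p)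
            own≡ = trans (cong₂ (λ y s → nodeCost j y s + A j y) (σ[j]-≡ σ x) (σ[j]-≢ σ x parent≢))
                     (trans (sym eq) (cong message (sym (σ[j]-≢ σ x parent≢))))
            Φ≡ : Potential done A σ₂ ≡ Potential done′ A′ σ
            Φ≡ = trans (+-cancelʳ-≡ (message (σ₂ p)) _ _
                   (trans (sym (exchange σ₂ b₂)) (cong (Potential done′ A′ σ₂ +_) own≡))) (independent σ x)
            σ′ , b′ , le = attained ex σ₂ b₂ (subst (_< INF) (sym Φ≡) lt)
        in σ′ , b′ , subst (Total σ′ ≤_) Φ≡ le

  module _ {done A} (ex : Exact done A) (all-done : ∀ i → i < m → done i ≢ 0) (m-undone : done m ≡ 0) where
    private
      final : ∀ σ → Potential done A σ ≡ A m (σ m)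
      final σ = trans (cong₂ _+_ (∑-0 m λ i i<m → zero-at i (all-done i i<m))
                  (trans (cong (λ d → caseZ d _ 0) m-undone) (cong (_+ A m (σ m)) (nodeCost-m _ _)))) refl
        where
        zero-at : ∀ i → done i ≢ 0 → remaining done A σ i ≡ 0
        zero-at i d≢ with done i
        ... | zero  = contradiction refl d≢
        ... | suc _ = refl

    optimum-below : ∀ σ → Bounded σ → A m (σ m) ≤ Total σ
    optimum-below σ b = subst (_≤ Total σ) (final σ) (below ex σ b)

    optimum-attained : ∀ {s} → s < K → A m s < INF → ∃[ σ ] Bounded σ × Total σ ≤ A m s
    optimum-attained {s} s<K lt =
      let σ′ , b , le = attained ex (λ _ → s) (λ _ → s<K) (subst (_< INF) (sym (final (λ _ → s))) lt) in
      σ′ , b , subst (Total σ′ ≤_) (final (λ _ → s)) le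

-- The memory after a program

iter-invariant : ∀ {A : Set} (Inv : ℕ → A → Set) n {f : ℕ → A → A} {a} → Inv 0 a →
                 (∀ i a → i < n → Inv i a → Inv (suc i) (f i a)) → Inv n (iter n f a)
iter-invariant Inv zero    start next = start
iter-invariant Inv (suc n) start next =
  next n _ ≤-refl (iter-invariant Inv n start λ i a i< → next i a (m≤n⇒m≤1+n i<))

write-≡ : ∀ μ t i a → write μ t i a t i ≡ a
write-≡ μ t i a rewrite ≡ᵇ-refl (offset t) | ≡ᵇ-refl i = refl

write-≢ : ∀ μ t {i i′} a → i′ ≢ i → write μ t i a t i′ ≡ μ t i′
write-≢ μ t a i′≢i rewrite ≡ᵇ-refl (offset t) | ≢⇒≡ᵇ i′≢i = refl

write-tag : ∀ μ {t t′} i a i′ → (offset t′ ≡ᵇ offset t) ≡ false → write μ t i a t′ i′ ≡ μ t′ i′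
write-tag μ i a i′ t≢ rewrite t≢ = refl

-- Boolean, so that for a concrete statement the side condition of `frame` holds by `refl`.
writes : ∀ {k} → Stmt k → Tag → Bool
writes (store t _ _) t′ = offset t′ ≡ᵇ offset t
writes (s ⨾ s′)      t′ = writes s t′ ∨ writes s′ t′
writes (when _ a b)  t′ = writes a t′ ∨ writes b t′
writes (bindS _ s)   t′ = writes s t′
writes (for _ s)     t′ = writes s t′

readsOnly : (Tag → Bool) → ∀ {k} → Tm k → Bool
readsOnly ok (num _)        = true
readsOnly ok (var _)        = true
readsOnly ok (par _)        = true
readsOnly ok (inp e)        = readsOnly ok e
readsOnly ok (arr t e)      = ok t ∧ readsOnly ok e
readsOnly ok (e ⊞ e′)       = readsOnly ok e ∧ readsOnly ok e′
readsOnly ok (e ⊟ e′)       = readsOnly ok e ∧ readsOnly ok e′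
readsOnly ok (ifz c a b)    = readsOnly ok c ∧ (readsOnly ok a ∧ readsOnly ok b)
readsOnly ok (bind e b)     = readsOnly ok e ∧ readsOnly ok b
readsOnly ok (fold _ e b o) = readsOnly ok e ∧ (readsOnly ok b ∧ readsOnly ok o)

module Framing (I : ℕ → ℕ) where
  open Semantics I

  private
    ∨-falseˡ : ∀ {a b} → a ∨ b ≡ false → a ≡ false
    ∨-falseˡ {false} _ = refl

    ∨-falseʳ : ∀ {a b} → a ∨ b ≡ false → b ≡ false
    ∨-falseʳ {false} eq = eq

  frame : ∀ {k} (s : Stmt k) {π ρ μ t} → writes s t ≡ false → ∀ i → exec s π ρ μ t i ≡ μ t i
  frame (store t e e′) {μ = μ} w i = write-tag μ _ _ i w
  frame (s ⨾ s′) w i = trans (frame s′ (∨-falseʳ {writes s _} w) i) (frame s (∨-falseˡ w) i)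
  frame (when c a b) {π} {ρ} {μ} w i with eval c π μ ρ
  ... | zero  = frame a (∨-falseˡ w) i
  ... | suc _ = frame b (∨-falseʳ {writes a _} w) i
  frame (bindS e s) w i = frame s w i
  frame (for P s) {π} {ρ} {μ} {t} w i =
    iter-invariant (λ _ (μ′ : Mem) → μ′ t i ≡ μ t i) (π P) {λ j → exec s π (j ∷ ρ)} refl
      λ j μ′ _ eq → trans (frame s {μ = μ′} w i) eq

  iter-cong : ∀ {A : Set} n {f g : ℕ → A → A} {a} → (∀ i a → f i a ≡ g i a) → iter n f a ≡ iter n g a
  iter-cong zero    h = refl
  iter-cong (suc n) {f} h = trans (cong (f n) (iter-cong n h)) (h n _)

  module _ (ok : Tag → Bool) {μ μ′ : Mem} (agree : ∀ t → ok t ≡ true → ∀ i → μ t i ≡ μ′ t i) where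
    private
      ∧-l : ∀ {a b} → a ∧ b ≡ true → a ≡ true
      ∧-l {true} _ = refl

      ∧-r : ∀ {a b} → a ∧ b ≡ true → b ≡ true
      ∧-r {true} eq = eq

    eval-agree : ∀ {k} (e : Tm k) {π} ρ → readsOnly ok e ≡ true → eval e π μ ρ ≡ eval e π μ′ ρ
    eval-agree (num _)     ρ h = refl
    eval-agree (var _)     ρ h = refl
    eval-agree (par _)     ρ h = refl
    eval-agree (inp e)     ρ h = cong I (eval-agree e ρ h)
    eval-agree (arr t e)   ρ h =
      trans (cong (μ t) (eval-agree e ρ (∧-r {ok t} h))) (agree t (∧-l h) _)
    eval-agree (e ⊞ e′)    ρ h =
      cong₂ _+_ (eval-agree e ρ (∧-l h)) (eval-agree e′ ρ (∧-r {readsOnly ok e} h))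
    eval-agree (e ⊟ e′)    ρ h =
      cong₂ _∸_ (eval-agree e ρ (∧-l h)) (eval-agree e′ ρ (∧-r {readsOnly ok e} h))
    eval-agree (ifz c a b) {π} ρ h =
      trans (cong (λ x → caseZ x (eval a π μ ρ) (eval b π μ ρ)) (eval-agree c ρ (∧-l h)))
        (cong₂ (caseZ (eval c π μ′ ρ)) (eval-agree a ρ (∧-l h′)) (eval-agree b ρ (∧-r {readsOnly ok a} h′)))
      where h′ = ∧-r {readsOnly ok c} h
    eval-agree (bind e b) {π} ρ h =
      trans (cong (λ v → eval b π μ (v ∷ ρ)) (eval-agree e ρ (∧-l h)))
            (eval-agree b _ (∧-r {readsOnly ok e} h))
    eval-agree (fold P e b o) {π} ρ h =
      trans (cong (iter (π P) _) (eval-agree e ρ (∧-l h)))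
        (iter-cong (π P) λ i a →
          trans (cong (λ v → eval o π μ (a ∷ v ∷ [])) (eval-agree b (i ∷ ρ) (∧-l h′)))
                (eval-agree o _ (∧-r {readsOnly ok b} h′)))
      where h′ = ∧-r {readsOnly ok e} h

  fill : ∀ {P t e π μ} (g : ℕ → ℕ) → μ t 0 ≡ g 0 →
         (∀ i μ′ → i < π P → μ′ t i ≡ g i → eval e π μ′ (i ∷ []) ≡ g (suc i)) →
         ∀ k → k ≤ π P → exec (for P (store t (num 1 ⊞ var 0F) e)) π [] μ t k ≡ g k
  fill {P} {t} {e} {π} {μ} g start next =
    iter-invariant (λ i μ′ → ∀ k → k ≤ i → μ′ t k ≡ g k) (π P)
      (λ { _ z≤n → start })
      (λ i μ′ i< ih k k≤ → [ (λ k< → trans (write-≢ μ′ t _ (<⇒≢ k<)) (ih k (s≤s⁻¹ k<)))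
                           , (λ { refl → trans (write-≡ μ′ t (suc i) _) (next i μ′ i< (ih i ≤-refl)) })
                           ]′ (m≤n⇒m<n∨m≡n k≤))

module Counting (f : ℕ → ℕ) where

  -- With the parent function for `f`, `count i (f i)` is the number of earlier siblings of `i`, and
  -- `count m p` the number of children of `p`.
  count : ℕ → ℕ → ℕ
  count k p = ∑ k (λ i → only p 1 (f i))

  count-mono : ∀ {k k′} p → k ≤ k′ → count k p ≤ count k′ p
  count-mono {k} {k′} p k≤k′ = subst (λ x → count k p ≤ count x p) (m∸n+n≡m k≤k′) (go (k′ ∸ k))
    where go : ∀ d → count k p ≤ count (d + k) p
          go zero    = ≤-refl
          go (suc d) = ≤-trans (go d) (m≤m+n _ _)

  count-suc : ∀ i → count (suc i) (f i) ≡ suc (count i (f i))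
  count-suc i = trans (cong (count i (f i) +_) (only-≡ (f i) 1)) (+-comm _ 1)

  count-< : ∀ {i k} → i < k → count i (f i) < count k (f i)
  count-< {i} {k} i<k = ≤-trans (≤-reflexive (sym (count-suc i))) (count-mono (f i) i<k)

  count-injective : ∀ {i j} → f i ≡ f j → count i (f i) ≡ count j (f j) → i ≡ j
  count-injective {i} {j} f≡ c≡ with <-cmp i j
  ... | tri< i<j _ _ = contradiction (trans c≡ (cong (count j) (sym f≡))) (<⇒≢ (count-< i<j))
  ... | tri≈ _ i≡j _ = i≡j
  ... | tri> _ _ j<i = contradiction (trans (sym c≡) (cong (count i) f≡)) (<⇒≢ (count-< j<i))

  count-at : ∀ k {p c} → c < count k p → ∃[ i ] i < k × f i ≡ p × count i p ≡ c
  count-at (suc k) {p} {c} c< with f k ≟ p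
  ... | no f≢ =
        let i , i< , rest = count-at k (subst (c <_) (trans (cong (count k p +_) (only-≢ 1 f≢)) (+-identityʳ _)) c<)
        in i , m≤n⇒m≤1+n i< , rest
  ... | yes refl with m≤n⇒m<n∨m≡n (s≤s⁻¹ (subst (c <_) (count-suc k) c<))
  ...   | inj₁ c<′ = let i , i< , rest = count-at k c<′ in i , m≤n⇒m≤1+n i< , rest
  ...   | inj₂ c≡ = k , ≤-refl , refl , sym c≡

iter-times : ∀ n x → iter n (λ _ a → a + x) 0 ≡ n * x
iter-times zero    x = refl
iter-times (suc n) x = trans (cong (_+ x) (iter-times n x)) (+-comm (n * x) x)

iter-plus : ∀ n x y → iter n (λ _ a → a + x) y ≡ n * x + y
iter-plus zero    x y = refl
iter-plus (suc n) x y = trans (cong (_+ x) (iter-plus n x y)) (trans (+-comm _ x) (sym (+-assoc x (n * x) y)))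

iter-power : ∀ n x → iter n (λ _ a → iter x (λ _ a′ → a′ + a) 0) 1 ≡ x ^ n
iter-power zero    x = refl
iter-power (suc n) x = trans (iter-times x _) (cong (x *_) (iter-power n x))

maximum : ℕ → (ℕ → ℕ) → ℕ
maximum n f = iter n (λ i a → a + (f i ∸ a)) 0

≤-maximum : ∀ n f i → i < n → f i ≤ maximum n f
≤-maximum (suc n) f i i< with m≤n⇒m<n∨m≡n (s≤s⁻¹ i<)
... | inj₁ i<n  = ≤-trans (≤-maximum n f i i<n) (m≤m+n _ _)
... | inj₂ refl = m≤n+m∸n (f n) (maximum n f)

maximum-≤ : ∀ n f c → (∀ i → i < n → f i ≤ c) → maximum n f ≤ c
maximum-≤ zero    f c h = z≤n
maximum-≤ (suc n) f c h with ≤-total (f n) (maximum n f)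
... | inj₁ ≤ = subst (_≤ c) (sym (trans (cong (maximum n f +_) (m≤n⇒m∸n≡0 ≤)) (+-identityʳ _)))
                 (maximum-≤ n f c λ i i< → h i (m≤n⇒m≤1+n i<))
... | inj₂ ≥ = subst (_≤ c) (sym (m+[n∸m]≡n ≥)) (h n ≤-refl)

-- The value of the term a ≐ b.
distance : ℕ → ℕ → ℕ
distance a b = (a ∸ b) + (b ∸ a)

distance-refl : ∀ a → distance a a ≡ 0
distance-refl a = cong₂ _+_ (n∸n≡0 a) (n∸n≡0 a)

distance≡0 : ∀ {a b} → distance a b ≡ 0 → a ≡ b
distance≡0 {a} {b} eq =
  ≤-antisym (m∸n≡0⇒m≤n (m+n≡0⇒m≡0 _ eq)) (m∸n≡0⇒m≤n (m+n≡0⇒n≡0 (a ∸ b) eq))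

caseZ-0 : ∀ {A : Set} {c} {a b : A} → c ≡ 0 → caseZ c a b ≡ a
caseZ-0 refl = refl

caseZ-≢0 : ∀ {A : Set} {c} {a b : A} → c ≢ 0 → caseZ c a b ≡ b
caseZ-≢0 {c = zero}  c≢ = contradiction refl c≢
caseZ-≢0 {c = suc _} c≢ = refl

address-pair-injective : ∀ {n} {u u′ v v′ : Fin n} →
                         toℕ u * n + toℕ v ≡ toℕ u′ * n + toℕ v′ → u ≡ u′ × v ≡ v′
address-pair-injective {n} {u} {u′} {v} {v′} eq =
  Fin.combine-injective u v u′ v′ (Fin.toℕ-injective
    (trans (Fin.toℕ-combine u v) (trans (cong (_+ toℕ v) (*-comm n (toℕ u)))
      (trans eq (sym (trans (Fin.toℕ-combine u′ v′) (cong (_+ toℕ v′) (*-comm n (toℕ u′)))))))))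

-- Parameters and memory before the main loop

module Preparation {n m} (ℓ : ℕ) (G : Graph n) (V′ : Subset n) (D : NiceTreeDecomposition G m) where
  open NiceTreeDecomposition D
  open Encoding ℓ G V′ D
  open Semantics I
  open Framing I

  parentℕ : ℕ → ℕ
  parentℕ i = caseZ (distance i (toℕ root)) m (I (bagPointer i))

  parentℕ-root : parentℕ (toℕ root) ≡ m
  parentℕ-root = caseZ-0 (distance-refl (toℕ root))

  parentℕ-other : ∀ {j} → j ≢ root → parentℕ (toℕ j) ≡ toℕ (parent j)
  parentℕ-other {j} j≢ = trans (caseZ-≢0 (j≢ ∘ Fin.toℕ-injective ∘ distance≡0)) (I-parent j)

  open Counting parentℕ public

  record Input (π : Params) : Set where
    field
      n≡ : π pn ≡ n
      m≡ : π pm ≡ m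
      E≡ : π pE ≡ E

  HasPointers : Mem → Set
  HasPointers μ = ∀ k → k ≤ m → μ BP k ≡ bagPointer k

  record Setup (π : Params) (μ : Mem) : Set where
    field
      input    : Input π
      ℓ≡       : π pℓ ≡ ℓ
      b≥       : ∀ i → ∣ bag i ∣ ≤ π pb
      D≡       : π pD ≡ π pb + π pb + π pb + π pb
      B≡       : E ≢ 0 → π pB ≡ 3 + ℓ
      K≡       : π pK ≡ π pB ^ π pD
      TW≡      : π pTW ≡ 2 ^ n
      INF≡     : π pINF ≡ n * 2 ^ n + 2 ^ n
      IT≡      : π pIT ≡ 1 + m + m
      pointers : HasPointers μ
      powers≡  : ∀ k → k ≤ n → μ PW k ≡ 2 ^ k
      times≡   : ∀ k → k ≤ n → μ MN k ≡ k * n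
      adj⁺     : ∀ {u v} → Adj G u v → 1 ≤ μ ADJ (toℕ u * n + toℕ v)
      adj⁻     : ∀ {u v} → 1 ≤ μ ADJ (toℕ u * n + toℕ v) → Adj G u v
      children≡ : ∀ i → μ NC i ≡ count m i
      side≡    : ∀ i → i < m → μ SD i ≡ count i (parentℕ i)
      table≡0  : ∀ i → μ TAB i ≡ 0
      done≡0   : ∀ i → μ DONE i ≡ 0
      number≡0 : ∀ i → μ DN i ≡ 0
      cursor≡0 : ∀ i → μ CUR i ≡ 0

  module _ {π : Params} (inputs : Input π) where
    open Input inputs

    rootT≡ : I (4 + π pn + π pE + π pE) ≡ toℕ root
    rootT≡ = trans (cong₂ (λ a e → I (4 + a + e + e)) n≡ E≡) I-root

    parT≡ : ∀ {k} (x : Fin k) {μ ρ} → μ BP (lookup ρ x) ≡ bagPointer (lookup ρ x) →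
            eval (parT x) π μ ρ ≡ parentℕ (lookup ρ x)
    parT≡ x {μ} {ρ} eq = trans (cong (λ r → caseZ (distance (lookup ρ x) r) (π pm) (I (μ BP (lookup ρ x)))) rootT≡)
      (cong₂ (caseZ (distance (lookup ρ x) (toℕ root))) m≡ (cong I eq))

    bagPointers-correct : ∀ μ → HasPointers (exec bagPointers π [] μ)
    bagPointers-correct μ k k≤ =
      fill {pm} {BP} {num 2 ⊞ arr BP (var 0F) ⊞ sizeT 0F} {π} bagPointer
        (trans (write-≡ μ BP 0 _) (cong₂ (λ a e → 5 + a + e + e) n≡ E≡))
        (λ i μ′ _ eq → cong (λ p → 2 + p + I (1 + p)) eq) k (subst (k ≤_) (sym m≡) k≤)

    powers-correct : ∀ μ k → k ≤ n → exec powers π [] μ PW k ≡ 2 ^ k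
    powers-correct μ k k≤ =
      fill {pn} {PW} {arr PW (var 0F) ⊞ arr PW (var 0F)} {π} (2 ^_) (write-≡ μ PW 0 1)
        (λ i μ′ _ eq → trans (cong (λ p → p + p) eq) (cong (2 ^ i +_) (sym (+-identityʳ (2 ^ i)))))
        k (subst (k ≤_) (sym n≡) k≤)

    multiples-correct : ∀ μ → μ MN 0 ≡ 0 → ∀ k → k ≤ n → exec multiples π [] μ MN k ≡ k * n
    multiples-correct μ start k k≤ =
      fill {pn} {MN} {par pn ⊞ arr MN (var 0F)} {π} (_* n) start
        (λ i μ′ _ eq → cong₂ _+_ n≡ eq) k (subst (k ≤_) (sym n≡) k≤)

    module _ (μ : Mem) (times≡ : ∀ k → k ≤ n → μ MN k ≡ k * n) (empty : ∀ a → μ ADJ a ≡ 0) where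
      private
        first second : ℕ → ℕ
        first  i = I (3 + π pn + i + i)
        second i = I (4 + π pn + i + i)

        Mark : ℕ → ℕ → Set
        Mark k a = ∃[ i ] i < k × (a ≡ μ MN (first i) + second i ⊎ a ≡ μ MN (second i) + first i)

        record Marked (k : ℕ) (μ′ : Mem) : Set where
          field
            unchanged : ∀ i → μ′ MN i ≡ μ MN i
            only-marked : ∀ a → 1 ≤ μ′ ADJ a → Mark k a
            marked    : ∀ a → Mark k a → 1 ≤ μ′ ADJ a
        open Marked

        mark : ∀ i → i < π pE → ∀ μ′ → Marked i μ′ → Marked (suc i)
               (write (write μ′ ADJ (μ′ MN (first i) + second i) 1) ADJ (μ′ MN (second i) + first i) 1)
        mark i _ μ′ inv = record
          { unchanged = unchanged inv
          ; only-marked = om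
          ; marked = λ { a (k , k< , at) → mk a k at (m≤n⇒m<n∨m≡n (s≤s⁻¹ k<)) } }
          where
          a₁ = μ′ MN (first i) + second i
          a₂ = μ′ MN (second i) + first i
          a₁≡ : a₁ ≡ μ MN (first i) + second i
          a₁≡ = cong (_+ second i) (unchanged inv (first i))
          a₂≡ : a₂ ≡ μ MN (second i) + first i
          a₂≡ = cong (_+ first i) (unchanged inv (second i))
          μ₁ = write μ′ ADJ a₁ 1
          μ₂ = write μ₁ ADJ a₂ 1
          om : (a : ℕ) → 1 ≤ μ₂ ADJ a → Mark (suc i) a
          om a le with a ≟ a₂ | a ≟ a₁
          ... | yes refl | _        = i , ≤-refl , inj₂ a₂≡
          ... | no _     | yes refl = i , ≤-refl , inj₁ a₁≡
          ... | no ≢₂    | no ≢₁ =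
                let k , k< , at = only-marked inv a (subst (1 ≤_) (trans (write-≢ μ₁ ADJ 1 ≢₂) (write-≢ μ′ ADJ 1 ≢₁)) le)
                in k , m≤n⇒m≤1+n k< , at
          keep : ∀ a μ′ x → 1 ≤ μ′ ADJ a → 1 ≤ write μ′ ADJ x 1 ADJ a
          keep a μ′ x le with a ≟ x
          ... | yes refl = ≤-reflexive (sym (write-≡ μ′ ADJ a 1))
          ... | no ≢ = subst (1 ≤_) (sym (write-≢ μ′ ADJ 1 ≢)) le
          hit : ∀ a μ′ x → a ≡ x → 1 ≤ write μ′ ADJ x 1 ADJ a
          hit a μ′ x refl = ≤-reflexive (sym (write-≡ μ′ ADJ a 1))
          mk : ∀ a k → (a ≡ μ MN (first k) + second k ⊎ a ≡ μ MN (second k) + first k) → k < i ⊎ k ≡ i → 1 ≤ μ₂ ADJ a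
          mk a k at (inj₁ k<i) = keep a μ₁ a₂ (keep a μ′ a₁ (marked inv a (k , k<i , at)))
          mk a k (inj₁ eq) (inj₂ refl) = keep a μ₁ a₂ (hit a μ′ a₁ (trans eq (sym a₁≡)))
          mk a k (inj₂ eq) (inj₂ refl) = hit a μ₁ a₂ (trans eq (sym a₂≡))

        result : Marked (π pE) (exec adjacency π [] μ)
        result = iter-invariant Marked (π pE)
          (record { unchanged = λ _ → refl
                  ; only-marked = λ a le → contradiction (subst (1 ≤_) (empty a) le) λ ()
                  ; marked = λ { a (_ , () , _) } })
          (λ i μ′ i< inv → mark i i< μ′ inv)

        MN≡ : ∀ (v : Fin n) → μ MN (toℕ v) ≡ toℕ v * n
        MN≡ v = times≡ (toℕ v) (Fin.toℕ≤n v)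

        endpoints : ∀ i → i < E → ∃[ e ] e ∈ₗ edges G × first i ≡ toℕ (proj₁ e) × second i ≡ toℕ (proj₂ e)
        endpoints i i< = let e , e∈ , eq₁ , eq₂ = I-edge⁻ i i< in
          e , e∈ , trans (cong (λ a → I (3 + a + i + i)) n≡) eq₁ , trans (cong (λ a → I (4 + a + i + i)) n≡) eq₂

      adjacency⁻ : ∀ {u v} → 1 ≤ exec adjacency π [] μ ADJ (toℕ u * n + toℕ v) → Adj G u v
      adjacency⁻ {u} {v} le with only-marked result _ le
      ... | i , i< , at with endpoints i (subst (i <_) E≡ i<)
      adjacency⁻ {u} {v} le | i , i< , inj₁ eq | (x , y) , e∈ , eq₁ , eq₂
        with address-pair-injective {u = u} {x} {v} {y}
               (trans eq (cong₂ _+_ (trans (cong (μ MN) eq₁) (MN≡ x)) eq₂))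
      ... | refl , refl = inj₁ e∈
      adjacency⁻ {u} {v} le | i , i< , inj₂ eq | (x , y) , e∈ , eq₁ , eq₂
        with address-pair-injective {u = u} {y} {v} {x}
               (trans eq (cong₂ _+_ (trans (cong (μ MN) eq₂) (MN≡ y)) eq₁))
      ... | refl , refl = inj₂ e∈

      adjacency⁺ : ∀ {u v} → Adj G u v → 1 ≤ exec adjacency π [] μ ADJ (toℕ u * n + toℕ v)
      adjacency⁺ {u} {v} (inj₁ e∈) =
        let i , i< , eq₁ , eq₂ = I-edge⁺ e∈ in
        marked result _ (i , subst (i <_) (sym E≡) i< , inj₁ (sym (cong₂ _+_
          (trans (cong (μ MN) (trans (cong (λ a → I (3 + a + i + i)) n≡) eq₁)) (MN≡ u))
          (trans (cong (λ a → I (4 + a + i + i)) n≡) eq₂))))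
      adjacency⁺ {u} {v} (inj₂ e∈) =
        let i , i< , eq₁ , eq₂ = I-edge⁺ e∈ in
        marked result _ (i , subst (i <_) (sym E≡) i< , inj₂ (sym (cong₂ _+_
          (trans (cong (μ MN) (trans (cong (λ a → I (4 + a + i + i)) n≡) eq₂)) (MN≡ u))
          (trans (cong (λ a → I (3 + a + i + i)) n≡) eq₁))))

    module _ (μ : Mem) (pointers : HasPointers μ) (nc0 : ∀ i → μ NC i ≡ 0) where
      private
        record Counted (k : ℕ) (μ′ : Mem) : Set where
          field
            unchanged : ∀ i → μ′ BP i ≡ μ BP i
            counted : ∀ p → μ′ NC p ≡ count k p
            sides   : ∀ i → i < k → μ′ SD i ≡ count i (parentℕ i)
        open Counted

        visit : ∀ i → i < m → ∀ μ′ → Counted i μ′ → ∀ p → p ≡ parentℕ i → Counted (suc i)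
                (write (write μ′ SD i (μ′ NC p)) NC p (suc (μ′ NC p)))
        visit i i< μ′ inv p refl = record
          { unchanged = unchanged inv
          ; counted = λ q → counted′ q
          ; sides = λ j j≤ → [ (λ j< → trans (write-≢ μ′ SD (μ′ NC p) (<⇒≢ j<)) (sides inv j j<))
                             , (λ { refl → trans (write-≡ μ′ SD i (μ′ NC p)) (counted inv p) }) ]′
                             (m≤n⇒m<n∨m≡n (s≤s⁻¹ j≤)) }
          where
          μ₁ = write μ′ SD i (μ′ NC p)
          counted′ : ∀ q → write μ₁ NC p (suc (μ′ NC p)) NC q ≡ count (suc i) q
          counted′ q with q ≟ p
          ... | yes refl = trans (write-≡ μ₁ NC q _) (trans (cong suc (counted inv q)) (sym (count-suc i)))
          ... | no q≢ = trans (write-≢ μ₁ NC _ q≢) (trans (counted inv q)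
                  (trans (sym (+-identityʳ _)) (cong (count i q +_) (sym (only-≢ {p} {q} 1 (q≢ ∘ sym))))))

        result : Counted m (exec siblings π [] μ)
        result = subst (λ k → Counted k (exec siblings π [] μ)) m≡ (iter-invariant (λ k μ′ → Counted k μ′) (π pm)
          (record { unchanged = λ _ → refl ; counted = nc0 ; sides = λ _ () })
          λ i μ′ i< inv → visit i (subst (i <_) m≡ i<) μ′ inv _
            (parT≡ 0F {μ′} {i ∷ []} (trans (unchanged inv i) (pointers i (<⇒≤ (subst (i <_) m≡ i<))))))

      siblings-children : ∀ p → exec siblings π [] μ NC p ≡ count m p
      siblings-children = counted result

      siblings-sides : ∀ i → i < m → exec siblings π [] μ SD i ≡ count i (parentℕ i)
      siblings-sides = sides result

  π₀ : Params
  π₀ pn = n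
  π₀ pm = m
  π₀ pE = E
  π₀ _  = 0

  μ₀ : Mem
  μ₀ _ _ = 0

  μ₁ μ₂ μ₃ μ₄ μ₅ : Mem
  π₁ π₂ π₃ π₄ π₅ π₆ π₇ π₈ : Params
  μ₁ = exec bagPointers π₀ [] μ₀
  π₁ = setParam π₀ pb (maximum m (λ i → I (1 + μ₁ BP i)))
  π₂ = setParam π₁ pD (π₁ pb + π₁ pb + π₁ pb + π₁ pb)
  π₃ = setParam π₂ pℓ ℓ
  π₄ = setParam π₃ pB (caseZ E 1 (3 + ℓ))
  π₅ = setParam π₄ pK (iter (π₄ pD) (λ _ a → iter (π₄ pB) (λ _ a′ → a′ + a) 0) 1)
  μ₂ = exec powers π₅ [] μ₁
  π₆ = setParam π₅ pTW (μ₂ PW n)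
  π₇ = setParam π₆ pINF (iter n (λ _ a → a + π₆ pTW) (π₆ pTW))
  μ₃ = exec multiples π₇ [] μ₂
  μ₄ = exec adjacency π₇ [] μ₃
  μ₅ = exec siblings π₇ [] μ₄
  π₈ = setParam π₇ pIT (1 + m + m)

  pointers₁ : HasPointers μ₁
  pointers₁ = bagPointers-correct {π₀} (record { n≡ = refl ; m≡ = refl ; E≡ = refl }) μ₀

  private
    untouched : ∀ t → writes bagPointers t ≡ false → writes powers t ≡ false → writes multiples t ≡ false →
                writes adjacency t ≡ false → writes siblings t ≡ false → ∀ i → μ₅ t i ≡ 0
    untouched t w₁ w₂ w₃ w₄ w₅ i =
      trans (frame siblings {π₇} {[]} {μ₄} w₅ i) (trans (frame adjacency {π₇} {[]} {μ₃} w₄ i)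
      (trans (frame multiples {π₇} {[]} {μ₂} w₃ i) (trans (frame powers {π₅} {[]} {μ₁} w₂ i)
      (frame bagPointers {π₀} {[]} {μ₀} w₁ i))))

    in₅ : Input π₅
    in₅ = record { n≡ = refl ; m≡ = refl ; E≡ = refl }
    in₇ : Input π₇
    in₇ = record { n≡ = refl ; m≡ = refl ; E≡ = refl }

    frame₁₂ : ∀ {t} → writes powers t ≡ false → ∀ i → μ₂ t i ≡ μ₁ t i
    frame₁₂ w = frame powers {π₅} {[]} {μ₁} w
    frame₂₃ : ∀ {t} → writes multiples t ≡ false → ∀ i → μ₃ t i ≡ μ₂ t i
    frame₂₃ w = frame multiples {π₇} {[]} {μ₂} w
    frame₃₄ : ∀ {t} → writes adjacency t ≡ false → ∀ i → μ₄ t i ≡ μ₃ t i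
    frame₃₄ w = frame adjacency {π₇} {[]} {μ₃} w
    frame₄₅ : ∀ {t} → writes siblings t ≡ false → ∀ i → μ₅ t i ≡ μ₄ t i
    frame₄₅ w = frame siblings {π₇} {[]} {μ₄} w

    pointers₄ : HasPointers μ₄
    pointers₄ k k≤ = trans (frame₃₄ refl k) (trans (frame₂₃ refl k) (trans (frame₁₂ refl k) (pointers₁ k k≤)))

    times₃ : ∀ k → k ≤ n → μ₃ MN k ≡ k * n
    times₃ = multiples-correct in₇ μ₂ (trans (frame₁₂ refl 0) (frame bagPointers {π₀} {[]} {μ₀} refl 0))

    unmarked₃ : ∀ a → μ₃ ADJ a ≡ 0
    unmarked₃ a = trans (frame₂₃ refl a) (trans (frame₁₂ refl a) (frame bagPointers {π₀} {[]} {μ₀} refl a))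

    childless₄ : ∀ a → μ₄ NC a ≡ 0
    childless₄ a = trans (frame₃₄ refl a) (trans (frame₂₃ refl a)
      (trans (frame₁₂ refl a) (frame bagPointers {π₀} {[]} {μ₀} refl a)))

    B≡ : ∀ e → e ≢ 0 → caseZ e 1 (3 + ℓ) ≡ 3 + ℓ
    B≡ zero    e≢ = contradiction refl e≢
    B≡ (suc _) _  = refl

    TW≡ : π₆ pTW ≡ 2 ^ n
    TW≡ = powers-correct in₅ μ₁ n ≤-refl

  prepared : Setup π₈ μ₅
  prepared = record
    { input     = record { n≡ = refl ; m≡ = refl ; E≡ = refl }
    ; ℓ≡        = refl
    ; b≥        = λ i → subst (_≤ π₁ pb) (trans (cong (λ p → I (1 + p)) (pointers₁ (toℕ i) (Fin.toℕ≤n i))) (I-size i))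
                    (≤-maximum m (λ i → I (1 + μ₁ BP i)) (toℕ i) (Fin.toℕ<n i))
    ; D≡        = refl
    ; B≡        = B≡ E
    ; K≡        = iter-power (π₄ pD) (π₄ pB)
    ; TW≡       = TW≡
    ; INF≡      = trans (iter-plus n (π₆ pTW) (π₆ pTW)) (cong (λ w → n * w + w) TW≡)
    ; IT≡       = refl
    ; pointers  = λ k k≤ → trans (frame₄₅ refl k) (pointers₄ k k≤)
    ; powers≡   = λ k k≤ → trans (frame₄₅ refl k) (trans (frame₃₄ refl k) (trans (frame₂₃ refl k) (powers-correct in₅ μ₁ k k≤)))
    ; times≡    = λ k k≤ → trans (frame₄₅ refl k) (trans (frame₃₄ refl k) (times₃ k k≤))
    ; adj⁺      = λ a → subst (1 ≤_) (sym (frame₄₅ refl _)) (adjacency⁺ in₇ μ₃ times₃ unmarked₃ a)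
    ; adj⁻      = λ le → adjacency⁻ in₇ μ₃ times₃ unmarked₃ (subst (1 ≤_) (frame₄₅ refl _) le)
    ; children≡ = siblings-children in₇ μ₄ pointers₄ childless₄
    ; side≡     = siblings-sides in₇ μ₄ pointers₄ childless₄
    ; table≡0   = untouched TAB refl refl refl refl refl
    ; done≡0    = untouched DONE refl refl refl refl refl
    ; number≡0  = untouched DN refl refl refl refl refl
    ; cursor≡0  = untouched CUR refl refl refl refl refl
    }

-- Digits of a state

module Quotients (K B : ℕ) where

  quotient : ℕ → ℕ
  quotient s = iter K (λ _ a → caseZ (iter B (λ _ z → z + suc a) 0 ∸ s) (suc a) a) 0

  -- The first `x` rounds divide by the base and the others are idle, because only a parameter can
  -- bound a loop.
  digit : ℕ → ℕ → ℕ → ℕ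
  digit D s x = r ∸ iter B (λ _ z → z + quotient r) 0
    where r = iter D (λ i a → caseZ (suc i ∸ x) (quotient a) a) s

  quotient-correct : ∀ {s d r} → s < K → d < B → s ≡ d + r * B → quotient s ≡ r
  quotient-correct {s} {d} {r} s<K d<B s≡ = finish (iter-invariant Inv K (z≤n , inj₁ refl) step′)
    where
    Inv : ℕ → ℕ → Set
    -- Either every round so far has counted, or the quotient has been reached.
    Inv i a = a * B ≤ s × (a ≡ i ⊎ s < suc a * B)

    step′ : ∀ i a → i < K → Inv i a → Inv (suc i) (caseZ (iter B (λ _ z → z + suc a) 0 ∸ s) (suc a) a)
    step′ i a _ (le , up) = go (suc a * B ≤? s)
      where
      times : iter B (λ _ z → z + suc a) 0 ≡ suc a * B
      times = trans (iter-times B (suc a)) (*-comm B (suc a))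
      go : Dec (suc a * B ≤ s) → Inv (suc i) (caseZ (iter B (λ _ z → z + suc a) 0 ∸ s) (suc a) a)
      go (yes fits) = subst (Inv (suc i)) (sym (caseZ-0 (m≤n⇒m∸n≡0 (≤-trans (≤-reflexive times) fits))))
        (fits , [ inj₁ ∘ cong suc , (λ s< → contradiction (<-≤-trans s< fits) (n≮n s)) ]′ up)
      go (no exceeds) = subst (Inv (suc i)) (sym (caseZ-≢0 (λ z → exceeds (≤-trans (≤-reflexive (sym times)) (m∸n≡0⇒m≤n z)))))
        (le , inj₂ (≰⇒> exceeds))

    B≥1 : 1 ≤ B
    B≥1 = ≤-trans (s≤s z≤n) d<B

    finish : Inv K (quotient s) → quotient s ≡ r
    finish (le , up) = ≤-antisym (s≤s⁻¹ (*-cancelʳ-< B (quotient s) (suc r) (≤-<-trans le s<)))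
                                 (s≤s⁻¹ (*-cancelʳ-< B r (suc (quotient s)) (≤-<-trans ≤s s<q)))
      where
      s< : s < suc r * B
      s< = subst (_< suc r * B) (sym s≡) (+-monoˡ-< (r * B) d<B)
      ≤s : r * B ≤ s
      ≤s = subst (r * B ≤_) (sym s≡) (m≤n+m (r * B) d)
      s<q : s < suc (quotient s) * B
      -- Had all `K` rounds counted, then `K ≤ K * B ≤ s`, against `s < K`.
      s<q = [ (λ eq → contradiction (<-≤-trans s<K (≤-trans (≤-reflexive (sym (*-identityʳ K)))
              (≤-trans (*-mono-≤ (≤-reflexive (sym eq)) B≥1) le))) (n≮n s)) , id ]′ up

  encodeDigits : (ℕ → ℕ) → ℕ → ℕ
  encodeDigits f zero    = 0
  encodeDigits f (suc k) = f 0 + encodeDigits (f ∘ suc) k * B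

  encodeDigits-< : ∀ k {f} → (∀ i → f i < B) → encodeDigits f k < B ^ k
  encodeDigits-< zero    h = s≤s z≤n
  encodeDigits-< (suc k) {f} h = ≤-trans (+-monoˡ-≤ (encodeDigits (f ∘ suc) k * B) (h 0))
    (≤-trans (*-monoˡ-≤ B (encodeDigits-< k (h ∘ suc))) (≤-reflexive (*-comm (B ^ k) B)))

  module _ (D : ℕ) (K≡ : K ≡ B ^ D) {f : ℕ → ℕ} (f<B : ∀ i → f i < B) where
    private
      tail : ℕ → ℕ
      tail x = encodeDigits (λ i → f (x + i)) (D ∸ x)

      encodeDigits-cong : ∀ k {f g} → (∀ i → f i ≡ g i) → encodeDigits f k ≡ encodeDigits g k
      encodeDigits-cong zero    h = refl
      encodeDigits-cong (suc k) h = cong₂ (λ a b → a + b * B) (h 0) (encodeDigits-cong k (h ∘ suc))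

      tail-step : ∀ x → x < D → tail x ≡ f x + tail (suc x) * B
      tail-step x x<D = trans (cong (encodeDigits (λ i → f (x + i))) (sym (suc-∸ x<D)))
        (cong₂ (λ a b → a + b * B) (cong f (+-identityʳ x))
          (encodeDigits-cong (D ∸ suc x) λ i → cong f (+-suc x i)))
        where suc-∸ : x < D → suc (D ∸ suc x) ≡ D ∸ x
              suc-∸ lt = trans (sym (+-∸-assoc 1 lt)) refl

      1≤B : 1 ≤ B
      1≤B = ≤-trans (s≤s z≤n) (f<B 0)

      tail< : ∀ x → x ≤ D → tail x < K
      tail< x x≤D = <-≤-trans (encodeDigits-< (D ∸ x) λ i → f<B (x + i))
        (≤-trans (^-monoʳ-≤ B ⦃ >-nonZero 1≤B ⦄ (m∸n≤m D x)) (≤-reflexive (sym K≡)))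

      quotient-tail : ∀ x → x < D → quotient (tail x) ≡ tail (suc x)
      quotient-tail x x<D = quotient-correct (tail< x (<⇒≤ x<D)) (f<B x) (tail-step x x<D)

      shifts : ∀ x k → k ≤ x → x ≤ D → iter k (λ i a → caseZ (suc i ∸ x) (quotient a) a) (tail 0) ≡ tail k
      shifts x zero    _  _   = refl
      shifts x (suc k) k< x≤D = trans (caseZ-0 (m≤n⇒m∸n≡0 k<))
        (trans (cong quotient (shifts x k (<⇒≤ k<) x≤D)) (quotient-tail k (<-≤-trans k< x≤D)))

      stays : ∀ x k → x ≤ D → iter (k + x) (λ i a → caseZ (suc i ∸ x) (quotient a) a) (tail 0) ≡ tail x
      stays x zero    x≤D = shifts x x ≤-refl x≤D
      stays x (suc k) x≤D = trans (caseZ-≢0 (m>n⇒m∸n≢0 (s≤s (m≤n+m x k)))) (stays x k x≤D)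

    digit-encodeDigits : ∀ x → x < D → digit D (encodeDigits f D) x ≡ f x
    digit-encodeDigits x x<D = trans (cong (λ r → r ∸ iter B (λ _ z → z + quotient r) 0) reached)
      (trans (cong (tail x ∸_) (trans (iter-times B (quotient (tail x)))
          (trans (cong (B *_) (quotient-tail x x<D)) (*-comm B _))))
        (trans (cong (_∸ tail (suc x) * B) (tail-step x x<D)) (m+n∸n≡m (f x) (tail (suc x) * B))))
      where
      reached : iter D (λ i a → caseZ (suc i ∸ x) (quotient a) a) (encodeDigits f D) ≡ tail x
      reached = trans (cong (λ k → iter k (λ i a → caseZ (suc i ∸ x) (quotient a) a) (tail 0)) (sym (m∸n+n≡m (<⇒≤ x<D))))
                      (stays x (D ∸ x) (<⇒≤ x<D))

    encodeDigits-<K : encodeDigits f D < K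
    encodeDigits-<K = subst (encodeDigits f D <_) (sym K≡) (encodeDigits-< D f<B)

-- The labels encoded by states

at-most-two-children : ∀ {n m} {X : Fin m → Subset n} {i js} → NiceNode X i js → ∀ {a b c} →
                       a ∈ₗ js → b ∈ₗ js → c ∈ₗ js → a ≢ b → b ≢ c → a ≢ c → ⊥
at-most-two-children {js = x ∷ []} _ (here refl) (here refl) _ ab _ _ = ab refl
at-most-two-children {js = x ∷ y ∷ []} _ (here refl) (here refl) _ ab _ _ = ab refl
at-most-two-children {js = x ∷ y ∷ []} _ (here refl) (there (here refl)) (here refl) _ _ ac = ac refl
at-most-two-children {js = x ∷ y ∷ []} _ (here refl) (there (here refl)) (there (here refl)) _ bc _ = bc refl
at-most-two-children {js = x ∷ y ∷ []} _ (there (here refl)) (there (here refl)) _ ab _ _ = ab refl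
at-most-two-children {js = x ∷ y ∷ []} _ (there (here refl)) (here refl) (here refl) _ bc _ = bc refl
at-most-two-children {js = x ∷ y ∷ []} _ (there (here refl)) (here refl) (there (here refl)) _ _ ac = ac refl

module Check {n m} (ℓ : ℕ) (G : Graph n) (V′ : Subset n) (D : NiceTreeDecomposition G m)
  {π : Params} {μ : Mem} (setup : Preparation.Setup ℓ G V′ D π μ) where
  open NiceTreeDecomposition D
  open Encoding ℓ G V′ D
  open Preparation ℓ G V′ D
  open Setup setup
  open Input input
  open Semantics I
  open Formulas I
  open TreeFacts D
  open Quotients (π pK) (π pB)

  side arity : Fin m → ℕ
  side j  = count (toℕ j) (parentℕ (toℕ j))
  arity i = count m (toℕ i)

  side-injective : ∀ {j j′} → j ≢ root → j′ ≢ root → parent j ≡ parent j′ → side j ≡ side j′ → j ≡ j′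
  side-injective j≢ j′≢ p≡ s≡ = Fin.toℕ-injective (count-injective
    (trans (parentℕ-other j≢) (trans (cong toℕ p≡) (sym (parentℕ-other j′≢)))) s≡)

  side<arity : ∀ {j} → j ≢ root → side j < arity (parent j)
  side<arity {j} j≢ = subst (λ p → side j < count m p) (parentℕ-other j≢) (count-< (Fin.toℕ<n j))

  child-at : ∀ {i c} → c < arity i → ∃[ j ] j ≢ root × parent j ≡ i × side j ≡ c
  child-at {i} {c} c< =
    let k , k<m , p≡ , c≡ = count-at m c<
        j = fromℕ< k<m
        pj≡ : parentℕ (toℕ j) ≡ toℕ i
        pj≡ = trans (cong parentℕ (Fin.toℕ-fromℕ< k<m)) p≡
        j≢ : j ≢ root
        j≢ j≡ = <⇒≢ (Fin.toℕ<n i) (trans (sym pj≡) (trans (cong (parentℕ ∘ toℕ) j≡) parentℕ-root))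
    in j , j≢ , Fin.toℕ-injective (trans (sym (parentℕ-other j≢)) pj≡)
       , trans (cong₂ count (Fin.toℕ-fromℕ< k<m) pj≡) c≡

  -- Niceness enters here: a direction takes at most four values and fits into a digit to the base
  -- `3 + ℓ`.
  arity≤2 : ∀ i → arity i ≤ 2
  arity≤2 i = ≮⇒≥ λ 2< →
    let j₀ , ≢₀ , p₀ , s₀ = child-at {i} {0} (≤-trans (s≤s z≤n) 2<)
        j₁ , ≢₁ , p₁ , s₁ = child-at {i} {1} (≤-trans (s≤s (s≤s z≤n)) 2<)
        j₂ , ≢₂ , p₂ , s₂ = child-at {i} {2} 2<
    in at-most-two-children {X = bag} {i} {children i} (nice i) (child ≢₀ p₀) (child ≢₁ p₁) (child ≢₂ p₂)
         (λ eq → 0≢1+n (trans (sym s₀) (trans (cong side eq) s₁)))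
         (λ eq → 0≢1+n (suc-injective (trans (sym s₁) (trans (cong side eq) s₂))))
         (λ eq → 0≢1+n (trans (sym s₀) (trans (cong side eq) s₂)))
    where
    child : ∀ {j} → j ≢ root → parent j ≡ i → j ∈ₗ children i
    child {j} j≢ p≡ = ∈-filter⁺ (λ j → ¬? (j Fin.≟ root) ×-dec (parent j Fin.≟ i)) (∈-allFin j) (j≢ , p≡)

  open Labels ℓ V′ D side arity

  size : ℕ → ℕ
  size i = I (1 + μ BP i)

  vertex : ℕ → ℕ → ℕ
  vertex i q = I (2 + μ BP i + q)

  label : ℕ → ℕ → ℕ → ℕ
  label f s q = digit (π pD) s (f + (q + q + q + q))

  size≡ : ∀ i → size (toℕ i) ≡ ∣ bag i ∣
  size≡ i = trans (cong (λ p → I (1 + p)) (pointers (toℕ i) (Fin.toℕ≤n i))) (I-size i)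

  size-m : size m ≡ 0
  size-m = trans (cong (λ p → I (1 + p)) (pointers m ≤-refl)) I-last-size

  vertex≡ : ∀ i q → vertex (toℕ i) q ≡ slot i q
  vertex≡ i q = cong (λ p → I (2 + p + q)) (pointers (toℕ i) (Fin.toℕ≤n i))

  target⁺ : ∀ {v} → 1 ≤ I (2 + toℕ v) → v ∈ V′
  target⁺ {v} le = go (lookup V′ v) refl
    where go : ∀ b → lookup V′ v ≡ b → v ∈ V′
          go true  eq = lookup⇒[]= v V′ eq
          go false eq = contradiction (subst (1 ≤_) (trans (I-target v) (cong bit eq)) le) λ ()

  target⁻ : ∀ {v} → v ∈ V′ → 1 ≤ I (2 + toℕ v)
  target⁻ {v} v∈ = ≤-reflexive (sym (trans (I-target v) (cong bit ([]=⇒lookup v∈))))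

  -- Digits belong to slots of a bag, labels to vertices. Keeping `lab` abstract serves both
  -- directions: labels decoded from a given state and states encoded from given labels.
  module Link (σ : ℕ → ℕ) (lab : ℕ → Fin m → Fin n → ℕ)
    (agree : ∀ {f} → f < 4 → ∀ i q {v} → q < ∣ bag i ∣ → v ∈ bag i → slot i q ≡ toℕ v →
             label f (σ (toℕ i)) q ≡ lab f i v) where

    -- The node appears both as `i` and as the number `p`, because `parentℕ (toℕ j)` equals
    -- `toℕ (parent j)` only propositionally and only below the root.
    record At (i : Fin m) (p q : ℕ) (v : Fin n) : Set where
      field
        in-bag  : v ∈ bag i
        in-size : suc q ≤ size p
        in-b    : q < π pb
        is      : vertex p q ≡ toℕ v
        labels  : ∀ {f} → f < 4 → label f (σ p) q ≡ lab f i v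
    open At

    own⁻ : ∀ {i q} → suc q ≤ size (toℕ i) → ∃[ v ] At i (toℕ i) q v
    own⁻ {i} {q} q< =
      let v , v∈ , eq = slot⁻ i q (subst (suc q ≤_) (size≡ i) q<) in
      v , record { in-bag = v∈ ; in-size = q< ; in-b = ≤-trans q< (≤-trans (≤-reflexive (size≡ i)) (b≥ i))
                 ; is = trans (vertex≡ i q) eq
                 ; labels = λ f< → agree f< i q (subst (suc q ≤_) (size≡ i) q<) v∈ eq }

    own⁺ : ∀ {i v} → v ∈ bag i → ∃[ q ] At i (toℕ i) q v
    own⁺ {i} {v} v∈ =
      let q , q< , eq = slot⁺ i v∈ in
      q , record { in-bag = v∈ ; in-size = subst (suc q ≤_) (sym (size≡ i)) q< ; in-b = ≤-trans q< (b≥ i)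
                 ; is = trans (vertex≡ i q) eq ; labels = λ f< → agree f< i q q< v∈ eq }

    parent⁺ : ∀ {j v} → j ≢ root → v ∈ bag (parent j) → ∃[ q ] At (parent j) (parentℕ (toℕ j)) q v
    parent⁺ {j} {v} j≢ v∈ =
      subst (λ p → ∃[ q ] At (parent j) p q v) (sym (parentℕ-other j≢)) (own⁺ v∈)

    -- An occupied slot of the parent excludes the root, whose parent is the sentinel with its empty
    -- bag.
    parent⁻ : ∀ {j q} → suc q ≤ size (parentℕ (toℕ j)) →
              j ≢ root × ∃[ v ] At (parent j) (parentℕ (toℕ j)) q v
    parent⁻ {j} {q} q< = go (j Fin.≟ root)
      where
      go : Dec (j ≡ root) → j ≢ root × ∃[ v ] At (parent j) (parentℕ (toℕ j)) q v
      go (yes refl) = contradiction (subst (suc q ≤_) (trans (cong size parentℕ-root) size-m) q<) λ ()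
      go (no j≢) = j≢ , subst (λ p → ∃[ v ] At (parent j) p q v) (sym (parentℕ-other j≢))
                          (own⁻ (subst (λ p → suc q ≤ size p) (parentℕ-other j≢) q<))

    same-vertex : ∀ {i i′ p p′ q q′ v v′} → At i p q v → At i′ p′ q′ v′ → vertex p q ≡ vertex p′ q′ → v ≡ v′
    same-vertex a a′ eq = Fin.toℕ-injective (trans (sym (is a)) (trans eq (is a′)))

    vertex-eq : ∀ {i i′ p p′ q q′ v} → At i p q v → At i′ p′ q′ v → vertex p q ≡ vertex p′ q′
    vertex-eq a a′ = trans (is a) (sym (is a′))

    Adjacent : ℕ → ℕ → ℕ → Set
    Adjacent p q q′ = 1 ≤ μ ADJ (μ MN (vertex p q) + vertex p q′)

    adjacent-at : ∀ {i p q q′ u v} → At i p q u → At i p q′ v →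
                  μ ADJ (μ MN (vertex p q) + vertex p q′) ≡ μ ADJ (toℕ u * n + toℕ v)
    adjacent-at {u = u} a a′ =
      cong (μ ADJ) (cong₂ _+_ (trans (cong (μ MN) (is a)) (times≡ (toℕ u) (Fin.toℕ≤n u))) (is a′))

    adjacent⁻ : ∀ {i p q q′ u v} → At i p q u → At i p q′ v → Adjacent p q q′ → Adj G u v
    adjacent⁻ a a′ le = adj⁻ (subst (1 ≤_) (adjacent-at a a′) le)

    adjacent⁺ : ∀ {i p q q′ u v} → At i p q u → At i p q′ v → Adj G u v → Adjacent p q q′
    adjacent⁺ a a′ e = subst (1 ≤_) (sym (adjacent-at a a′)) (adj⁺ e)

    IsTop : Fin m → ℕ → Set
    IsTop j q = ¬ (∃[ q′ ] q′ < π pb × (suc q′ ≤ size (parentℕ (toℕ j)) ×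
                   vertex (toℕ j) q ≡ vertex (parentℕ (toℕ j)) q′))

    top⁻ : ∀ {j q v} → At j (toℕ j) q v → IsTop j q → Top j v
    top⁻ a top j≢ v∈ = let q′ , a′ = parent⁺ j≢ v∈ in
      top (q′ , in-b a′ , in-size a′ , vertex-eq a a′)

    top⁺ : ∀ {j q v} → At j (toℕ j) q v → Top j v → IsTop j q
    top⁺ a top (q′ , _ , q′< , eq) = let j≢ , v′ , a′ = parent⁻ q′< in
      top j≢ (subst (_∈ bag _) (sym (same-vertex a a′ eq)) (in-bag a′))

    -- In the order in which the main loop binds its variables; the final 0 stands for the counter
    -- of that loop.
    environment : ℕ → Vec ℕ 5
    environment j = σ j ∷ σ (parentℕ j) ∷ parentℕ j ∷ j ∷ 0 ∷ []

    Checks : Set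
    Checks = ∀ (j : Fin m) → ⟪ checkF ⟫ π μ (environment (toℕ j))

    private
      0<4 : 0 < 4
      0<4 = s≤s z≤n
      1<4 : 1 < 4
      1<4 = s≤s (s≤s z≤n)
      2<4 : 2 < 4
      2<4 = s≤s (s≤s (s≤s z≤n))
      3<4 : 3 < 4
      3<4 = ≤-refl

      side-at : ∀ j → 2 + μ SD (toℕ j) ≡ 2 + side j
      side-at j = cong (2 +_) (side≡ (toℕ j) (Fin.toℕ<n j))

    checks⇒valid : Checks → Valid (lab 0) (lab 1) (lab 2) (lab 3)
    checks⇒valid checks = record
      { τ-parent = λ j≢ v∈ v∈p → let q , a = own⁺ v∈ ; q′ , a′ = parent⁺ j≢ v∈p in
          trans (sym (labels a 0<4)) (trans (proj₁ (compat a a′)) (labels a′ 0<4))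
      ; γ-parent = λ j≢ v∈ v∈p → let q , a = own⁺ v∈ ; q′ , a′ = parent⁺ j≢ v∈p in
          trans (sym (labels a 1<4)) (trans (proj₁ (proj₂ (compat a a′))) (labels a′ 1<4))
      ; δ-parent = λ {j} j≢ v∈ v∈p δ≢ → let q , a = own⁺ v∈ ; q′ , a′ = parent⁺ j≢ v∈p in
          trans (sym (labels a′ 3<4)) (trans (proj₂ (proj₂ (compat a a′)) (δ≢ ∘ trans (sym (labels a 3<4)))) (side-at j))
      ; ε-child = λ {j} j≢ {v} v∈p ε≡ →
          let q′ , a′ = parent⁺ j≢ v∈p
              q , q<b , q< , eq , ε≢ = proj₁ (proj₂ (checks j)) q′ (in-b a′) (in-size a′)
                                (trans (labels a′ 2<4) (trans ε≡ (sym (side-at j))))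
              u , a = own⁻ q<
              u≡v = same-vertex a a′ eq
          in subst (λ v → v ∈ bag j × lab 2 j v ≢ 0) u≡v (in-bag a , ε≢ ∘ trans (labels a 2<4))
      ; ε-range = λ {i} v∈ → let q , a = own⁺ v∈ in
          subst₂ _<_ (labels a 2<4) (cong (2 +_) (children≡ (toℕ i))) (proj₁ (local a))
      ; ε-here = λ {i} v∈ ε≡ →
          let q , a = own⁺ v∈
              q′ , _ , q′< , e , γ≡ = proj₁ (proj₂ (local a)) (trans (labels a 2<4) ε≡)
              u , a′ = own⁻ q′<
          in u , in-bag a′ , adjacent⁻ a a′ e , trans (sym (labels a′ 1<4)) (trans γ≡ (labels a 0<4))
      ; ε-top = λ v∈ top 1≤ ≤ℓ ε≡ → let q , a = own⁺ v∈ in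
          proj₁ (proj₂ (proj₂ (local a))) (top⁺ a top) (subst (1 ≤_) (sym (labels a 0<4)) 1≤)
            (subst₂ _≤_ (sym (labels a 0<4)) (sym ℓ≡) ≤ℓ) (trans (labels a 2<4) ε≡)
      ; τ-target = λ v∈ v∈V′ → let q , a = own⁺ v∈ in
          subst₂ _≤_ (labels a 0<4) ℓ≡ (proj₁ (proj₂ (proj₂ (proj₂ (local a))))
            (subst (λ v → 1 ≤ I (2 + v)) (sym (is a)) (target⁻ v∈V′)))
      ; γ-self = λ v∈ γ≢ → let q , a = own⁺ v∈ in
          subst₂ _<_ (labels a 0<4) (labels a 1<4)
            (proj₁ (proj₂ (proj₂ (proj₂ (proj₂ (local a))))) (γ≢ ∘ trans (sym (labels a 1<4))))
      ; γ-bound = λ u∈ w∈ e γ≢ → let q , a = own⁺ u∈ ; q′ , a′ = own⁺ w∈ in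
          subst₂ _≤_ (labels a′ 0<4) (labels a 1<4)
            (proj₁ (edge a a′ e) (γ≢ ∘ trans (sym (labels a 1<4))))
      ; δ-here = λ u∈ w∈ e own 2≤ eq → let q , a = own⁺ u∈ ; q′ , a′ = own⁺ w∈ in
          trans (sym (labels a 3<4)) (proj₁ (owned a a′ e own 2≤ eq))
      ; γ-unique = λ u∈ w∈ w′∈ e e′ own 2≤ eq eq′ →
          let q , a = own⁺ u∈ ; q′ , a′ = own⁺ w∈ ; q″ , a″ = own⁺ w′∈ in
          same-vertex a″ a′ (proj₂ (owned a a′ e own 2≤ eq) q″ (in-b a″) (in-size a″) (adjacent⁺ a a″ e′)
            (trans (labels a″ 0<4) (trans eq′ (sym (labels a 1<4)))))
      }
      where
      compat : ∀ {j v q q′} → At j (toℕ j) q v → At (parent j) (parentℕ (toℕ j)) q′ v → _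
      compat {j} a a′ =
        proj₁ (checks j) _ (in-b a) (in-size a) _ (in-b a′) (in-size a′) (vertex-eq a a′)
      local : ∀ {j v q} → At j (toℕ j) q v → _
      local {j} a = proj₂ (proj₂ (checks j)) _ (in-b a) (in-size a)
      edge : ∀ {j u w q q′} → At j (toℕ j) q u → At j (toℕ j) q′ w → Adj G u w → _
      edge a a′ e = proj₂ (proj₂ (proj₂ (proj₂ (proj₂ (local a))))) _ (in-b a′) (in-size a′) (adjacent⁺ a a′ e)
      owned : ∀ {j u w q q′} → At j (toℕ j) q u → At j (toℕ j) q′ w → Adj G u w → Top j u ⊎ Top j w →
              2 ≤ lab 1 j u → lab 0 j w ≡ lab 1 j u → _
      owned a a′ e own 2≤ eq = proj₂ (edge a a′ e) ([ inj₁ ∘ top⁺ a , inj₂ ∘ top⁺ a′ ]′ own)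
        (subst (2 ≤_) (sym (labels a 1<4)) 2≤) (trans (labels a′ 0<4) (trans eq (sym (labels a 1<4))))

    valid⇒checks : Valid (lab 0) (lab 1) (lab 2) (lab 3) → Checks
    valid⇒checks valid j = compat , down , local
      where
      open Valid valid

      compat : ⟪ compatF ⟫ π μ (environment (toℕ j))
      compat q _ q< q′ _ q′< eq =
        let v , a = own⁻ q<
            j≢ , v′ , a′ = parent⁻ q′<
            v≡ = same-vertex a a′ eq
            v∈ = subst (_∈ bag j) v≡ (in-bag a)
            at : ∀ {f} → f < 4 → label f (σ (toℕ j)) q ≡ lab f j v′
            at f< = trans (labels a f<) (cong (lab _ j) v≡)
        in trans (at 0<4) (trans (τ-parent j≢ v∈ (in-bag a′)) (sym (labels a′ 0<4)))
         , trans (at 1<4) (trans (γ-parent j≢ v∈ (in-bag a′)) (sym (labels a′ 1<4)))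
         , λ δ≢ → trans (labels a′ 3<4) (trans (δ-parent j≢ v∈ (in-bag a′) (δ≢ ∘ trans (at 3<4))) (sym (side-at j)))

      down : ⟪ downF ⟫ π μ (environment (toℕ j))
      down q′ _ q′< eq =
        let j≢ , v , a′ = parent⁻ q′<
            v∈ , ε≢ = ε-child j≢ (in-bag a′) (trans (sym (labels a′ 2<4)) (trans eq (side-at j)))
            q , a = own⁺ v∈
        in q , in-b a , in-size a , vertex-eq a a′ , ε≢ ∘ trans (sym (labels a 2<4))

      local : ⟪ localF ⟫ π μ (environment (toℕ j))
      local q _ q< =
        let v , a = own⁻ q< in
          subst₂ _<_ (sym (labels a 2<4)) (cong (2 +_) (sym (children≡ (toℕ j)))) (ε-range (in-bag a))
        , (λ ε≡ → let u , u∈ , e , γ≡ = ε-here (in-bag a) (trans (sym (labels a 2<4)) ε≡)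
                      q′ , a′ = own⁺ u∈
                  in q′ , in-b a′ , in-size a′ , adjacent⁺ a a′ e
                     , trans (labels a′ 1<4) (trans γ≡ (sym (labels a 0<4))))
        , (λ top 1≤ ≤ℓ ε≡ → ε-top (in-bag a) (top⁻ a top) (subst (1 ≤_) (labels a 0<4) 1≤)
              (subst₂ _≤_ (labels a 0<4) ℓ≡ ≤ℓ) (trans (sym (labels a 2<4)) ε≡))
        , (λ le → subst₂ _≤_ (sym (labels a 0<4)) (sym ℓ≡)
              (τ-target (in-bag a) (target⁺ (subst (λ v → 1 ≤ I (2 + v)) (is a) le))))
        , (λ γ≢ → subst₂ _<_ (sym (labels a 0<4)) (sym (labels a 1<4))
              (γ-self (in-bag a) (γ≢ ∘ trans (labels a 1<4))))
        , λ q′ _ q′< adj →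
            let w , a′ = own⁻ q′<
                e = adjacent⁻ a a′ adj
            in (λ γ≢ → subst₂ _≤_ (sym (labels a′ 0<4)) (sym (labels a 1<4))
                   (γ-bound (in-bag a) (in-bag a′) e (γ≢ ∘ trans (labels a 1<4))))
             , λ own 2≤ eq →
                 let own′ = [ inj₁ ∘ top⁻ a , inj₂ ∘ top⁻ a′ ]′ own
                     2≤′ = subst (2 ≤_) (labels a 1<4) 2≤
                     eq′ = trans (sym (labels a′ 0<4)) (trans eq (labels a 1<4))
                 in trans (labels a 3<4) (δ-here (in-bag a) (in-bag a′) e own′ 2≤′ eq′)
                  , λ q″ _ q″< adj″ eq″ →
                      let w′ , a″ = own⁻ q″< in
                      trans (is a″) (trans (cong toℕ (γ-unique (in-bag a) (in-bag a′) (in-bag a″) e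
                        (adjacent⁻ a a″ adj″) own′ 2≤′ eq′
                        (trans (sym (labels a″ 0<4)) (trans eq″ (labels a 1<4)))))
                        (sym (is a′)))

∑-unique : ∀ n (f : ℕ → ℕ) {i a} → i < n → f i ≡ a → (∀ k → k < n → k ≢ i → f k ≡ 0) → ∑ n f ≡ a
∑-unique n f {i} {a} i<n fi≡ zeros = trans (∑-cong n pointwise) (∑-only n i a i<n)
  where
  pointwise : ∀ k → k < n → f k ≡ only i a k
  pointwise k k<n with k ≟ i
  ... | yes refl = trans fi≡ (sym (only-≡ k a))
  ... | no k≢    = trans (zeros k k<n k≢) (sym (only-≢ a k≢))

extend : ∀ {n} → (Fin n → ℕ) → ℕ → ℕ
extend {zero}  f _       = 0
extend {suc n} f zero    = f zero
extend {suc n} f (suc i) = extend (f ∘ suc) i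

extend-toℕ : ∀ {n} (f : Fin n → ℕ) i → extend f (toℕ i) ≡ f i
extend-toℕ f zero    = refl
extend-toℕ f (suc i) = extend-toℕ (f ∘ suc) i

extend-out : ∀ {n} (f : Fin n → ℕ) i → n ≤ i → extend f i ≡ 0
extend-out {zero}  f i       _  = refl
extend-out {suc n} f (suc i) le = extend-out (f ∘ suc) i (s≤s⁻¹ le)

extend-< : ∀ {n K} (f : Fin n → ℕ) → 0 < K → (∀ i → f i < K) → ∀ i → extend f i < K
extend-< {zero}  f pos h i       = pos
extend-< {suc n} f pos h zero    = h zero
extend-< {suc n} f pos h (suc i) = extend-< (f ∘ suc) pos (h ∘ suc) i

-- The weight 2ⁿ + 2ᵛ of a vertex v makes the weight of a set determine the
-- set, and a set of minimal weight a set of minimal size.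
weight : ∀ {n} → Subset n → ℕ
weight {n} S = ∑ n (λ v → caseZ (extend (bit ∘ lookup S) v) 0 (2 ^ n + 2 ^ v))

-- Totals of states and weights of sets

module Optimum {n m} (ℓ : ℕ) (G : Graph n) (V′ : Subset n) (D : NiceTreeDecomposition G m)
  {π : Params} {μ : Mem} (setup : Preparation.Setup ℓ G V′ D π μ)
  (1≤ℓ : 1 ≤ ℓ) (E≢0 : Encoding.E ℓ G V′ D ≢ 0) where
  open NiceTreeDecomposition D
  open Encoding ℓ G V′ D
  open Preparation ℓ G V′ D
  open Check ℓ G V′ D setup
  open Setup setup
  open Input input
  open Semantics I
  open Formulas I
  open TreeFacts D
  open Labels ℓ V′ D side arity
  open Quotients (π pK) (π pB)

  slotF : Fm 6
  slotF = (num 1 ⊞ var 0F) ≼ sizeT 4F ∧′ topF 4F 3F 0F ∧′ stepT 1F 0F ≐ num 0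

  opaque
    -- Opaque, so that the evaluation of a large formula stays folded; soundness and completeness
    -- are all that is visible of it.
    checkValue : Vec ℕ 5 → ℕ
    checkValue ρ = eval (term checkF) π μ ρ

    check-sound : ∀ {ρ} → checkValue ρ ≡ 0 → ⟪ checkF ⟫ π μ ρ
    check-sound {ρ} = sound checkF {π} {μ} {ρ}

    check-complete : ∀ {ρ} → ⟪ checkF ⟫ π μ ρ → checkValue ρ ≡ 0
    check-complete {ρ} = complete checkF {π} {μ} {ρ}

    slotValue : Vec ℕ 6 → ℕ
    slotValue ρ = eval (term slotF) π μ ρ

    slot-sound : ∀ {ρ} → slotValue ρ ≡ 0 → ⟪ slotF ⟫ π μ ρ
    slot-sound {ρ} = sound slotF {π} {μ} {ρ}

    slot-complete : ∀ {ρ} → ⟪ slotF ⟫ π μ ρ → slotValue ρ ≡ 0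
    slot-complete {ρ} = complete slotF {π} {μ} {ρ}

    nodeValue : Vec ℕ 5 → ℕ
    nodeValue ρ = eval nodeCostT π μ ρ

  slotWeight : ℕ → Vec ℕ 5 → ℕ
  slotWeight q ρ = caseZ (slotValue (q ∷ ρ)) (π pTW + μ PW (vertex (lookup ρ 3F) q)) 0

  opaque
    unfolding nodeValue
    nodeValue≡ : ∀ ρ → nodeValue ρ ≡ caseZ (checkValue ρ) (∑ (π pb) (λ q → slotWeight q ρ)) (π pINF)
    nodeValue≡ (x ∷ y ∷ p ∷ j ∷ z ∷ []) = refl

  -- Cut off at `m`, because the optimisation requires a sentinel without cost.
  nodeCost : ℕ → ℕ → ℕ → ℕ
  nodeCost j x y = caseZ (m ∸ j) 0 (nodeValue (x ∷ y ∷ parentℕ j ∷ j ∷ 0 ∷ []))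

  nodeCost-m : ∀ x y → nodeCost m x y ≡ 0
  nodeCost-m x y = caseZ-0 (n∸n≡0 m)

  nodeCost-< : ∀ {j} x y → j < m → let ρ = x ∷ y ∷ parentℕ j ∷ j ∷ 0 ∷ [] in
               nodeCost j x y ≡ caseZ (checkValue ρ) (∑ (π pb) (λ q → slotWeight q ρ)) (π pINF)
  nodeCost-< x y j<m = trans (caseZ-≢0 (m>n⇒m∸n≢0 j<m)) (nodeValue≡ _)

  open TreeOptimisation m (π pK) (π pINF) parentℕ nodeCost nodeCost-m

  module _ (σ : ℕ → ℕ) (lab : ℕ → Fin m → Fin n → ℕ)
    (agree : ∀ {f} → f < 4 → ∀ i q {v} → q < ∣ bag i ∣ → v ∈ bag i → slot i q ≡ toℕ v →
             label f (σ (toℕ i)) q ≡ lab f i v) where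
    open Link σ lab agree
    open At

    checks-from-total : Total σ < π pINF → Checks
    checks-from-total lt j = check-sound (go (checkValue (environment (toℕ j)) ≟ 0))
      where
      cost≤ : nodeCost (toℕ j) (σ (toℕ j)) (σ (parentℕ (toℕ j))) ≤ Total σ
      cost≤ = term≤∑ (suc m) (λ i → nodeCost i (σ i) (σ (parentℕ i))) (toℕ j) (m≤n⇒m≤1+n (Fin.toℕ<n j))
      go : Dec (checkValue (environment (toℕ j)) ≡ 0) → checkValue (environment (toℕ j)) ≡ 0
      go (yes z) = z
      go (no nz) = contradiction (≤-<-trans (≤-trans (≤-reflexive (sym
        (trans (nodeCost-< (σ (toℕ j)) (σ (parentℕ (toℕ j))) (Fin.toℕ<n j)) (caseZ-≢0 nz)))) cost≤) lt) (n≮n (π pINF))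

    module _ (checks : Checks) (S : Subset n)
      (lab-0 : ∀ {i v} → v ∈ bag i → (lab 0 i v ≡ 0 → v ∈ S) × (v ∈ S → lab 0 i v ≡ 0)) where
      private
        w : ℕ → ℕ → ℕ
        w j q = slotWeight q (environment j)

        charge : ℕ → ℕ
        charge v = caseZ (extend (bit ∘ lookup S) v) 0 (2 ^ n + 2 ^ v)

        Counted : ℕ → ℕ → Set
        Counted j q = ⟪ slotF ⟫ π μ (q ∷ environment j)

        counted : ∀ {j q} → w j q ≢ 0 → Counted j q
        counted {j} {q} w≢ = slot-sound (go (slotValue (q ∷ environment j) ≟ 0))
          where
          go : Dec (slotValue (q ∷ environment j) ≡ 0) → slotValue (q ∷ environment j) ≡ 0
          go (yes z) = z
          go (no nz) = contradiction (caseZ-≢0 nz) w≢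

        split : ∀ (i : Fin m) q → w (toℕ i) q ≡ ∑ n (only (vertex (toℕ i) q) (w (toℕ i) q))
        split i q = go (w (toℕ i) q ≟ 0)
          where
          go : Dec (w (toℕ i) q ≡ 0) → w (toℕ i) q ≡ ∑ n (only (vertex (toℕ i) q) (w (toℕ i) q))
          go (no w≢) = let v , a = own⁻ {i} {q} (proj₁ (counted w≢)) in
            sym (∑-only n (vertex (toℕ i) q) (w (toℕ i) q) (subst (_< n) (sym (is a)) (Fin.toℕ<n v)))
          go (yes z) = trans z (sym (∑-0 n λ v _ → only-0 v))
            where
            only-0 : ∀ v → only (vertex (toℕ i) q) (w (toℕ i) q) v ≡ 0
            only-0 v with v ≡ᵇ vertex (toℕ i) q
            ... | true  = z
            ... | false = refl

        part : ℕ → ℕ → ℕ → ℕ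
        part v i q = only (vertex i q) (w i q) v

        part-zero : ∀ {v i q} → (v ≡ vertex i q → Counted i q → ⊥) → part v i q ≡ 0
        part-zero {v} {i} {q} h = go (v ≟ vertex i q) (w i q ≟ 0)
          where
          go : Dec (v ≡ vertex i q) → Dec (w i q ≡ 0) → part v i q ≡ 0
          go (no v≢) _ = only-≢ (w i q) v≢
          go (yes refl) (yes z) = trans (only-≡ (vertex i q) (w i q)) z
          go (yes eq) (no w≢) = contradiction (counted w≢) (h eq)

        -- A vertex has one topmost bag and one slot in it, so that of all pairs of node and slot
        -- just one can charge for it.
        collect : ∀ (v : Fin n) → ∑ m (λ i → ∑ (π pb) (part (toℕ v) i)) ≡ charge (toℕ v)
        collect v =
          let h , v∈h = coverV v
              z , v∈ , top , _ = top-exists h v∈h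
              q , a = own⁺ v∈
          in ∑-unique m _ (Fin.toℕ<n z)
               (∑-unique (π pb) _ (in-b a) (at a top) (λ q′ _ q′≢ → part-zero λ eq (q′< , _) →
                  q′≢ (slot-injective z (subst (suc q′ ≤_) (size≡ z) q′<) (subst (suc q ≤_) (size≡ z) (in-size a))
                    (trans (sym (vertex≡ z q′)) (trans (sym eq) (trans (sym (is a)) (vertex≡ z q)))))))
               (λ i i<m i≢ → ∑-0 (π pb) λ q′ _ → part-zero (other z v∈ top i i<m i≢ q′))
          where
          other : ∀ z → v ∈ bag z → Top z v → ∀ i → i < m → i ≢ toℕ z → ∀ q′ → toℕ v ≡ vertex i q′ → ¬ Counted i q′
          other z v∈ top i i<m i≢ q′ = subst (λ i → i ≢ toℕ z → toℕ v ≡ vertex i q′ → ¬ Counted i q′)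
            (Fin.toℕ-fromℕ< i<m) (go (fromℕ< i<m)) i≢
            where
            go : ∀ j → toℕ j ≢ toℕ z → toℕ v ≡ vertex (toℕ j) q′ → ¬ Counted (toℕ j) q′
            go j j≢ eq (q′< , top′ , _) =
              let u , a = own⁻ {j} q′<
                  u≡v = Fin.toℕ-injective (trans (sym (is a)) (sym eq))
              in j≢ (cong toℕ (top-unique (subst (_∈ bag j) u≡v (in-bag a)) v∈
                   (subst (Top j) u≡v (top⁻ a top′)) top))
          at : ∀ {z q} → At z (toℕ z) q v → Top z v → part (toℕ v) (toℕ z) q ≡ charge (toℕ v)
          at {z} {q} a top = trans (cong (only (vertex (toℕ z) q) (w (toℕ z) q)) (sym (is a)))
            (trans (only-≡ (vertex (toℕ z) q) (w (toℕ z) q)) (go (v ∈? S)))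
            where
            go : Dec (v ∈ S) → w (toℕ z) q ≡ charge (toℕ v)
            go (yes v∈S) = trans (caseZ-0 (slot-complete (in-size a , top⁺ a top
                              , trans (labels a (s≤s z≤n)) (proj₂ (lab-0 (in-bag a)) v∈S))))
              (trans (cong₂ _+_ TW≡ (trans (cong (μ PW) (is a)) (powers≡ (toℕ v) (Fin.toℕ≤n v))))
                (sym (cong (λ b → caseZ b 0 (2 ^ n + 2 ^ toℕ v))
                  (trans (extend-toℕ (bit ∘ lookup S) v) (cong bit ([]=⇒lookup v∈S))))))
            go (no v∉S) = trans (caseZ-≢0 λ z → v∉S (proj₁ (lab-0 (in-bag a))
                (trans (sym (labels a (s≤s z≤n))) (proj₂ (proj₂ (slot-sound z))))))
              (sym (cong (λ b → caseZ b 0 (2 ^ n + 2 ^ toℕ v)) (trans (extend-toℕ (bit ∘ lookup S) v) (out (lookup S v) refl))))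
              where
              out : ∀ b → lookup S v ≡ b → bit (lookup S v) ≡ 0
              out true  eq = contradiction (lookup⇒[]= v S eq) v∉S
              out false eq = cong bit eq

        at-fin : ∀ {k} {P : ℕ → Set} → (∀ (i : Fin k) → P (toℕ i)) → ∀ i → i < k → P i
        at-fin {P = P} h i i<k = subst P (Fin.toℕ-fromℕ< i<k) (h (fromℕ< i<k))

      -- Double counting: each slot weight is assigned to its vertex, and the sum over nodes and
      -- slots is exchanged with the sum over vertices.
      total≡weight : Total σ ≡ weight S
      total≡weight = trans (cong₂ _+_
          (∑-cong m (at-fin {P = λ i → nodeCost i (σ i) (σ (parentℕ i)) ≡ ∑ (π pb) (w i)} λ i →
            trans (nodeCost-< (σ (toℕ i)) (σ (parentℕ (toℕ i))) (Fin.toℕ<n i))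
                  (caseZ-0 (check-complete (checks i)))))
          (nodeCost-m (σ m) (σ (parentℕ m))))
        (trans (+-identityʳ _)
        (trans (∑-cong m (at-fin {P = λ i → ∑ (π pb) (w i) ≡ ∑ (π pb) (λ q → ∑ n (λ v → part v i q))} λ i →
            ∑-cong (π pb) λ q _ → split i q))
        (trans (∑-cong m λ i _ → ∑-swap (π pb) n (λ q v → part v i q))
        (trans (∑-swap m n (λ i v → ∑ (π pb) (part v i)))
          (∑-cong n (at-fin {P = λ v → ∑ m (λ i → ∑ (π pb) (part v i)) ≡ charge v} collect))))))

  slotOf : Fin m → Fin n → ℕ
  slotOf i v = pick (v ∈? bag i)
    where pick : Dec (v ∈ bag i) → ℕ
          pick (yes v∈) = proj₁ (slot⁺ i v∈)
          -- An arbitrary default; labels matter only for vertices of the bag.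
          pick (no _)   = 0

  decoded : (ℕ → ℕ) → ℕ → Fin m → Fin n → ℕ
  decoded σ f i v = label f (σ (toℕ i)) (slotOf i v)

  decoded-agree : ∀ σ {f} → f < 4 → ∀ i q {v} → q < ∣ bag i ∣ → v ∈ bag i → slot i q ≡ toℕ v →
                  label f (σ (toℕ i)) q ≡ decoded σ f i v
  decoded-agree σ {f} _ i q {v} q< v∈ eq = cong (label f (σ (toℕ i))) (go (v ∈? bag i) refl)
    where
    go : ∀ d → (v ∈? bag i) ≡ d → q ≡ slotOf i v
    go (yes v∈′) d≡ rewrite d≡ = let _ , q′< , eq′ = slot⁺ i v∈′ in
      slot-injective i q< q′< (trans eq (sym eq′))
    go (no v∉) _ = contradiction v∈ v∉

  set-from-state : ∀ σ → Total σ < π pINF → ∃[ S ] Dominates G ℓ V′ S × Total σ ≡ weight S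
  set-from-state σ lt = S , dominates 1≤ℓ , total≡weight σ (decoded σ) (decoded-agree σ) checks S
      (λ v∈ → (λ eq → ∈S⁺ (trans (sym (τ≡t v∈)) eq)) , λ v∈S → trans (τ≡t v∈) (∈S⁻ v∈S))
    where
    checks : Link.Checks σ (decoded σ) (decoded-agree σ)
    checks = checks-from-total σ (decoded σ) (decoded-agree σ) lt
    open Soundness side-injective child-at (Link.checks⇒valid σ (decoded σ) (decoded-agree σ) checks)

  module _ (S : Subset n) (dom : Dominates G ℓ V′ S) where
    open Canonical G ℓ S
    open Pointers D side arity side-injective side<arity
    open Completeness ℓ V′ D side arity side-injective side<arity S dom

    private
      lab : ℕ → Fin m → Fin n → ℕ
      lab 0 i v = t v
      lab 1 i v = g v
      lab 2 i v = ε i v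
      lab _ i v = δ i v

      pointer<B : ∀ w i → pointer w i < 3 + ℓ
      -- At most two children give `2 + 2 ≤ 3 + ℓ`, by `1 ≤ ℓ`.
      pointer<B w i = <-≤-trans (pointer-range w i) (≤-trans (+-monoʳ-≤ 2 (arity≤2 i)) (+-monoʳ-≤ 3 1≤ℓ))

      lab< : ∀ f i v → lab f i v < π pB
      lab< f i v = subst (lab f i v <_) (sym (B≡ E≢0)) (go f)
        where
        go : ∀ f → lab f i v < 3 + ℓ
        go 0 = s≤s (≤-trans (t≤1+ℓ v) (n≤1+n (1 + ℓ)))
        go 1 = s≤s (≤-trans (g≤ 1≤ℓ v) (m≤n+m ℓ 2))
        go 2 = pointer<B (proj₁ (inWitness v)) i
        go (suc (suc (suc _))) = pointer<B (proj₁ (outWitness v)) i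

      pos : 0 < π pB
      pos = subst (0 <_) (sym (B≡ E≢0)) (s≤s z≤n)

      labelAt : ∀ f i q → Dec (q < ∣ bag i ∣) → ℕ
      labelAt f i q (yes q<) = lab f i (proj₁ (slot⁻ i q q<))
      -- Padding: there are `pD` digits in every state, enough for a bag of maximal size.
      labelAt f i q (no _)   = 0

      digits : Fin m → ℕ → ℕ
      digits i x = labelAt (x % 4) i (x / 4) (x / 4 <? ∣ bag i ∣)

      digits< : ∀ i x → digits i x < π pB
      digits< i x = go (x / 4 <? ∣ bag i ∣)
        where go : ∀ d → labelAt (x % 4) i (x / 4) d < π pB
              go (yes _) = lab< (x % 4) i _
              go (no _)  = pos

      state : Fin m → ℕ
      state i = encodeDigits (digits i) (π pD)

      K-power : π pK ≡ π pB ^ π pD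
      K-power = K≡

      4q : ∀ q → q + q + q + q ≡ q * 4
      4q = solve-∀

      agree : ∀ {f} → f < 4 → ∀ i q {v} → q < ∣ bag i ∣ → v ∈ bag i → slot i q ≡ toℕ v →
              label f (extend state (toℕ i)) q ≡ lab f i v
      agree {f} f<4 i q {v} q< v∈ eq =
        trans (cong (λ s → label f s q) (extend-toℕ state i))
        (trans (digit-encodeDigits (π pD) K-power (digits< i) (f + (q + q + q + q)) in-range)
        (trans (cong (λ x → digits i (f + x)) (4q q))
        (trans (cong₂ (λ r q → labelAt r i q (q <? ∣ bag i ∣)) rem quo) (go (q <? ∣ bag i ∣)))))
        where
        rem : (f + q * 4) % 4 ≡ f
        rem = trans ([m+kn]%n≡m%n f q 4) (m<n⇒m%n≡m f<4)
        quo : (f + q * 4) / 4 ≡ q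
        quo = trans (+-distrib-/ f (q * 4) (subst (_< 4) (sym (cong₂ _+_ (m<n⇒m%n≡m f<4) (m*n%n≡0 q 4)))
                (subst (_< 4) (sym (+-identityʳ f)) f<4))) (cong₂ _+_ (m<n⇒m/n≡0 f<4) (m*n/n≡m q 4))
        go : ∀ d → labelAt f i q d ≡ lab f i v
        go (yes q<′) = let v′ , _ , eq′ = slot⁻ i q q<′ in
          cong (lab f i) (Fin.toℕ-injective (trans (sym eq′) eq))
        go (no q≮) = contradiction q< q≮
        in-range : f + (q + q + q + q) < π pD
        in-range = subst₂ _<_ (cong (f +_) (sym (4q q))) (trans (sym (4q (π pb))) (sym D≡))
          (<-≤-trans (+-monoˡ-< (q * 4) f<4) (*-monoˡ-≤ 4 (≤-trans q< (b≥ i))))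

      checks : Link.Checks (extend state) lab agree
      checks = Link.valid⇒checks (extend state) lab agree valid

    -- `σ m ≡ 0` is recorded because the optimum is read from the table of the sentinel at state 0.
    state-from-set : ∃[ σ ] Bounded σ × σ m ≡ 0 × Total σ ≡ weight S
    state-from-set = extend state
      , extend-< state (≤-<-trans z≤n (encodeDigits-<K (π pD) K-power {λ _ → 0} (λ _ → pos)))
          (λ i → encodeDigits-<K (π pD) K-power (digits< i))
      , extend-out state m ≤-refl
      , total≡weight (extend state) lab agree checks S (λ _ → t≡0⁻ , t≡0⁺)

-- The main loop

isStatic : Tag → Bool
isStatic BP  = true
isStatic PW  = true
isStatic MN  = true
isStatic ADJ = true
isStatic NC  = true
isStatic SD  = true
isStatic _   = false

static≢TAB : ∀ {t} → isStatic t ≡ true → (offset t ≡ᵇ offset TAB) ≡ false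
static≢TAB {BP}  _ = refl
static≢TAB {PW}  _ = refl
static≢TAB {MN}  _ = refl
static≢TAB {ADJ} _ = refl
static≢TAB {NC}  _ = refl
static≢TAB {SD}  _ = refl

row-injective : ∀ {K i i′ s s′} → s < K → s′ < K → K * i + s ≡ K * i′ + s′ → i ≡ i′ × s ≡ s′
row-injective {K} {i} {i′} {s} {s′} s<K s′<K eq with <-cmp i i′
... | tri≈ _ refl _ = refl , +-cancelˡ-≡ (K * i) s s′ eq
... | tri< i<i′ _ _ = contradiction eq (<⇒≢ (≤-trans (+-monoʳ-< (K * i) s<K) (≤-trans
        (≤-reflexive (trans (+-comm (K * i) K) (sym (*-suc K i)))) (≤-trans (*-monoʳ-≤ K i<i′) (m≤m+n _ s′)))))
... | tri> _ _ i′<i = contradiction (sym eq) (<⇒≢ (≤-trans (+-monoʳ-< (K * i′) s′<K) (≤-trans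
        (≤-reflexive (trans (+-comm (K * i′) K) (sym (*-suc K i′)))) (≤-trans (*-monoʳ-≤ K i′<i) (m≤m+n _ s)))))

module Search {n m} (ℓ : ℕ) (G : Graph n) (V′ : Subset n) (D : NiceTreeDecomposition G m)
  {π : Params} {μ : Mem} (setup : Preparation.Setup ℓ G V′ D π μ)
  (1≤ℓ : 1 ≤ ℓ) (E≢0 : Encoding.E ℓ G V′ D ≢ 0) where
  open NiceTreeDecomposition D
  open Encoding ℓ G V′ D
  open Preparation ℓ G V′ D hiding (μ₁; μ₂; μ₃; μ₄)
  open Setup setup
  open Input input
  open Check ℓ G V′ D setup
  open Optimum ℓ G V′ D setup 1≤ℓ E≢0
  open Semantics I
  open Formulas I
  open Framing I
  open TreeFacts D
  open Labels ℓ V′ D side arity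
  open TreeOptimisation m (π pK) (π pINF) parentℕ nodeCost nodeCost-m

  private
    K : ℕ
    K = π pK

  Static : Mem → Set
  Static μ′ = ∀ t → isStatic t ≡ true → ∀ i → μ′ t i ≡ μ t i

  parentℕ≤m : ∀ {i} → i < m → parentℕ i ≤ m
  parentℕ≤m {i} i<m = subst (λ i → parentℕ i ≤ m) (Fin.toℕ-fromℕ< i<m) (go (fromℕ< i<m) (fromℕ< i<m Fin.≟ root))
    where go : ∀ j → Dec (j ≡ root) → parentℕ (toℕ j) ≤ m
          go j (yes refl) = ≤-reflexive parentℕ-root
          go j (no j≢)    = subst (_≤ m) (sym (parentℕ-other j≢)) (Fin.toℕ≤n (parent j))

  parentℕ≢ : ∀ {i} → i < m → parentℕ i ≢ i
  parentℕ≢ {i} i<m = subst (λ i → parentℕ i ≢ i) (Fin.toℕ-fromℕ< i<m) (go (fromℕ< i<m) (fromℕ< i<m Fin.≟ root))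
    where go : ∀ j → Dec (j ≡ root) → parentℕ (toℕ j) ≢ toℕ j
          go j (yes refl) eq = <⇒≢ (Fin.toℕ<n root) (trans (sym eq) parentℕ-root)
          go j (no j≢) eq = <⇒≢ (rank-parent-< j≢)
            (cong rank (Fin.toℕ-injective (trans (sym (parentℕ-other j≢)) eq)))

  opaque
    unfolding nodeValue
    -- `nodeCostT` reads only arrays that the main loop leaves alone, so its value is fixed by the
    -- memory at the start.
    nodeCost-eval : ∀ {μ′} → Static μ′ → ∀ {j} → j < m → ∀ x y z →
                    eval nodeCostT π μ′ (x ∷ y ∷ parentℕ j ∷ j ∷ z ∷ []) ≡ nodeCost j x y
    nodeCost-eval {μ′} static {j} j<m x y z =
      trans (eval-agree isStatic {μ′} {μ} static nodeCostT {π} (x ∷ y ∷ parentℕ j ∷ j ∷ z ∷ []) refl)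
      (trans (irrelevant x y (parentℕ j) j z) (sym (caseZ-≢0 (m>n⇒m∸n≢0 j<m))))
      where
      irrelevant : ∀ x y p j z → eval nodeCostT π μ (x ∷ y ∷ p ∷ j ∷ z ∷ []) ≡ nodeValue (x ∷ y ∷ p ∷ j ∷ 0 ∷ [])
      irrelevant x y p j z = refl

  table : Mem → ℕ → ℕ → ℕ
  table μ′ p s = μ′ TAB (K * p + s)

  message : Mem → ℕ → ℕ → ℕ
  message μ′ j s = minimum K (π pINF) (λ x → nodeCost j x s + table μ′ j x)

  -- The message has to stay correct while the row of the parent is being overwritten; it may depend
  -- only on static arrays and on the row of `j`.
  Delivers : Tm 4 → ℕ → Mem → Set
  Delivers e j μ′ = ∀ {μ″} → Static μ″ → (∀ x → x < K → table μ″ j x ≡ table μ′ j x) → ∀ s z →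
                    eval e π μ″ (s ∷ parentℕ j ∷ j ∷ z ∷ []) ≡ message μ′ j s

  messageT-delivers : ∀ {μ′ j} → j < m → Delivers messageT j μ′
  messageT-delivers {μ′} {j} j<m {μ″} static same s z = trans unfolded
    (minimum-cong K (π pINF) λ x x<K → cong₂ _+_ (nodeCost-eval static j<m x s z)
      (trans (cong (λ a → μ″ TAB (a + x)) (iter-times K j)) (same x x<K)))
    where
    unfolded : eval messageT π μ″ (s ∷ parentℕ j ∷ j ∷ z ∷ []) ≡
               minimum K (π pINF) (λ x → eval nodeCostT π μ″ (x ∷ s ∷ parentℕ j ∷ j ∷ z ∷ []) +
                                         μ″ TAB (iter K (λ _ a → a + j) 0 + x))
    unfolded = refl

  record Updated (j : ℕ) (μ′ : Mem) (s : ℕ) (μ″ : Mem) : Set where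
    field
      others   : ∀ t → (offset t ≡ᵇ offset TAB) ≡ false → ∀ i → μ″ t i ≡ μ′ t i
      row      : ∀ x → x < K → x < s → table μ″ (parentℕ j) x ≡ table μ′ (parentℕ j) x + message μ′ j x
      row-rest : ∀ x → x < K → s ≤ x → table μ″ (parentℕ j) x ≡ table μ′ (parentℕ j) x
      rows     : ∀ i → i ≢ parentℕ j → ∀ x → x < K → table μ″ i x ≡ table μ′ i x
  open Updated

  update-step : ∀ {j} → j < m → ∀ {μ′} → Static μ′ → ∀ e → Delivers e j μ′ → ∀ z s → s < K →
    ∀ μ″ → Updated j μ′ s μ″ →
    Updated j μ′ (suc s) (exec (addToTable e) π (s ∷ parentℕ j ∷ j ∷ z ∷ []) μ″)
  update-step {j} j<m {μ′} static e delivers z s s<K μ″ inv =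
    subst (λ ν → Updated j μ′ (suc s) ν) (sym written) record
      { others   = λ t t≢ i → trans (write-tag μ″ {TAB} {t} a v i t≢) (others inv t t≢ i)
      ; row      = λ x x<K x≤s → [ (λ x<s → trans (write-≢ μ″ TAB v (λ eq → <⇒≢ x<s (proj₂ (row-injective x<K s<K eq))))
                                              (row inv x x<K x<s))
                                 , (λ { refl → write-≡ μ″ TAB a v }) ]′ (m≤n⇒m<n∨m≡n (s≤s⁻¹ x≤s))
      ; row-rest = λ x x<K s<x → trans (write-≢ μ″ TAB v (λ eq → <⇒≢ s<x (sym (proj₂ (row-injective x<K s<K eq)))))
                                   (row-rest inv x x<K (<⇒≤ s<x))
      ; rows     = λ i i≢ x x<K → trans (write-≢ μ″ TAB v (i≢ ∘ proj₁ ∘ row-injective x<K s<K))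
                                    (rows inv i i≢ x x<K) }
    where
    a v : ℕ
    a = K * parentℕ j + s
    v = table μ′ (parentℕ j) s + message μ′ j s
    times : iter K (λ _ a → a + parentℕ j) 0 ≡ K * parentℕ j
    times = iter-times K (parentℕ j)
    written : exec (addToTable e) π (s ∷ parentℕ j ∷ j ∷ z ∷ []) μ″ ≡ write μ″ TAB a v
    written = cong₂ (write μ″ TAB) (cong (_+ s) times) (cong₂ _+_
        (trans (cong (λ r → μ″ TAB (r + s)) times) (row-rest inv s s<K ≤-refl))
        (delivers (λ t st i → trans (others inv t (static≢TAB {t} st) i) (static t st i))
          (rows inv j (parentℕ≢ j<m ∘ sym)) s z))

  update-correct : ∀ {j} → j < m → ∀ {μ′} → Static μ′ → ∀ e → Delivers e j μ′ → ∀ z →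
                   Updated j μ′ K (exec (for pK (addToTable e)) π (parentℕ j ∷ j ∷ z ∷ []) μ′)
  update-correct {j} j<m {μ′} static e delivers z = iter-invariant (Updated j μ′) K
    (record { others = λ _ _ _ → refl ; row = λ _ _ () ; row-rest = λ _ _ _ → refl ; rows = λ _ _ _ _ → refl })
    (λ s μ″ s<K inv → update-step j<m static e delivers z s s<K μ″ inv)

  Ready : Mem → ℕ → Set
  Ready μ′ i = μ′ DONE i ≡ 0 × μ′ DN i ≡ μ′ NC i

  doneChildren : Mem → ℕ → ℕ
  doneChildren μ′ p = ∑ m (λ j → caseZ (μ′ DONE j) 0 (only p 1 (parentℕ j)))

  -- `candidate` carries the schedule: a ready node is still ahead of the scan or is the current
  -- one, since a node becomes ready when its last child is absorbed, and then the cursor moves to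
  -- it. `closed` yields that the parent of an unfinished node is unfinished. `progress` splits the
  -- rounds into finished nodes and advances.
  record Loop (k : ℕ) (μ′ : Mem) : Set where
    field
      static    : Static μ′
      exact     : Exact (μ′ DONE) (table μ′)
      m-undone  : μ′ DONE m ≡ 0
      closed    : ∀ {i j} → j < m → parentℕ j ≡ i → μ′ DONE i ≢ 0 → μ′ DONE j ≢ 0
      number    : ∀ p → μ′ DN p ≡ doneChildren μ′ p
      candidate : ∀ {i} → i < m → Ready μ′ i → μ′ CUR 1 ≤ i ⊎ i ≡ μ′ CUR 0
      beyond    : m < μ′ CUR 1 → m ≤ μ′ CUR 0
      progress  : k ≡ ∑ m (λ i → caseZ (μ′ DONE i) 0 1) + μ′ CUR 1
  open Loop

  loop-start : Loop 0 μ
  loop-start = record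
    { static    = λ _ _ _ → refl
    ; exact     = exact-start done≡0 (λ p s → table≡0 (K * p + s))
    ; m-undone  = done≡0 m
    ; closed    = λ {i} _ _ d≢ → contradiction (done≡0 i) d≢
    ; number    = λ p → trans (number≡0 p) (sym (∑-0 m λ j _ → caseZ-0 (done≡0 j)))
    ; candidate = λ {i} _ _ → inj₁ (subst (_≤ i) (sym (cursor≡0 1)) z≤n)
    ; beyond    = λ lt → contradiction (subst (m <_) (cursor≡0 1) lt) λ ()
    ; progress  = sym (cong₂ _+_ (∑-0 m λ i _ → caseZ-0 (done≡0 i)) (cursor≡0 1)) }

  -- The count of finished children is a sum bounded termwise by the count of all children; when the
  -- sums agree, so do the terms.
  children-done : ∀ {k μ′} → Loop k μ′ → ∀ {i} → μ′ DN i ≡ μ′ NC i → ∀ {j} → j < m → parentℕ j ≡ i → μ′ DONE j ≢ 0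
  children-done {μ′ = μ′} L {i} eq {j} j<m refl z = 0≢1+n (trans (sym (cong (λ d → caseZ d 0 (only i 1 i)) z))
    (trans (∑-≡⇒≡ m (λ j → caseZ (μ′ DONE j) 0 (only i 1 (parentℕ j))) (λ j → only i 1 (parentℕ j))
             (λ j _ → bound (μ′ DONE j)) sums j j<m) (only-≡ i 1)))
    where
    bound : ∀ d {a} → caseZ d 0 a ≤ a
    bound zero    = z≤n
    bound (suc _) = ≤-refl
    sums : doneChildren μ′ i ≡ ∑ m (λ j → only i 1 (parentℕ j))
    sums = trans (sym (number L i)) (trans eq (trans (static L NC refl i) (children≡ i)))

  loop-advance : ∀ {k μ′} → Loop k μ′ → (μ′ CUR 0 < m → ¬ Ready μ′ (μ′ CUR 0)) → ∀ z →
                 Loop (suc k) (exec advance π (μ′ CUR 0 ∷ z ∷ []) μ′)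
  loop-advance {k} {μ′} L not-ready z = record
    { static    = λ { BP _ i → static L BP refl i ; PW _ i → static L PW refl i ; MN _ i → static L MN refl i
                    ; ADJ _ i → static L ADJ refl i ; NC _ i → static L NC refl i ; SD _ i → static L SD refl i }
    ; exact     = exact L
    ; m-undone  = m-undone L
    ; closed    = closed L
    ; number    = number L
    ; candidate = λ i<m r → later (candidate L i<m r) i<m r
    ; beyond    = λ lt → s≤s⁻¹ lt
    ; progress  = trans (cong suc (progress L)) (sym (+-suc _ (μ′ CUR 1))) }
    where
    later : ∀ {i} → μ′ CUR 1 ≤ i ⊎ i ≡ μ′ CUR 0 → i < m → Ready μ′ i → suc (μ′ CUR 1) ≤ i ⊎ i ≡ μ′ CUR 1
    later (inj₂ refl) i<m r = contradiction r (not-ready i<m)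
    later (inj₁ le) _ _ = [ inj₁ , inj₂ ∘ sym ]′ (m≤n⇒m<n∨m≡n le)

  loop-absorbWith : ∀ {k μ′} → Loop k μ′ → ∀ {j} → j ≡ μ′ CUR 0 → j < m → Ready μ′ j →
                    ∀ e → Delivers e j μ′ → ∀ z →
                    Loop (suc k) (exec (absorbWith e) π (parentℕ j ∷ j ∷ z ∷ []) μ′)
  loop-absorbWith {k} {μ′} L {j} j≡ j<m (undone , ready) e delivers z = record
    { static    = λ { BP _ i → static₁ BP refl i ; PW _ i → static₁ PW refl i ; MN _ i → static₁ MN refl i
                    ; ADJ _ i → static₁ ADJ refl i ; NC _ i → static₁ NC refl i ; SD _ i → static₁ SD refl i }
    ; exact     = exact-step {j} {μ′ DONE} {μ₄ DONE} {table μ′} {table μ₄} record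
        { message       = message μ′ j
        ; j<m           = j<m
        ; parent≤m      = parentℕ≤m j<m
        ; parent≢       = parentℕ≢ j<m
        ; undone        = undone
        ; parent-undone = p-undone
        ; children-done = λ i i<m eq → children-done L ready i<m eq
        ; done-j        = done-j
        ; done-other    = done-other
        ; A-parent      = λ s s<K → row U s s<K s<K
        ; A-other       = λ i _ i≢ s s<K → rows U i i≢ s s<K
        ; message-below = λ s x _ x<K → minimum-≤ K (π pINF) (λ x → nodeCost j x s + table μ′ j x) x x<K
        ; message-attained = λ s _ lt → minimum-attained K (π pINF) (λ x → nodeCost j x s + table μ′ j x) lt
        } (exact L)
    ; m-undone  = trans (done-other m (<⇒≢ j<m ∘ sym)) (m-undone L)
    ; closed    = closed′
    ; number    = number′
    ; candidate = λ {i} i<m r → candidate′ i<m r (i ≟ p)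
    -- Vacuous: the cursor stood at `j < m`, so the scan has not passed `m`.
    ; beyond    = λ lt → contradiction (subst (m ≤_) (sym j≡) (beyond L (subst (m <_) (others U CUR refl 1) lt))) (<⇒≱ j<m)
    ; progress  = progress′
    }
    where
    p = parentℕ j
    μ₁ = exec (for pK (addToTable e)) π (parentℕ j ∷ j ∷ z ∷ []) μ′
    U : Updated j μ′ K μ₁
    U = update-correct j<m (static L) e delivers z
    μ₂ = write μ₁ DONE j 1
    μ₃ = write μ₂ DN p (suc (μ₁ DN p))
    μ₄ = write μ₃ CUR 0 p

    static₁ : Static μ₁
    static₁ t st i = trans (others U t (static≢TAB {t} st) i) (static L t st i)

    done-j≡ : μ₄ DONE j ≡ 1
    done-j≡ = write-≡ μ₁ DONE j 1

    done-j : μ₄ DONE j ≢ 0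
    done-j eq = 0≢1+n (trans (sym eq) done-j≡)

    done-other : ∀ i → i ≢ j → μ₄ DONE i ≡ μ′ DONE i
    done-other i i≢ = trans (write-≢ μ₁ DONE 1 i≢) (others U DONE refl i)

    done-more : ∀ {i} → μ′ DONE i ≢ 0 → μ₄ DONE i ≢ 0
    done-more {i} d≢ = go (i ≟ j)
      where go : Dec (i ≡ j) → μ₄ DONE i ≢ 0
            go (yes refl) = done-j
            go (no i≢)    = d≢ ∘ trans (sym (done-other i i≢))

    p-undone : μ′ DONE p ≡ 0
    p-undone = go (μ′ DONE p ≟ 0)
      where go : Dec (μ′ DONE p ≡ 0) → μ′ DONE p ≡ 0
            go (yes eq) = eq
            go (no p≢)  = contradiction undone (closed L j<m refl p≢)

    closed′ : ∀ {i c} → c < m → parentℕ c ≡ i → μ₄ DONE i ≢ 0 → μ₄ DONE c ≢ 0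
    closed′ {i} {c} c<m eq d≢ = done-more (go (i ≟ j))
      where go : Dec (i ≡ j) → μ′ DONE c ≢ 0
            go (yes refl) = children-done L ready c<m eq
            go (no i≢)    = closed L c<m eq (d≢ ∘ trans (done-other i i≢))

    add-one : ∀ (f : ℕ → ℕ) i → caseZ (μ₄ DONE i) 0 (f i) ≡ caseZ (μ′ DONE i) 0 (f i) + only j (f j) i
    add-one f i = go (i ≟ j)
      where go : Dec (i ≡ j) → caseZ (μ₄ DONE i) 0 (f i) ≡ caseZ (μ′ DONE i) 0 (f i) + only j (f j) i
            go (yes refl) = trans (caseZ-≢0 done-j) (sym (cong₂ _+_ (caseZ-0 undone) (only-≡ j (f j))))
            go (no i≢) = trans (cong (λ d → caseZ d 0 (f i)) (done-other i i≢))
                           (sym (trans (cong (caseZ (μ′ DONE i) 0 (f i) +_) (only-≢ (f j) i≢)) (+-identityʳ _)))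

    ∑-add-one : ∀ (f : ℕ → ℕ) → ∑ m (λ i → caseZ (μ₄ DONE i) 0 (f i)) ≡ ∑ m (λ i → caseZ (μ′ DONE i) 0 (f i)) + f j
    ∑-add-one f = trans (∑-cong m λ i _ → add-one f i)
      (trans (∑-+ m (λ i → caseZ (μ′ DONE i) 0 (f i)) (only j (f j)))
        (cong (∑ m (λ i → caseZ (μ′ DONE i) 0 (f i)) +_) (∑-only m j (f j) j<m)))

    number′ : ∀ q → μ₄ DN q ≡ doneChildren μ₄ q
    number′ q = trans (go (q ≟ p)) (sym (∑-add-one (λ i → only q 1 (parentℕ i))))
      where
      go : Dec (q ≡ p) → μ₄ DN q ≡ doneChildren μ′ q + only q 1 p
      go (yes refl) = trans (write-≡ μ₂ DN q (suc (μ₁ DN q)))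
        (trans (cong suc (trans (others U DN refl q) (number L q)))
          (trans (+-comm 1 _) (cong (doneChildren μ′ q +_) (sym (only-≡ q 1)))))
      go (no q≢) = trans (write-≢ μ₂ DN (suc (μ₁ DN p)) q≢) (trans (others U DN refl q)
        (trans (number L q) (trans (sym (+-identityʳ _))
          (cong (doneChildren μ′ q +_) (sym (only-≢ 1 (q≢ ∘ sym)))))))

    candidate′ : ∀ {i} → i < m → Ready μ₄ i → Dec (i ≡ p) → μ₄ CUR 1 ≤ i ⊎ i ≡ μ₄ CUR 0
    candidate′ i<m r (yes i≡) = inj₂ i≡
    candidate′ {i} i<m (u , e) (no i≢) =
      [ (λ le → inj₁ (subst (_≤ i) (sym (others U CUR refl 1)) le))
      , (λ i≡ → contradiction (subst (λ i → μ₄ DONE i ≡ 0) (trans i≡ (sym j≡)) u) done-j) ]′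
      (candidate L i<m (trans (sym (done-other i (λ { refl → done-j u }))) u
                       , trans (trans (sym (others U DN refl i)) (trans (sym (write-≢ μ₂ DN (suc (μ₁ DN p)) i≢)) e))
                               (others U NC refl i)))

    progress′ : suc k ≡ ∑ m (λ i → caseZ (μ₄ DONE i) 0 1) + μ₄ CUR 1
    progress′ = trans (cong suc (progress L)) (sym (cong₂ _+_ (trans (∑-add-one (λ _ → 1)) (+-comm _ 1)) (others U CUR refl 1)))

  loop-absorb : ∀ {k μ′} → Loop k μ′ → ∀ {j} → j ≡ μ′ CUR 0 → j < m → Ready μ′ j → ∀ z →
                ∀ e → Delivers e j μ′ → Loop (suc k) (exec (bindS (parT 0F) (absorbWith e)) π (j ∷ z ∷ []) μ′)
  loop-absorb {k} {μ′} L {j} j≡ j<m ready z e delivers = subst (λ p → Loop (suc k) (exec (absorbWith e) π (p ∷ j ∷ z ∷ []) μ′))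
    (sym (parT≡ input 0F {μ′} {j ∷ z ∷ []} (trans (static L BP refl j) (pointers j (<⇒≤ j<m)))))
    (loop-absorbWith L j≡ j<m ready e delivers z)

  exec-when : ∀ {k} {P : Mem → Set} (φ : Fm k) (a b : Stmt k) ρ μ →
              (⟪ φ ⟫ π μ ρ → P (exec a π ρ μ)) → (¬ ⟪ φ ⟫ π μ ρ → P (exec b π ρ μ)) →
              P (exec (when (term φ) a b) π ρ μ)
  exec-when {P = P} φ a b ρ μ f g = go (eval (term φ) π μ ρ ≟ 0)
    where
    go : Dec (eval (term φ) π μ ρ ≡ 0) → P (exec (when (term φ) a b) π ρ μ)
    go (yes t) = subst P (sym (caseZ-0 t)) (f (sound φ t))
    go (no nt) = subst P (sym (caseZ-≢0 nt)) (g (nt ∘ complete φ))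

  loop-body : ∀ {k μ′} → Loop k μ′ → ∀ z →
    Loop (suc k) (exec (bindS (arr CUR (num 0)) (when (term readyF) absorb advance)) π (z ∷ []) μ′)
  loop-body {k} {μ′} L z = exec-when {P = Loop (suc k)} readyF absorb advance (μ′ CUR 0 ∷ z ∷ []) μ′
    (λ (lt , ready) → let j<m = subst (μ′ CUR 0 <_) m≡ lt in
      loop-absorb {k} {μ′} L {μ′ CUR 0} refl j<m ready z messageT (λ {μ″} → messageT-delivers {μ′} j<m {μ″}))
    (λ not → loop-advance L (λ lt ready → not (subst (μ′ CUR 0 <_) (sym m≡) lt , ready)) z)

  μ-final : Mem
  μ-final = exec dynamic π [] μ

  loop-end : Loop (1 + m + m) μ-final
  loop-end = subst (λ k → Loop k μ-final) IT≡ (iter-invariant Loop (π pIT) loop-start λ i μ′ _ L → loop-body L i)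

  -- After `1 + m + m` rounds the scan has passed `m`, so `candidate` leaves no ready node. An
  -- unfinished node whose children are finished would be ready, and induction from the leaves
  -- concludes.
  all-done : ∀ i → i < m → μ-final DONE i ≢ 0
  all-done i i<m = subst (λ i → μ-final DONE i ≢ 0) (Fin.toℕ-fromℕ< i<m)
    (descending (λ j → μ-final DONE (toℕ j) ≢ 0) step′ (fromℕ< i<m))
    where
    L = loop-end
    count≤m : ∑ m (λ i → caseZ (μ-final DONE i) 0 1) ≤ m
    count≤m = ≤-trans (∑-mono m {g = λ _ → 1} (λ i _ → le (μ-final DONE i))) (ones m)
      where
      le : ∀ d → caseZ d 0 1 ≤ 1
      le zero    = z≤n
      le (suc _) = ≤-refl
      ones : ∀ k → ∑ k (λ _ → 1) ≤ k
      ones zero    = z≤n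
      ones (suc k) = ≤-trans (+-monoˡ-≤ 1 (ones k)) (≤-reflexive (+-comm k 1))
    m<next : m < μ-final CUR 1
    m<next = +-cancelˡ-≤ m _ _ (≤-trans (≤-reflexive (trans (+-suc m m) (progress L))) (+-monoˡ-≤ _ count≤m))
    never : ∀ {i} → i < m → ¬ Ready μ-final i
    never i<m r = [ (λ le → n≮n _ (<-trans i<m (<-≤-trans m<next le)))
                  , (λ eq → <⇒≢ (<-≤-trans i<m (beyond L m<next)) eq) ]′ (candidate L i<m r)
    step′ : ∀ i → (∀ j → j ≢ root → parent j ≡ i → μ-final DONE (toℕ j) ≢ 0) → μ-final DONE (toℕ i) ≢ 0
    step′ i ih undone = never (Fin.toℕ<n i) (undone , trans (number L (toℕ i))
        (trans (∑-cong m pointwise) (sym (trans (static L NC refl (toℕ i)) (children≡ (toℕ i))))))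
      where
      pointwise : ∀ j → j < m → caseZ (μ-final DONE j) 0 (only (toℕ i) 1 (parentℕ j)) ≡ only (toℕ i) 1 (parentℕ j)
      pointwise j j<m = subst (λ j → caseZ (μ-final DONE j) 0 (only (toℕ i) 1 (parentℕ j)) ≡ only (toℕ i) 1 (parentℕ j))
        (Fin.toℕ-fromℕ< j<m) (go (fromℕ< j<m) (parentℕ (toℕ (fromℕ< j<m)) ≟ toℕ i))
        where
        zero-case : ∀ d {a} → a ≡ 0 → caseZ d 0 a ≡ a
        zero-case zero    eq = sym eq
        zero-case (suc _) eq = refl
        go : ∀ j → Dec (parentℕ (toℕ j) ≡ toℕ i) →
             caseZ (μ-final DONE (toℕ j)) 0 (only (toℕ i) 1 (parentℕ (toℕ j))) ≡ only (toℕ i) 1 (parentℕ (toℕ j))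
        go j (no p≢) = zero-case (μ-final DONE (toℕ j)) (only-≢ 1 p≢)
        go j (yes p≡) = caseZ-≢0 (ih j j≢ (Fin.toℕ-injective (trans (sym (parentℕ-other j≢)) p≡)))
          where
          j≢ : j ≢ root
          j≢ refl = <⇒≢ (Fin.toℕ<n i) (trans (sym p≡) parentℕ-root)

  optimum : ℕ
  optimum = μ-final TAB (K * m)

  private
    table-m : table μ-final m 0 ≡ optimum
    table-m = cong (μ-final TAB) (+-identityʳ (K * m))

  optimum-≤ : ∀ S → Dominates G ℓ V′ S → optimum ≤ weight S
  optimum-≤ S dom =
    let σ , b , σm≡0 , total = state-from-set S dom in
    subst₂ _≤_ (trans (cong (table μ-final m) σm≡0) table-m) total
      (optimum-below (exact loop-end) all-done (m-undone loop-end) σ b)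

  -- The states found have total at most the optimum; the set they encode dominates, so its weight
  -- is also at least the optimum.
  optimum-set : optimum < π pINF → 0 < K → ∃[ S ] Dominates G ℓ V′ S × weight S ≡ optimum
  optimum-set lt 0<K =
    let σ , b , le = optimum-attained (exact loop-end) all-done (m-undone loop-end) 0<K (subst (_< π pINF) (sym table-m) lt)
        le′ = ≤-trans le (≤-reflexive table-m)
        S , dom , total = set-from-state σ (≤-<-trans le′ lt)
    in S , dom , ≤-antisym (subst (_≤ optimum) total le′) (optimum-≤ S dom)

-- Decoding the optimum

∑-head : ∀ n (f : ℕ → ℕ) → ∑ (suc n) f ≡ f 0 + ∑ n (f ∘ suc)
∑-head zero    f = sym (+-identityʳ (f 0))
∑-head (suc n) f = trans (cong (_+ f (suc n)) (∑-head n f)) (+-assoc (f 0) (∑ n (f ∘ suc)) (f (suc n)))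

∑-*ʳ : ∀ n (f : ℕ → ℕ) c → ∑ n (λ i → f i * c) ≡ ∑ n f * c
∑-*ʳ zero    f c = refl
∑-*ʳ (suc n) f c = trans (cong (_+ f n * c) (∑-*ʳ n f c)) (sym (*-distribʳ-+ c (∑ n f) (f n)))

indicator : ∀ {n} → Subset n → ℕ → ℕ
indicator S = extend (bit ∘ lookup S)

maskTerm : ∀ {n} → Subset n → ℕ → ℕ
maskTerm S v = caseZ (indicator S v) 0 (2 ^ v)

mask : ∀ {n} → Subset n → ℕ
mask {n} S = ∑ n (maskTerm S)

∑-indicator : ∀ {n} (S : Subset n) → ∑ n (λ v → caseZ (indicator S v) 0 1) ≡ ∣ S ∣
∑-indicator []      = refl
∑-indicator {suc n} (true ∷ S)  = trans (∑-head n _) (cong suc (∑-indicator S))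
∑-indicator {suc n} (false ∷ S) = trans (∑-head n _) (∑-indicator S)

-- Quotient and remainder modulo 2ⁿ: comparing weights compares sizes first, and the remainder is
-- the bit pattern of the set.
weight≡ : ∀ {n} (S : Subset n) → weight S ≡ ∣ S ∣ * 2 ^ n + mask S
weight≡ {n} S = trans (∑-cong n λ v _ → split (indicator S v) v)
  (trans (∑-+ n (λ v → caseZ (indicator S v) 0 1 * 2 ^ n) (maskTerm S))
    (cong (_+ mask S) (trans (∑-*ʳ n (λ v → caseZ (indicator S v) 0 1) (2 ^ n)) (cong (_* 2 ^ n) (∑-indicator S)))))
  where
  split : ∀ b v → caseZ b 0 (2 ^ n + 2 ^ v) ≡ caseZ b 0 1 * 2 ^ n + caseZ b 0 (2 ^ v)
  split zero    v = refl
  split (suc _) v = cong (_+ 2 ^ v) (sym (+-identityʳ (2 ^ n)))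

maskTerms-< : ∀ {n} (S : Subset n) k → ∑ k (maskTerm S) < 2 ^ k
maskTerms-< S zero    = s≤s z≤n
maskTerms-< S (suc k) = <-≤-trans (+-mono-<-≤ (maskTerms-< S k) (bound (indicator S k)))
                          (≤-reflexive (cong (2 ^ k +_) (sym (+-identityʳ (2 ^ k)))))
  where bound : ∀ b → caseZ b 0 (2 ^ k) ≤ 2 ^ k
        bound zero    = z≤n
        bound (suc _) = ≤-refl

weight-≤⇒size-≤ : ∀ {n} {S S′ : Subset n} → weight S ≤ weight S′ → ∣ S ∣ ≤ ∣ S′ ∣
weight-≤⇒size-≤ {n} {S} {S′} le = ≮⇒≥ λ lt → n≮n (weight S′) (<-≤-trans (≤-<-trans (≤-reflexive (weight≡ S′))
  (<-≤-trans (+-monoʳ-< (∣ S′ ∣ * 2 ^ n) (maskTerms-< S′ n))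
    (≤-trans (≤-reflexive (+-comm (∣ S′ ∣ * 2 ^ n) (2 ^ n))) (≤-trans (*-monoˡ-≤ (2 ^ n) lt)
      (≤-trans (m≤m+n _ (mask S)) (≤-reflexive (sym (weight≡ S)))))))) le)

-- Only `c` of the `k` rounds subtract; from then on the value is below `T` and stays.
reduce : ∀ k c {T r} → r < T → c ≤ k → iter k (λ _ a → caseZ (T ∸ a) (a ∸ T) a) (c * T + r) ≡ r
reduce k c {T} {r} r<T c≤k = trans (go k) (cong (λ x → x * T + r) (m≤n⇒m∸n≡0 c≤k))
  where
  one : ∀ c → caseZ (T ∸ (c * T + r)) ((c * T + r) ∸ T) (c * T + r) ≡ (c ∸ 1) * T + r
  one zero    = caseZ-≢0 (m>n⇒m∸n≢0 r<T)
  one (suc c) = trans (caseZ-0 (m≤n⇒m∸n≡0 (≤-trans (m≤m+n T (c * T)) (m≤m+n (T + c * T) r))))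
    (trans (cong (_∸ T) (+-assoc T (c * T) r)) (m+n∸m≡n T (c * T + r)))
  go : ∀ k → iter k (λ _ a → caseZ (T ∸ a) (a ∸ T) a) (c * T + r) ≡ (c ∸ k) * T + r
  go zero    = refl
  go (suc k) = trans (cong (λ a → caseZ (T ∸ a) (a ∸ T) a) (go k)) (trans (one (c ∸ k))
    (cong (λ x → x * T + r) (trans (∸-+-assoc c k 1) (cong (c ∸_) (+-comm k 1)))))

module Final (I : ℕ → ℕ) where
  open Semantics I

  -- Opaque, because the loop bound π₈ pIT is a successor and would unfold.
  opaque
    finalMem : Params → Mem → Mem
    finalMem π μ = exec output π [] (exec dynamic π [] μ)

    finalMem≡ : ∀ π μ → finalMem π μ ≡ exec output π [] (exec dynamic π [] μ)
    finalMem≡ π μ = refl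

-- Correctness of the output, without and with edges

module Edgeless {n} (G : Graph n) (edgeless : length (edges G) ≡ 0) where

  isolated : ∀ {u v} → ¬ Adj G u v
  isolated = go (edges G) edgeless
    where
    go : ∀ es → length es ≡ 0 → ∀ {u v} → ¬ ((u , v) ∈ₗ es ⊎ (v , u) ∈ₗ es)
    go [] _ (inj₁ ())
    go [] _ (inj₂ ())

  𝒫⊆ : ∀ r {S v} → 𝒫 G r S v → v ∈ S
  𝒫⊆ zero          p = p
  𝒫⊆ (suc zero)    (u , u∈ , inj₁ refl) = u∈
  𝒫⊆ (suc zero)    (u , u∈ , inj₂ a) = contradiction a isolated
  𝒫⊆ (suc (suc r)) (inj₁ p) = 𝒫⊆ (suc r) p
  𝒫⊆ (suc (suc r)) (inj₂ (u , a , _)) = contradiction a isolated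

  minimum-is-target : ∀ ℓ V′ → IsMinimumDominating G ℓ V′ V′
  minimum-is-target ℓ V′ = (λ v v∈ → 𝒫-mono G {0} {ℓ} z≤n v∈)
    , λ S′ dom → p⊆q⇒∣p∣≤∣q∣ λ {v} v∈ → 𝒫⊆ ℓ (dom v v∈)

module Decoding {n m} (ℓ : ℕ) (G : Graph n) (V′ : Subset n) (D : NiceTreeDecomposition G m)
  {π : Params} {μ : Mem} (setup : Preparation.Setup ℓ G V′ D π μ) (1≤ℓ : 1 ≤ ℓ) where
  open Encoding ℓ G V′ D
  open Preparation ℓ G V′ D using (module Setup; module Input)
  open Setup setup
  open Input input
  open Semantics I

  Correct : Mem → Set
  Correct μ′ = ∃[ S ] IsMinimumDominating G ℓ V′ S × (∀ v → μ′ OUT (toℕ v) ≡ bit (lookup S v))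

  copyTarget extract : Stmt 0
  copyTarget = for pn (store OUT (var 0F) (inp (num 2 ⊞ var 0F)))
  extract = for pn (bindS (par pn ⊟ (num 1 ⊞ var 0F))
        (when (arr PW (var 0F) ⊟ arr CUR (num 2))
          ( store OUT (var 0F) (num 1)
          ⨾ store CUR (num 2) (arr CUR (num 2) ⊟ arr PW (var 0F)))
          (store OUT (var 0F) (num 0))))

  copyTarget-correct : E ≡ 0 → ∀ μ′ → Correct (exec copyTarget π [] μ′)
  copyTarget-correct E≡0 μ′ = V′ , Edgeless.minimum-is-target G E≡0 ℓ V′
    , λ v → trans (copied (toℕ v) (subst (toℕ v <_) (sym n≡) (Fin.toℕ<n v))) (I-target v)
    where
    copied : ∀ i → i < π pn → exec copyTarget π [] μ′ OUT i ≡ I (2 + i)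
    copied = iter-invariant (λ k ν → ∀ i → i < k → ν OUT i ≡ I (2 + i)) (π pn) (λ _ ())
      (λ k ν _ ih i i≤ → [ (λ i< → trans (write-≢ ν OUT (I (2 + k)) (<⇒≢ i<)) (ih i i<))
                         , (λ { refl → write-≡ ν OUT i (I (2 + i)) }) ]′ (m≤n⇒m<n∨m≡n (s≤s⁻¹ i≤)))

  record Extracted (S : Subset n) (k : ℕ) (ν : Mem) : Set where
    field
      halves  : ∀ v → v ≤ n → ν PW v ≡ 2 ^ v
      remnant : ν CUR 2 ≡ ∑ (n ∸ k) (maskTerm S)
      written : ∀ v → v < n → n ∸ k ≤ v → ν OUT v ≡ indicator S v
  open Extracted

  indicator-≤1 : ∀ {n} (S : Subset n) v → indicator S v ≡ 0 ⊎ indicator S v ≡ 1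
  indicator-≤1 []          v       = inj₁ refl
  indicator-≤1 (true ∷ S)  zero    = inj₂ refl
  indicator-≤1 (false ∷ S) zero    = inj₁ refl
  indicator-≤1 (x ∷ S)     (suc v) = indicator-≤1 S v

  -- The powers 2ᵛ with `v < u` sum to less than 2ᵘ, so comparing the remnant with 2ᵘ decides bit
  -- `u`.
  extract-step : ∀ S k → k < n → ∀ ν → Extracted S k ν → ∀ u → u ≡ n ∸ suc k →
    Extracted S (suc k) (caseZ (ν PW u ∸ ν CUR 2)
      (write (write ν OUT u 1) CUR 2 (ν CUR 2 ∸ ν PW u)) (write ν OUT u 0))
  extract-step S k k<n ν inv u refl = go (indicator-≤1 S u)
    where
    n∸k : n ∸ k ≡ suc u
    n∸k = +-∸-assoc 1 k<n
    u<n : u < n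
    u<n = ≤-trans (≤-reflexive (sym n∸k)) (m∸n≤m n k)
    PWu : ν PW u ≡ 2 ^ u
    PWu = halves inv u (<⇒≤ u<n)
    R : ν CUR 2 ≡ ∑ u (maskTerm S) + maskTerm S u
    R = trans (remnant inv) (cong (λ j → ∑ j (maskTerm S)) n∸k)
    output-at : ∀ ν′ b → indicator S u ≡ b → (∀ v → v ≢ u → ν′ OUT v ≡ ν OUT v) → ν′ OUT u ≡ b →
                ∀ v → v < n → u ≤ v → ν′ OUT v ≡ indicator S v
    output-at ν′ b eq other at-u v v<n u≤v =
      [ (λ u<v → trans (other v (<⇒≢ u<v ∘ sym)) (written inv v v<n (≤-trans (≤-reflexive n∸k) u<v)))
      , (λ { refl → trans at-u (sym eq) }) ]′ (m≤n⇒m<n∨m≡n u≤v)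
    go : indicator S u ≡ 0 ⊎ indicator S u ≡ 1 → _
    go (inj₁ out) = subst (Extracted S (suc k)) (sym (caseZ-≢0 (m>n⇒m∸n≢0
        (subst₂ _<_ (sym R′) (sym PWu) (maskTerms-< S u))))) record
      { halves = halves inv ; remnant = R′
      ; written = output-at (write ν OUT u 0) 0 out (λ v v≢ → write-≢ ν OUT 0 v≢) (write-≡ ν OUT u 0) }
      where
      R′ : ν CUR 2 ≡ ∑ u (maskTerm S)
      R′ = trans R (trans (cong (λ b → ∑ u (maskTerm S) + caseZ b 0 (2 ^ u)) out) (+-identityʳ _))
    go (inj₂ in′) = subst (Extracted S (suc k)) (sym (caseZ-0 (m≤n⇒m∸n≡0
        (subst₂ _≤_ (sym PWu) (sym R′) (m≤n+m (2 ^ u) _))))) record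
      { halves = halves inv
      ; remnant = trans (cong₂ _∸_ R′ PWu) (m+n∸n≡m (∑ u (maskTerm S)) (2 ^ u))
      ; written = output-at (write (write ν OUT u 1) CUR 2 (ν CUR 2 ∸ ν PW u)) 1 in′
                    (λ v v≢ → write-≢ ν OUT 1 v≢) (write-≡ ν OUT u 1) }
      where
      R′ : ν CUR 2 ≡ ∑ u (maskTerm S) + 2 ^ u
      R′ = trans R (cong (λ b → ∑ u (maskTerm S) + caseZ b 0 (2 ^ u)) in′)

  extract-correct : ∀ S ν → (∀ v → v ≤ n → ν PW v ≡ 2 ^ v) → ν CUR 2 ≡ mask S →
                    ∀ v → exec extract π [] ν OUT (toℕ v) ≡ bit (lookup S v)
  extract-correct S ν pw start v = trans
    (written (subst (λ k → Extracted S k (exec extract π [] ν)) n≡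
      (iter-invariant (Extracted S) (π pn)
        (record { halves = pw ; remnant = start ; written = λ v v<n n≤v → contradiction (<-≤-trans v<n n≤v) (n≮n v) })
        (λ k ν′ k< inv → extract-step S k (subst (k <_) n≡ k<) ν′ inv (π pn ∸ suc k) (cong (_∸ suc k) n≡))))
      (toℕ v) (Fin.toℕ<n v) (subst (_≤ toℕ v) (sym (n∸n≡0 n)) z≤n))
    (extend-toℕ (bit ∘ lookup S) v)

  module _ (E≢0 : E ≢ 0) where
    open Search ℓ G V′ D setup 1≤ℓ E≢0

    private
      weight-⊤ : weight {n} Subset.⊤ < π pINF
      weight-⊤ = subst₂ _<_ (sym (weight≡ (Subset.⊤ {n}))) (sym INF≡)
        (+-mono-≤-< (*-monoˡ-≤ (2 ^ n) (∣p∣≤n (Subset.⊤ {n}))) (maskTerms-< {n} Subset.⊤ n))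

      -- The set of all vertices always dominates, so the optimum is never a penalty.
      optimum<INF : optimum < π pINF
      optimum<INF = ≤-<-trans (optimum-≤ Subset.⊤ λ v _ → 𝒫-mono G {0} {ℓ} z≤n ∈⊤) weight-⊤

      0<K : 0 < π pK
      0<K = subst (0 <_) (sym (trans K≡ (cong (_^ π pD) (B≡ E≢0)))) (m^n>0 (3 + ℓ) (π pD))

    decode-correct : ∀ ν → (∀ v → v ≤ n → ν PW v ≡ 2 ^ v) →
      ν CUR 2 ≡ iter (π pn) (λ _ a → caseZ (π pTW ∸ a) (a ∸ π pTW) a) optimum → Correct (exec extract π [] ν)
    decode-correct ν pw start =
      let S , dom , w≡ = optimum-set optimum<INF 0<K in
      S , (dom , λ S′ dom′ → weight-≤⇒size-≤ {S = S} {S′} (subst (_≤ weight S′) (sym w≡) (optimum-≤ S′ dom′)))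
        , extract-correct S ν pw (trans start (trans
            (cong₂ (λ k T → iter k (λ _ a → caseZ (T ∸ a) (a ∸ T) a) optimum) n≡ TW≡)
            (trans (cong (iter n (λ _ a → caseZ (2 ^ n ∸ a) (a ∸ 2 ^ n) a)) (trans (sym w≡) (weight≡ S)))
              (reduce n ∣ S ∣ (maskTerms-< S n) (∣p∣≤n S)))))

    powers-final : ∀ v → v ≤ n → μ-final PW v ≡ 2 ^ v
    powers-final v v≤ = trans (Loop.static loop-end PW refl v) (powers≡ v v≤)

  output-correct : Correct (Final.finalMem I π μ)
  output-correct = subst Correct (sym (Final.finalMem≡ I π μ)) (go (E ≟ 0))
    where
    go : Dec (E ≡ 0) → Correct (exec output π [] (exec dynamic π [] μ))
    go (yes E≡0) = subst Correct (sym (caseZ-0 (trans E≡ E≡0))) (copyTarget-correct E≡0 (exec dynamic π [] μ))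
    go (no E≢0) = subst Correct (sym (caseZ-≢0 (E≢0 ∘ trans (sym E≡))))
      (decode-correct E≢0 (write (exec dynamic π [] μ) CUR 2 (iter (π pn) (λ _ a → caseZ (π pTW ∸ a) (a ∸ π pTW) a)
          (exec dynamic π [] μ TAB (iter (π pK) (λ _ a → a + π pm) 0))))
        (powers-final E≢0)
        (cong (λ i → iter (π pn) (λ _ a → caseZ (π pTW ∸ a) (a ∸ π pTW) a) (exec dynamic π [] μ TAB i))
          (trans (iter-times (π pK) (π pm)) (cong (π pK *_) m≡))))

-- Running time

-- `small` parameters are bounded in terms of k and ℓ, `large` ones by the size of the graph and the
-- tree; a `value` such as 2ⁿ never bounds a loop.
data Kind : Set where
  small large value : Kind

kind : Param → Kind
kind pn   = large
kind pm   = large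
kind pE   = large
kind pIT  = large
kind pb   = small
kind pD   = small
kind pB   = small
kind pK   = small
kind pℓ   = value
kind pTW  = value
kind pINF = value

-- class s a b stands for s Qᵃ Nᵇ, where Q bounds the small and N the large
-- parameters.
record Class : Set where
  constructor class
  field coefficient small-degree large-degree : ℕ
open Class

const : ℕ → Class
const c = class c 0 0

infixl 6 _⊹_
_⊹_ : Class → Class → Class
class s a b ⊹ class s′ a′ b′ = class (s + s′) (a ⊔ a′) (b ⊔ b′)

-- The 8 pays for both constants 4 of `loopTime`. The last clause also matches `value`, which
-- `iterable` rules out.
loopClass′ : Kind → Class → Class
loopClass′ large (class s a b) = class (8 + s) a (suc b)
loopClass′ _     (class s a b) = class (8 + s) (suc a) b

loopClass : Param → Class → Class
loopClass P = loopClass′ (kind P)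

classT : ∀ {k} → Tm k → Class
classT (num a)        = const 2
classT (var x)        = const 2
classT (par P)        = const 2
classT (inp e)        = const 1 ⊹ classT e ⊹ const 9
classT (arr t e)      = const 1 ⊹ classT e ⊹ const (1 + cost (mem (cell t (reg 0))))
classT (e ⊞ e′)       = const 1 ⊹ classT e ⊹ (const 1 ⊹ classT e′ ⊹ const 4)
classT (e ⊟ e′)       = const 1 ⊹ classT e ⊹ (const 1 ⊹ classT e′ ⊹ const 4)
classT (ifz c a b)    = const 1 ⊹ classT c ⊹ (const 2 ⊹ (classT a ⊹ classT b))
classT (bind e b)     = const 1 ⊹ classT e ⊹ (const 1 ⊹ classT b ⊹ const 2)
classT (fold P e b o) =
  const 1 ⊹ classT e ⊹ (const 3 ⊹ loopClass P (const 1 ⊹ classT b ⊹ (const 1 ⊹ classT o ⊹ const 7)))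

classS : ∀ {k} → Stmt k → Class
classS (store t i e) =
  const 1 ⊹ classT i ⊹ (const 1 ⊹ classT e ⊹ const (1 + cost (cell t (reg 0)) + 1))
classS (s ⨾ s′)      = const 1 ⊹ classS s ⊹ classS s′
classS (when c a b)  = const 1 ⊹ classT c ⊹ (const 2 ⊹ (classS a ⊹ classS b))
classS (bindS e s)   = const 1 ⊹ classT e ⊹ classS s
classS (for P s)     = const 3 ⊹ loopClass P (const 1 ⊹ classS s ⊹ const 4)

class₁ : Instr → Class
class₁ (assign P e) = const 1 ⊹ classT e ⊹ const 2
class₁ (perform s)  = classS s

classP : Program → Class
classP []      = const 1
classP (i ∷ p) = const 1 ⊹ class₁ i ⊹ classP p

iterable′ : Kind → Bool
iterable′ value = false
iterable′ _     = true

iterable : Param → Bool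
iterable P = iterable′ (kind P)

loopsT : ∀ {k} → Tm k → Bool
loopsT (num _)        = true
loopsT (var _)        = true
loopsT (par _)        = true
loopsT (inp e)        = loopsT e
loopsT (arr _ e)      = loopsT e
loopsT (e ⊞ e′)       = loopsT e ∧ loopsT e′
loopsT (e ⊟ e′)       = loopsT e ∧ loopsT e′
loopsT (ifz c a b)    = loopsT c ∧ (loopsT a ∧ loopsT b)
loopsT (bind e b)     = loopsT e ∧ loopsT b
loopsT (fold P e b o) = iterable P ∧ (loopsT e ∧ (loopsT b ∧ loopsT o))

loopsS : ∀ {k} → Stmt k → Bool
loopsS (store _ i e) = loopsT i ∧ loopsT e
loopsS (s ⨾ s′)      = loopsS s ∧ loopsS s′
loopsS (when c a b)  = loopsT c ∧ (loopsS a ∧ loopsS b)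
loopsS (bindS e s)   = loopsT e ∧ loopsS s
loopsS (for P s)     = iterable P ∧ loopsS s

loops₁ : Instr → Bool
loops₁ (assign _ e) = loopsT e
loops₁ (perform s)  = loopsS s

loopsP : Program → Bool
loopsP []      = true
loopsP (i ∷ p) = loops₁ i ∧ loopsP p

module Bounds (Q N : ℕ) (1≤Q : 1 ≤ Q) (1≤N : 1 ≤ N) where

  private
    instance
      Q-nonZero : NonZero Q
      Q-nonZero = >-nonZero 1≤Q
      N-nonZero : NonZero N
      N-nonZero = >-nonZero 1≤N

  ⟦_⟧ᶜ : Class → ℕ
  ⟦ class s a b ⟧ᶜ = s * (Q ^ a * N ^ b)

  const-sound : ∀ c → c ≤ ⟦ const c ⟧ᶜ
  const-sound c = ≤-reflexive (sym (*-identityʳ c))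

  ⊹-sound : ∀ {t t′} c c′ → t ≤ ⟦ c ⟧ᶜ → t′ ≤ ⟦ c′ ⟧ᶜ → t + t′ ≤ ⟦ c ⊹ c′ ⟧ᶜ
  ⊹-sound (class s a b) (class s′ a′ b′) le le′ =
    ≤-trans (+-mono-≤ (≤-trans le (*-monoʳ-≤ s (*-mono-≤ (^-monoʳ-≤ Q (m≤m⊔n a a′)) (^-monoʳ-≤ N (m≤m⊔n b b′)))))
                      (≤-trans le′ (*-monoʳ-≤ s′ (*-mono-≤ (^-monoʳ-≤ Q (m≤n⊔m a a′)) (^-monoʳ-≤ N (m≤n⊔m b b′))))))
            (≤-reflexive (sym (*-distribʳ-+ _ s s′)))

  private
    loop-bound : ∀ {n t x} s y → 1 ≤ x → 1 ≤ y → n ≤ x → t ≤ s * y → n * (4 + t) + 4 ≤ (8 + s) * (x * y)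
    loop-bound {n} {t} {x} s y 1≤x 1≤y n≤x t≤ = ≤-trans
      (+-mono-≤ (*-mono-≤ n≤x (+-mono-≤ (≤-trans (≤-reflexive (sym (*-identityʳ 4))) (*-monoʳ-≤ 4 1≤y)) t≤))
                (≤-trans (≤-reflexive (sym (*-identityʳ 4))) (*-monoʳ-≤ 4 (*-mono-≤ 1≤x 1≤y))))
      (≤-reflexive (rearrange x y s))
      where rearrange : ∀ x y s → x * (4 * y + s * y) + 4 * (x * y) ≡ (8 + s) * (x * y)
            rearrange = solve-∀

    1≤Q^ : ∀ a → 1 ≤ Q ^ a
    1≤Q^ a = m^n>0 Q a
    1≤N^ : ∀ a → 1 ≤ N ^ a
    1≤N^ a = m^n>0 N a

  Limit : Kind → ℕ → Set
  Limit small x = x ≤ Q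
  Limit large x = x ≤ N
  Limit value x = ⊤

  Fits : Params → Set
  Fits π = ∀ P → Limit (kind P) (π P)

  loop-sound : ∀ {t n} κ c → iterable′ κ ≡ true → Limit κ n → t ≤ ⟦ c ⟧ᶜ → loopTime n t ≤ ⟦ loopClass′ κ c ⟧ᶜ
  loop-sound small (class s a b) _ n≤ t≤ = ≤-trans
    (loop-bound s (Q ^ a * N ^ b) 1≤Q (*-mono-≤ (1≤Q^ a) (1≤N^ b)) n≤ t≤)
    (≤-reflexive (cong ((8 + s) *_) (sym (*-assoc Q (Q ^ a) (N ^ b)))))
  loop-sound large (class s a b) _ n≤ t≤ = ≤-trans
    (loop-bound s (Q ^ a * N ^ b) 1≤N (*-mono-≤ (1≤Q^ a) (1≤N^ b)) n≤ t≤)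
    (≤-reflexive (cong ((8 + s) *_) (swap N (Q ^ a) (N ^ b))))
    where swap : ∀ x y z → x * (y * z) ≡ y * (x * z)
          swap = solve-∀

  private
    ∧-l : ∀ {a b} → a ∧ b ≡ true → a ≡ true
    ∧-l {true} _ = refl
    ∧-r : ∀ {a b} → a ∧ b ≡ true → b ≡ true
    ∧-r {true} eq = eq

    unary : ∀ {t} c d e → t ≤ ⟦ c ⟧ᶜ → d + t + e ≤ ⟦ const d ⊹ c ⊹ const e ⟧ᶜ
    unary c d e le = ⊹-sound (const d ⊹ c) (const e) (⊹-sound (const d) c (const-sound d) le) (const-sound e)

  sequence : ∀ {t t′} c c′ → t ≤ ⟦ c ⟧ᶜ → t′ ≤ ⟦ c′ ⟧ᶜ → 1 + t + t′ ≤ ⟦ const 1 ⊹ c ⊹ c′ ⟧ᶜ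
  sequence c c′ le le′ = ⊹-sound (const 1 ⊹ c) c′ (⊹-sound (const 1) c (const-sound 1) le) le′

  module _ {π : Params} (fits : Fits π) where

    timeT-bound : ∀ {k} (e : Tm k) → loopsT e ≡ true → time π e ≤ ⟦ classT e ⟧ᶜ
    timeT-bound (num a)   _ = const-sound 2
    timeT-bound (var x)   _ = const-sound 2
    timeT-bound (par P)   _ = const-sound 2
    timeT-bound (inp e)   h = unary (classT e) 1 9 (timeT-bound e h)
    timeT-bound (arr t e) h = unary (classT e) 1 _ (timeT-bound e h)
    timeT-bound (e ⊞ e′)  h = sequence (classT e) (const 1 ⊹ classT e′ ⊹ const 4) (timeT-bound e (∧-l h))
      (unary (classT e′) 1 4 (timeT-bound e′ (∧-r {loopsT e} h)))
    timeT-bound (e ⊟ e′)  h = sequence (classT e) (const 1 ⊹ classT e′ ⊹ const 4) (timeT-bound e (∧-l h))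
      (unary (classT e′) 1 4 (timeT-bound e′ (∧-r {loopsT e} h)))
    timeT-bound (ifz c a b) h = sequence (classT c) (const 2 ⊹ (classT a ⊹ classT b)) (timeT-bound c (∧-l h))
      (⊹-sound (const 2) (classT a ⊹ classT b) (const-sound 2) (⊹-sound (classT a) (classT b)
        (timeT-bound a (∧-l (∧-r {loopsT c} h))) (timeT-bound b (∧-r {loopsT a} (∧-r {loopsT c} h)))))
    timeT-bound (bind e b) h = sequence (classT e) (const 1 ⊹ classT b ⊹ const 2) (timeT-bound e (∧-l h))
      (unary (classT b) 1 2 (timeT-bound b (∧-r {loopsT e} h)))
    timeT-bound (fold P e b o) h =
      sequence (classT e) (const 3 ⊹ loopClass P body) (timeT-bound e (∧-l h′))
        (⊹-sound (const 3) (loopClass P body) (const-sound 3)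
          (loop-sound (kind P) body (∧-l h) (fits P) (sequence (classT b) (const 1 ⊹ classT o ⊹ const 7)
            (timeT-bound b (∧-l (∧-r {loopsT e} h′))) (unary (classT o) 1 7 (timeT-bound o (∧-r {loopsT b} (∧-r {loopsT e} h′)))))))
      where
      h′ = ∧-r {iterable P} h
      body = const 1 ⊹ classT b ⊹ (const 1 ⊹ classT o ⊹ const 7)

    timeS-bound : ∀ {k} (s : Stmt k) → loopsS s ≡ true → timeS π s ≤ ⟦ classS s ⟧ᶜ
    timeS-bound (store t i e) h = sequence (classT i) (const 1 ⊹ classT e ⊹ const (1 + cost (cell t (reg 0)) + 1))
      (timeT-bound i (∧-l h)) (unary (classT e) 1 _ (timeT-bound e (∧-r {loopsT i} h)))
    timeS-bound (s ⨾ s′) h =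
      sequence (classS s) (classS s′) (timeS-bound s (∧-l h)) (timeS-bound s′ (∧-r {loopsS s} h))
    timeS-bound (when c a b) h = sequence (classT c) (const 2 ⊹ (classS a ⊹ classS b)) (timeT-bound c (∧-l h))
      (⊹-sound (const 2) (classS a ⊹ classS b) (const-sound 2) (⊹-sound (classS a) (classS b)
        (timeS-bound a (∧-l (∧-r {loopsT c} h))) (timeS-bound b (∧-r {loopsS a} (∧-r {loopsT c} h)))))
    timeS-bound (bindS e s) h = sequence (classT e) (classS s) (timeT-bound e (∧-l h)) (timeS-bound s (∧-r {loopsT e} h))
    timeS-bound (for P s) h = ⊹-sound (const 3) (loopClass P body) (const-sound 3)
      (loop-sound (kind P) body (∧-l h) (fits P) (unary (classS s) 1 4 (timeS-bound s (∧-r {iterable P} h))))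
      where body = const 1 ⊹ classS s ⊹ const 4

    time₁-bound : ∀ i → loops₁ i ≡ true → time₁ π i ≤ ⟦ class₁ i ⟧ᶜ
    time₁-bound (assign P e) h = unary (classT e) 1 2 (timeT-bound e h)
    time₁-bound (perform s)  h = timeS-bound s h

  fits-set : ∀ {π} → Fits π → ∀ P a → Limit (kind P) a → Fits (setParam π P a)
  fits-set {π} fits P a lim P′ = go (register P′ ≡ᵇ register P) (same-register P′ P)
    where
    same-register : ∀ P′ P → (register P′ ≡ᵇ register P) ≡ true → P′ ≡ P
    same-register pn pn _ = refl
    same-register pm pm _ = refl
    same-register pE pE _ = refl
    same-register pb pb _ = refl
    same-register pD pD _ = refl
    same-register pℓ pℓ _ = refl
    same-register pB pB _ = refl
    same-register pK pK _ = refl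
    same-register pTW pTW _ = refl
    same-register pINF pINF _ = refl
    same-register pIT pIT _ = refl
    go : ∀ b → (b ≡ true → P′ ≡ P) → Limit (kind P′) (if b then a else π P′)
    go true  eq with eq refl
    ... | refl = lim
    go false _  = fits P′

  module _ (I : ℕ → ℕ) (base : ℕ) (I-end : ∀ a → base ≤ a → I a ≡ 0) where
    open Execution I base I-end
    open Semantics I

    -- The time of an instruction is bounded in terms of the parameters in force when it starts, so
    -- `Fits` is recorded before each one.
    data Trace : Program → Params × Mem → Params × Mem → Set where
      finished  : ∀ {e} → Trace [] e e
      performed : ∀ {s p π μ e} → Fits π → Trace p (π , exec s π [] μ) e → Trace (perform s ∷ p) (π , μ) e
      assigned  : ∀ {P t p π μ e} a → Fits π → eval t π μ [] ≡ a → Trace p (setParam π P a , μ) e →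
                  Trace (assign P t ∷ p) (π , μ) e

    trace-exec : ∀ {p e e′} → Trace p e e′ → execP p e ≡ e′
    trace-exec finished                  = refl
    trace-exec (performed _ trace)       = trace-exec trace
    trace-exec (assigned _ _ refl trace) = trace-exec trace

    trace-time : ∀ {p e e′} → loopsP p ≡ true → Trace p e e′ → timeP p e ≤ ⟦ classP p ⟧ᶜ
    trace-time _ finished = const-sound 1
    trace-time h (performed {s} {p} fits trace) =
      sequence (classS s) (classP p) (timeS-bound fits s (∧-l h)) (trace-time (∧-r {loopsS s} h) trace)
    trace-time h (assigned {P} {t} {p} _ fits refl trace) =
      sequence (class₁ (assign P t)) (classP p) (time₁-bound fits (assign P t) (∧-l h)) (trace-time (∧-r {loopsT t} h) trace)

-- By evaluation: no loop of the program runs up to a `value`.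
program-loops : loopsP program ≡ true
program-loops = refl

-- Opaque, because its coefficient is a large numeral that would unfold.
opaque
  programClass : Class
  programClass = classP program

  programClass≡ : programClass ≡ classP program
  programClass≡ = refl

  large-degree-program : large-degree programClass ≡ 1
  large-degree-program = refl

-- 29 is the cost of the four assignments of `prelude` with their sequencing,
-- `(1 + 3) + (1 + 5) + (1 + 9) + (1 + 8)`; the body of its loop costs 11.
preludeClass postludeClass totalClass : Class
preludeClass  = const 29 ⊹ loopClass pm (const 11)
postludeClass = const 3 ⊹ loopClass pn (const (1 + (1 + 1 + cost (mem (cell OUT (reg 16)))) + 4))
totalClass    = const 1 ⊹ preludeClass ⊹ (const 1 ⊹ programClass ⊹ postludeClass)

-- The source of linearity: no loop over vertices, edges, nodes or rounds is nested in another such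
-- loop.
large-degree-total : large-degree totalClass ≡ 1
large-degree-total = cong (λ b → 1 ⊔ (b ⊔ 1)) large-degree-program

n≤2^⌈log₂n⌉ : ∀ n → n ≤ 2 ^ ⌈log₂ n ⌉
n≤2^⌈log₂n⌉ n = go n (<-wellFounded n)
  where
  go : ∀ n (ac : Acc _<_ n) → n ≤ 2 ^ ⌈log2⌉ n ac
  go 0 _ = z≤n
  go 1 _ = s≤s z≤n
  go (suc (suc n)) (acc rs) = ≤-trans
    (≤-trans (s≤s (s≤s (≤-trans (≤-reflexive (sym (⌊n/2⌋+⌈n/2⌉≡n n))) (+-monoˡ-≤ ⌈ n /2⌉ (⌊n/2⌋≤⌈n/2⌉ n)))))
             (≤-reflexive (double-suc ⌈ n /2⌉)))
    (*-monoʳ-≤ 2 (go (suc ⌈ n /2⌉) (rs (⌈n/2⌉<n n))))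
    where double-suc : ∀ x → 2 + (x + x) ≡ 2 * suc x
          double-suc = solve-∀

n<2^n : ∀ n → n < 2 ^ n
n<2^n zero    = s≤s z≤n
n<2^n (suc n) = ≤-trans (+-mono-≤ (m^n>0 2 n) (n<2^n n)) (≤-reflexive (cong (2 ^ n +_) (sym (+-identityʳ (2 ^ n)))))

max-upper : ∀ {m} (f : Fin m → ℕ) i → f i ≤ max 0 (map f (allFin m))
max-upper {m} f i = All.lookup (xs≤max 0 (map f (allFin m))) (∈-map⁺ f (∈-allFin i))

max-least : ∀ {m} (f : Fin m → ℕ) c → (∀ i → f i ≤ c) → max 0 (map f (allFin m)) ≤ c
max-least {m} f c h = max≤v⁺ {xs = map f (allFin m)} z≤n (All-map⁺ (All.tabulate λ {i} _ → h i))

module _ {A : Set} {m : ℕ} {P : Fin m → A → Set} (P? : ∀ i a → Dec (P i a)) where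

  -- Applied to edges and bags: as every edge lies in some bag, the induced edge counts add up to at
  -- least the number of edges.
  length-≤-∑-filter : ∀ xs → (∀ {x} → x ∈ₗ xs → ∃[ i ] P i x) →
                      length xs ≤ ∑ m (extend (λ i → length (filter (P? i) xs)))
  length-≤-∑-filter [] covered = z≤n
  length-≤-∑-filter (x ∷ xs) covered =
    let i , p = covered (here refl) in
    ≤-trans (s≤s (length-≤-∑-filter xs (covered ∘ there)))
    (≤-trans (≤-reflexive (trans (+-comm 1 _) (trans (cong (∑ m f +_) (sym (∑-only m (toℕ i) 1 (Fin.toℕ<n i))))
        (sym (∑-+ m f (only (toℕ i) 1))))))
      (∑-mono m λ k k<m → subst (λ k → f k + only (toℕ i) 1 k ≤ f′ k) (Fin.toℕ-fromℕ< k<m) (pointwise i p (fromℕ< k<m))))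
    where
    f f′ : ℕ → ℕ
    f  = extend (λ i → length (filter (P? i) xs))
    f′ = extend (λ i → length (filter (P? i) (x ∷ xs)))
    grows : ∀ i k → (toℕ k ≢ toℕ i ⊎ P k x) →
            length (filter (P? k) xs) + only (toℕ i) 1 (toℕ k) ≤ length (filter (P? k) (x ∷ xs))
    grows i k h with P? k x | toℕ k ≟ toℕ i
    ... | yes _ | yes eq = ≤-reflexive (trans (cong (length (filter (P? k) xs) +_)
                             (trans (cong (only (toℕ i) 1) eq) (only-≡ (toℕ i) 1))) (+-comm _ 1))
    ... | yes _ | no ne = ≤-trans (≤-reflexive (trans (cong (_ +_) (only-≢ 1 ne)) (+-identityʳ _))) (n≤1+n _)
    ... | no _  | no ne = ≤-reflexive (trans (cong (_ +_) (only-≢ 1 ne)) (+-identityʳ _))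
    ... | no ¬p | yes eq = [ (λ ne → contradiction eq ne) , (λ p → contradiction p ¬p) ]′ h
    pointwise : ∀ i → P i x → ∀ k → f (toℕ k) + only (toℕ i) 1 (toℕ k) ≤ f′ (toℕ k)
    pointwise i p k = subst₂ _≤_ (cong (_+ only (toℕ i) 1 (toℕ k)) (sym (extend-toℕ _ k))) (sym (extend-toℕ _ k))
      (grows i k (choose (k Fin.≟ i)))
      where choose : Dec (k ≡ i) → toℕ k ≢ toℕ i ⊎ P k x
            choose (yes refl) = inj₂ p
            choose (no k≢)    = inj₁ (k≢ ∘ Fin.toℕ-injective)

-- The complete algorithm on the RAM

module Correctness {n m} (ℓ : ℕ) (G : Graph n) (V′ : Subset n) (D : NiceTreeDecomposition G m) (1≤ℓ : 1 ≤ ℓ) where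
  open NiceTreeDecomposition D
  open Encoding ℓ G V′ D
  open Preparation ℓ G V′ D
  open Decoding ℓ G V′ D prepared 1≤ℓ
  open Semantics I
  open Simulation I base I-end
  open Execution I base I-end
  open Sim

  preludeTime postludeTime : ℕ
  preludeTime  = 1 + 3 + (1 + 5 + (1 + 9 + (1 + 8 + loopTime m 11)))
  postludeTime = 1 + 2 + loopTime n (1 + (1 + 1 + cost (mem (cell OUT (reg 16)))) + 4)

  prelude-correct : Exec prelude (initial (encode ℓ G V′ D)) preludeTime (Sim π₀ μ₀)
  prelude-correct =
    seqE (setE {Q = λ σ → σ ≡ ⟨ r₁ , I ⟩} refl) λ { refl →
    seqE (setE {Q = λ σ → σ ≡ ⟨ r₁ [ 3 ↦ I (2 + n) ] , I ⟩} refl) λ { refl →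
    seqE (setE {Q = λ σ → σ ≡ ⟨ r₃ , I ⟩} refl) λ { refl →
    seqE (setE {Q = λ σ → Inv 0 σ} record
            { registers = λ P → trans (update-other r₃ _ (0<register P)) (params₃ P)
            ; bound     = trans (cong (λ e → 5 + n + e + e) I-edgeCount) (sym (+-identityʳ start))
            ; counter   = refl
            ; memory    = refl }) λ inv →
    weaken ≤-refl finish (loopE m 11 Inv (λ inv → counter inv , registers inv pm) iteration inv) } } }
    where
    r₁ r₃ : ℕ → ℕ
    r₁ = (λ _ → 0) [ 1 ↦ n ]
    r₃ = (r₁ [ 3 ↦ I (2 + n) ]) [ 2 ↦ I (3 + n + I (2 + n) + I (2 + n)) ]
    params₃ : ∀ P → r₃ (register P) ≡ π₀ P
    params₃ pn   = refl
    params₃ pm   = trans (cong (λ e → I (3 + n + e + e)) I-edgeCount) I-nodeCount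
    params₃ pE   = I-edgeCount
    params₃ pb   = refl
    params₃ pD   = refl
    params₃ pℓ   = refl
    params₃ pB   = refl
    params₃ pK   = refl
    params₃ pTW  = refl
    params₃ pINF = refl
    params₃ pIT  = refl
    record Inv (i : ℕ) (σ : State) : Set where
      field
        registers : ∀ P → regs σ (register P) ≡ π₀ P
        bound     : regs σ 0 ≡ start + i * (2 + n)
        counter   : regs σ 16 ≡ i
        memory    : cells σ ≡ I
    open Inv
    iteration : ∀ {i σ} → i < m → Inv i σ →
      Exec ((reg 0 ≔ (reg 0 ⊕ (lit 2 ⊕ reg (register pn)))) ⨟ (reg 16 ≔ (reg 16 ⊕ lit 1))) σ 11 (Inv (suc i))
    iteration {i} {σ} _ inv =
      seqE (setE {Q = λ σ′ → σ′ ≡ ⟨ regs σ [ 0 ↦ regs σ 0 + (2 + regs σ 1) ] , cells σ ⟩} refl) λ { refl →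
      setE record
        { registers = λ P → trans (update-other (regs σ [ 0 ↦ _ ]) _ (<⇒≢ (register<16 P)))
                              (trans (update-other (regs σ) _ (0<register P)) (registers inv P))
        ; bound     = trans (cong₂ (λ a b → a + (2 + b)) (bound inv) (registers inv pn)) (shift start (i * (2 + n)) n)
        ; counter   = trans (cong (_+ 1) (counter inv)) (+-comm i 1)
        ; memory    = memory inv } }
      where shift : ∀ s x n → s + x + (2 + n) ≡ s + (2 + n + x)
            shift = solve-∀
    finish : ∀ {σ} → Inv m σ → Sim π₀ μ₀ σ
    finish inv = record
      { base-reg = bound inv
      ; params   = registers inv
      ; input    = λ a _ → cong (λ c → c a) (memory inv)
      -- All arrays start out as zero because the memory beyond the input does; nothing has to be
      -- cleared.
      ; arrays   = λ t i → trans (cong (λ c → c (address t i)) (memory inv)) (I-end _ (m≤m+n base _)) }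

  postlude-correct : ∀ {π μ σ} → π pn ≡ n → Sim π μ σ →
    Exec postlude σ postludeTime (λ σ′ → ∀ (v : Fin n) → cells σ′ (toℕ v) ≡ μ OUT (toℕ v))
  postlude-correct {π} {μ} {σ} n≡ sim =
    seqE {s = 2} (setE {Q = Inv 0} record
            { bound   = trans (params sim pn) n≡
            ; base-at = base-reg sim
            ; counter = refl
            ; source  = arrays sim OUT
            ; copied  = λ _ () }) λ inv →
    weaken ≤-refl (λ inv v → copied inv (toℕ v) (Fin.toℕ<n v))
      (loopE n _ Inv (λ inv → counter inv , bound inv) iteration inv)
    where
    record Inv (i : ℕ) (σ : State) : Set where
      field
        bound   : regs σ 1 ≡ n
        base-at : regs σ 0 ≡ base
        counter : regs σ 16 ≡ i
        source  : ∀ j → cells σ (address OUT j) ≡ μ OUT j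
        copied  : ∀ j → j < i → cells σ j ≡ μ OUT j
    open Inv
    iteration : ∀ {i σ} → i < n → Inv i σ →
      Exec ((mem reg 16 ≔ mem (cell OUT (reg 16))) ⨟ (reg 16 ≔ (reg 16 ⊕ lit 1))) σ
           (1 + (1 + 1 + cost (mem (cell OUT (reg 16)))) + 4) (Inv (suc i))
    iteration {i} {σ} i<n inv =
      seqE (setMemE {Q = Mid} (λ j → mid j)) λ {σ′} h →
      setE {σ = σ′} record
        { bound   = trans (proj₁ (proj₂ (h 0))) (bound inv)
        ; base-at = trans (proj₁ (proj₂ (proj₂ (h 0)))) (base-at inv)
        ; counter = trans (cong (_+ 1) (trans (proj₁ (proj₂ (proj₂ (proj₂ (h 0))))) (counter inv))) (+-comm i 1)
        ; source  = λ j → proj₁ (h j)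
        ; copied  = λ j j≤ → proj₂ (proj₂ (proj₂ (proj₂ (h j)))) j≤ }
      where
      Mid : State → Set
      Mid σ′ = ∀ j → cells σ′ (address OUT j) ≡ μ OUT j × regs σ′ 1 ≡ regs σ 1 × regs σ′ 0 ≡ regs σ 0 ×
                     regs σ′ 16 ≡ regs σ 16 × (j < suc i → cells σ′ j ≡ μ OUT j)
      value-at : cells σ (regs σ 0 + (double (regs σ 16) + 10)) ≡ μ OUT i
      value-at = trans (cong₂ (λ b x → cells σ (b + (double x + 10))) (base-at inv) (counter inv)) (source inv i)
      mid : ∀ j → _
      mid j = trans (update-other (cells σ) _ (λ eq → <⇒≢ (<-≤-trans (≤-trans (≤-reflexive (cong suc (counter inv))) i<n)
                 (≤-trans n≤base (m≤m+n base _))) (sym eq))) (source inv j)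
            , refl , refl , refl
            , λ j≤ → [ (λ j<i → trans (update-other (cells σ) _ (λ eq → <⇒≢ j<i (trans eq (counter inv)))) (copied inv j j<i))
                     , (λ { refl → trans (cong (cells σ [ regs σ 16 ↦ _ ]) (sym (counter inv)))
                              (trans (update-same (cells σ) (regs σ 16) _) value-at) }) ]′ (m≤n⇒m<n∨m≡n (s≤s⁻¹ j≤))

  -- Stated for any program and result, which keeps `program` and the final memory folded.
  algorithm-correct : ∀ {p e} → execP p (π₀ , μ₀) ≡ e → proj₁ e pn ≡ n →
    Exec (prelude ⨟ (compileP p ⨟ postlude)) (initial (encode ℓ G V′ D))
         (1 + preludeTime + (1 + timeP p (π₀ , μ₀) + postludeTime))
         (λ σ′ → ∀ (v : Fin n) → cells σ′ (toℕ v) ≡ proj₂ e OUT (toℕ v))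
  algorithm-correct {p} refl n≡ =
    seqE prelude-correct λ sim →
    seqE (compileP-correct p {π₀ , μ₀} sim) λ sim′ →
    postlude-correct n≡ sim′

  open Final I

  module _ (Q N : ℕ) (1≤Q : 1 ≤ Q) (1≤N : 1 ≤ N) where
    open Bounds Q N 1≤Q 1≤N

    final-trace : ∀ {π μ} → Fits π →
                  Trace I base I-end (perform dynamic ∷ perform output ∷ []) (π , μ) (π , finalMem π μ)
    final-trace {π} {μ} fits =
      subst (λ ν → Trace I base I-end (perform dynamic ∷ perform output ∷ []) (π , μ) (π , ν))
        (sym (finalMem≡ π μ)) (performed fits (performed fits finished))

    trace : n ≤ N → m ≤ N → E ≤ N → 1 + m + m ≤ N → π₅ pb ≤ Q → π₅ pD ≤ Q → π₅ pB ≤ Q → π₅ pK ≤ Q →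
            Trace I base I-end program (π₀ , μ₀) (π₈ , finalMem π₈ μ₅)
    trace n≤ m≤ E≤ IT≤ b≤ D≤ B≤ K≤ =
      performed fits₀ (assigned (π₁ pb) fits₀ refl (assigned (π₂ pD) fits₁ refl (assigned ℓ fits₂ refl
      (assigned (π₄ pB) fits₃ refl (assigned (π₅ pK) fits₄ refl (performed fits₅ (assigned (π₆ pTW) fits₅ refl
      (assigned (π₇ pINF) fits₆ refl (performed fits₇ (performed fits₇ (performed fits₇
      (assigned (π₈ pIT) fits₇ refl (final-trace fits₈)))))))))))))
      where
      fits₀ : Fits π₀
      fits₀ pn   = n≤
      fits₀ pm   = m≤
      fits₀ pE   = E≤
      fits₀ pb   = z≤n
      fits₀ pD   = z≤n
      fits₀ pℓ   = tt
      fits₀ pB   = z≤n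
      fits₀ pK   = z≤n
      fits₀ pTW  = tt
      fits₀ pINF = tt
      fits₀ pIT  = z≤n
      fits₁ : Fits π₁
      fits₁ = fits-set fits₀ pb (π₅ pb) b≤
      fits₂ : Fits π₂
      fits₂ = fits-set fits₁ pD (π₅ pD) D≤
      fits₃ : Fits π₃
      fits₃ = fits-set fits₂ pℓ ℓ tt
      fits₄ : Fits π₄
      fits₄ = fits-set fits₃ pB (π₅ pB) B≤
      fits₅ : Fits π₅
      fits₅ = fits-set fits₄ pK (π₅ pK) K≤
      fits₆ : Fits π₆
      fits₆ = fits-set fits₅ pTW (π₆ pTW) tt
      fits₇ : Fits π₇
      fits₇ = fits-set fits₆ pINF (π₇ pINF) tt
      fits₈ : Fits π₈
      fits₈ = fits-set fits₇ pIT (1 + m + m) IT≤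

open Class

-- The time bound and its constants

module Timing {n m} (ℓ k a : ℕ) (G : Graph n) (V′ : Subset n) (D : NiceTreeDecomposition G m) (1≤ℓ : 1 ≤ ℓ)
  (hasWidth : NiceTreeDecomposition.maxBagSize D ≡ suc k) (m≤an : m ≤ a * n) where
  open NiceTreeDecomposition D
  open Encoding ℓ G V′ D
  open Preparation ℓ G V′ D
  open Correctness ℓ G V′ D 1≤ℓ

  bag≤ : ∀ i → ∣ bag i ∣ ≤ suc k
  bag≤ i = subst (∣ bag i ∣ ≤_) hasWidth (max-upper (λ i → ∣ bag i ∣) i)

  1≤n : 1 ≤ n
  1≤n = ≮⇒≥ λ n<1 → <⇒≱ (s≤s z≤n) (subst (_≤ 0) hasWidth
    (max-least (λ i → ∣ bag i ∣) 0 λ i → ≤-trans (∣p∣≤n (bag i)) (s≤s⁻¹ n<1)))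

  edges≤ : E ≤ m * maxBagEdges
  edges≤ = ≤-trans (length-≤-∑-filter (λ i e → (proj₁ e ∈? bag i) ×-dec (proj₂ e ∈? bag i)) (edges G)
      λ {e} e∈ → coverE (proj₁ e) (proj₂ e) (inj₁ e∈))
    (≤-trans (∑-mono m {g = λ _ → maxBagEdges} λ i i<m →
        subst (λ i → extend f i ≤ maxBagEdges) (Fin.toℕ-fromℕ< i<m)
          (≤-trans (≤-reflexive (extend-toℕ f (fromℕ< i<m))) (max-upper f (fromℕ< i<m))))
      (≤-reflexive (iter-times m maxBagEdges)))
    where
    f : Fin m → ℕ
    f i = inducedEdgeCount G (bag i)

  -- The two ends of an edge occupy different slots of a common bag.
  1≤k : E ≢ 0 → 1 ≤ k
  1≤k E≢0 =
    let (u , v) , e∈ , _ = I-edge⁻ 0 (n≢0⇒n>0 E≢0)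
        i , u∈ , v∈ = coverE u v (inj₁ e∈)
        q , q< , eq = slot⁺ i u∈
        q′ , q′< , eq′ = slot⁺ i v∈
    in s≤s⁻¹ (≤-trans (two q q′ q< q′< λ q≡q′ →
      adj-irrefl G (inj₁ e∈) (Fin.toℕ-injective (trans (sym eq) (trans (cong (slot i) q≡q′) eq′)))) (bag≤ i))
    where
    two : ∀ q q′ {b} → q < b → q′ < b → q ≢ q′ → 2 ≤ b
    two zero    zero     _ _ ne = contradiction refl ne
    two zero    (suc q′) _ lt _ = ≤-trans (s≤s (s≤s z≤n)) lt
    two (suc q) q′       lt _ _ = ≤-trans (s≤s (s≤s z≤n)) lt

  -- If there is an edge, then `1 ≤ k`, and at most `4 * suc k ≤ 8 * k` digits to the base
  -- `3 + ℓ ≤ 2 ^ (3 * λℓ)` give at most `2 ^ (24 * L)` states; the factor 4 of `Q` accommodates the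
  -- number of digits. In `N`, `1 + 2 * a` covers the `1 + m + m` rounds, and `2 ^ maxBagEdges`
  -- covers `E ≤ m * maxBagEdges`.
  λℓ L Q N : ℕ
  λℓ = log ℓ
  L  = k * λℓ
  Q  = 4 * 2 ^ (24 * L)
  N  = (1 + 2 * a) * n * 2 ^ maxBagEdges

  1≤λ : 1 ≤ λℓ
  1≤λ = m≤m⊔n 1 ⌈log₂ ℓ ⌉

  1≤2^ : ∀ x → 1 ≤ 2 ^ x
  1≤2^ = m^n>0 2

  2^-mono : ∀ {x y} → x ≤ y → 2 ^ x ≤ 2 ^ y
  2^-mono = ^-monoʳ-≤ 2

  k≤24L : k ≤ 24 * L
  k≤24L = ≤-trans (≤-trans (≤-reflexive (sym (*-identityʳ k))) (*-monoʳ-≤ k 1≤λ)) (m≤n*m L 24)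

  1≤Q : 1 ≤ Q
  1≤Q = ≤-trans (1≤2^ (24 * L)) (m≤n*m _ 4)

  n≤N : n ≤ N
  n≤N = ≤-trans (m≤n*m n (1 + 2 * a)) (m≤m*n _ (2 ^ maxBagEdges) ⦃ >-nonZero (1≤2^ maxBagEdges) ⦄)

  1≤N : 1 ≤ N
  1≤N = ≤-trans 1≤n n≤N

  private
    an≤ : a * n ≤ (1 + 2 * a) * n
    an≤ = *-monoˡ-≤ n (≤-trans (m≤m+n a (a + 0)) (n≤1+n (2 * a)))

  m≤N : m ≤ N
  m≤N = ≤-trans (≤-trans m≤an an≤) (m≤m*n _ (2 ^ maxBagEdges) ⦃ >-nonZero (1≤2^ maxBagEdges) ⦄)

  E≤N : E ≤ N
  E≤N = ≤-trans edges≤ (*-mono-≤ (≤-trans m≤an an≤) (<⇒≤ (n<2^n maxBagEdges)))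

  IT≤N : 1 + m + m ≤ N
  IT≤N = ≤-trans (≤-trans (+-mono-≤ (+-mono-≤ 1≤n m≤an) m≤an) (≤-reflexive (rearrange n a)))
    (m≤m*n _ (2 ^ maxBagEdges) ⦃ >-nonZero (1≤2^ maxBagEdges) ⦄)
    where rearrange : ∀ n a → n + a * n + a * n ≡ (1 + 2 * a) * n
          rearrange = solve-∀

  b≤1+k : π₅ pb ≤ suc k
  b≤1+k = maximum-≤ m (λ i → I (1 + μ₁ BP i)) (suc k) λ i i<m →
    subst (λ i → I (1 + μ₁ BP i) ≤ suc k) (Fin.toℕ-fromℕ< i<m) (go (fromℕ< i<m))
    where
    go : ∀ i → I (1 + μ₁ BP (toℕ i)) ≤ suc k
    go i = ≤-trans (≤-reflexive (trans (cong (λ p → I (1 + p)) (pointers₁ (toℕ i) (Fin.toℕ≤n i))) (I-size i))) (bag≤ i)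

  D≤4+4k : π₅ pD ≤ 4 * suc k
  D≤4+4k = ≤-trans (+-mono-≤ (+-mono-≤ (+-mono-≤ b≤1+k b≤1+k) b≤1+k) b≤1+k) (≤-reflexive (four (suc k)))
    where four : ∀ x → x + x + x + x ≡ 4 * x
          four = solve-∀

  1+k≤ : suc k ≤ 2 ^ (24 * L)
  1+k≤ = ≤-trans (n<2^n k) (2^-mono k≤24L)

  b≤Q : π₅ pb ≤ Q
  b≤Q = ≤-trans b≤1+k (≤-trans 1+k≤ (m≤n*m _ 4))

  D≤Q : π₅ pD ≤ Q
  D≤Q = ≤-trans D≤4+4k (*-monoʳ-≤ 4 1+k≤)

  -- `3 + ℓ ≤ 4 * ℓ ≤ 2 ^ (2 + λℓ)`, and `2 ≤ 2 * λℓ` because the logarithm is taken to be at least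
  -- 1.
  3+ℓ≤ : 3 + ℓ ≤ 2 ^ (3 * λℓ)
  3+ℓ≤ = ≤-trans (≤-trans (+-monoˡ-≤ ℓ (*-monoʳ-≤ 3 1≤ℓ)) (≤-reflexive (+-comm (3 * ℓ) ℓ)))
    (≤-trans (*-monoʳ-≤ 4 (≤-trans (n≤2^⌈log₂n⌉ ℓ) (2^-mono (m≤n⊔m 1 ⌈log₂ ℓ ⌉))))
    (≤-trans (≤-reflexive (sym (^-distribˡ-+-* 2 2 λℓ)))
      (2^-mono (≤-trans (+-monoˡ-≤ λℓ (*-monoʳ-≤ 2 1≤λ)) (≤-reflexive (+-comm (2 * λℓ) λℓ))))))

  B≤ : E ≢ 0 → π₅ pB ≤ 2 ^ (3 * λℓ)
  B≤ E≢0 = ≤-trans (≤-reflexive (caseZ-≢0 E≢0)) 3+ℓ≤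

  K≡ : π₅ pK ≡ π₅ pB ^ π₅ pD
  K≡ = iter-power (π₄ pD) (π₄ pB)

  B≤Q : π₅ pB ≤ Q
  B≤Q = go (E ≟ 0)
    where
    go : Dec (E ≡ 0) → π₅ pB ≤ Q
    go (yes E≡0) = ≤-trans (≤-reflexive (caseZ-0 E≡0)) 1≤Q
    go (no E≢0)  = ≤-trans (B≤ E≢0) (≤-trans (2^-mono (*-mono-≤ (m≤m+n 3 21)
      (≤-trans (≤-reflexive (sym (*-identityˡ λℓ))) (*-monoˡ-≤ λℓ (1≤k E≢0))))) (m≤n*m _ 4))

  K≤Q : π₅ pK ≤ Q
  K≤Q = ≤-trans (≤-reflexive K≡) (go (E ≟ 0))
    where
    go : Dec (E ≡ 0) → π₅ pB ^ π₅ pD ≤ Q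
    go (yes E≡0) = ≤-trans (≤-reflexive (trans (cong (_^ π₅ pD) (caseZ-0 E≡0)) (^-zeroˡ (π₅ pD)))) 1≤Q
    go (no E≢0)  = ≤-trans (^-monoˡ-≤ (π₅ pD) (B≤ E≢0))
      (≤-trans (^-monoʳ-≤ (2 ^ (3 * λℓ)) ⦃ >-nonZero (1≤2^ (3 * λℓ)) ⦄ D≤8k)
      (≤-trans (≤-reflexive (^-*-assoc 2 (3 * λℓ) (8 * k)))
      (≤-trans (≤-reflexive (cong (2 ^_) (rearrange λℓ k))) (m≤n*m _ 4))))
      where
      D≤8k : π₅ pD ≤ 8 * k
      D≤8k = ≤-trans D≤4+4k (≤-trans (*-monoʳ-≤ 4 (+-monoˡ-≤ k (1≤k E≢0))) (≤-reflexive (eight k)))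
        where eight : ∀ k → 4 * (k + k) ≡ 8 * k
              eight = solve-∀
      rearrange : ∀ l k → 3 * l * (8 * k) ≡ 24 * (k * l)
      rearrange = solve-∀

  open Bounds Q N 1≤Q 1≤N

  program-trace : Trace I base I-end program (π₀ , μ₀) (π₈ , Final.finalMem I π₈ μ₅)
  program-trace = trace Q N 1≤Q 1≤N n≤N m≤N E≤N IT≤N b≤Q D≤Q B≤Q K≤Q

  private
    with-input-output : ∀ {t} c → t ≤ ⟦ c ⟧ᶜ →
      1 + preludeTime + (1 + t + postludeTime) ≤ ⟦ const 1 ⊹ preludeClass ⊹ (const 1 ⊹ c ⊹ postludeClass) ⟧ᶜ
    with-input-output c le = sequence preludeClass (const 1 ⊹ c ⊹ postludeClass)
      (⊹-sound (const 29) (loopClass pm (const 11)) (const-sound 29)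
        (loop-sound large (const 11) refl m≤N (const-sound 11)))
      (sequence c postludeClass le (⊹-sound (const 3) (loopClass pn (const postBody)) (const-sound 3)
        (loop-sound large (const postBody) refl n≤N (const-sound postBody))))
      where
      postBody : ℕ
      postBody = 1 + (1 + 1 + cost (mem (cell OUT (reg 16)))) + 4

    run-time : ∀ {p} c → c ≡ classP p → loopsP p ≡ true → ∀ {e} → Trace I base I-end p (π₀ , μ₀) e →
      1 + preludeTime + (1 + Execution.timeP I base I-end p (π₀ , μ₀) + postludeTime)
        ≤ ⟦ const 1 ⊹ preludeClass ⊹ (const 1 ⊹ c ⊹ postludeClass) ⟧ᶜ
    run-time c refl loops tr = with-input-output c (trace-time I base I-end loops tr)

    run-bounded : ∀ {p e} c → c ≡ classP p → loopsP p ≡ true → Trace I base I-end p (π₀ , μ₀) e → proj₁ e pn ≡ n →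
      Exec (prelude ⨟ (compileP p ⨟ postlude)) (initial (encode ℓ G V′ D))
           ⟦ const 1 ⊹ preludeClass ⊹ (const 1 ⊹ c ⊹ postludeClass) ⟧ᶜ
           (λ σ′ → ∀ (v : Fin n) → cells σ′ (toℕ v) ≡ proj₂ e OUT (toℕ v))
    run-bounded c c≡ loops tr n≡ =
      weaken (run-time c c≡ loops tr) id (algorithm-correct (trace-exec I base I-end tr) n≡)

    algorithm-bounded : Exec algorithm (initial (encode ℓ G V′ D)) ⟦ totalClass ⟧ᶜ
                          (λ σ′ → ∀ (v : Fin n) → cells σ′ (toℕ v) ≡ Final.finalMem I π₈ μ₅ OUT (toℕ v))
    algorithm-bounded = run-bounded programClass programClass≡ program-loops program-trace refl

  solved : ∃[ S ] IsMinimumDominating G ℓ V′ S × OutputsWithin algorithm (encode ℓ G V′ D) S ⟦ totalClass ⟧ᶜ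
  solved =
    let S , minimum-S , decoded = Decoding.output-correct ℓ G V′ D prepared 1≤ℓ
        σ , t , run , t≤ , out  = algorithm-bounded
    in S , minimum-S , σ , t , run , t≤ , λ v → trans (out v) (decoded v)

^-distribʳ-* : ∀ k x y → (x * y) ^ k ≡ x ^ k * y ^ k
^-distribʳ-* zero    x y = refl
^-distribʳ-* (suc k) x y = trans (cong (x * y *_) (^-distribʳ-* k x y)) (interchange x y (x ^ k) (y ^ k))
  where interchange : ∀ a b c d → a * b * (c * d) ≡ a * c * (b * d)
        interchange = solve-∀

-- The exponents of 2 combine to `24 * L * A + e`, which is at most `(1 + 24 * A) * (e + L)`. The
-- base `2 ^ (1 + 24 * A)` thus depends on the program only, while `a` goes into the constant
-- factor.
class-bound : ∀ s A a n e L → s * ((4 * 2 ^ (24 * L)) ^ A * ((1 + 2 * a) * n * 2 ^ e) ^ 1) ≤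
              s * 4 ^ A * (1 + 2 * a) * (2 ^ (1 + 24 * A)) ^ (e + L) * n
class-bound s A a n e L = ≤-trans (≤-reflexive (trans
    (cong₂ (λ x y → s * (x * y)) (trans (^-distribʳ-* A 4 (2 ^ (24 * L))) (cong (4 ^ A *_) (^-*-assoc 2 (24 * L) A)))
      (^-identityʳ ((1 + 2 * a) * n * 2 ^ e)))
    (trans (rearrange s (4 ^ A) (2 ^ (24 * L * A)) (1 + 2 * a) n (2 ^ e))
      (cong (λ x → s * 4 ^ A * (1 + 2 * a) * x * n) (sym (^-distribˡ-+-* 2 (24 * L * A) e))))))
  (*-monoˡ-≤ n (*-monoʳ-≤ (s * 4 ^ A * (1 + 2 * a))
    (≤-trans (^-monoʳ-≤ 2 (≤-trans (m≤m+n (24 * L * A + e) (L + 24 * A * e)) (≤-reflexive (exponents A e L)))) (≤-reflexive (sym (^-*-assoc 2 (1 + 24 * A) (e + L)))))))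
  where
  rearrange : ∀ s f x b n y → s * (f * x * (b * n * y)) ≡ s * f * b * (x * y) * n
  rearrange = solve-∀
  exponents : ∀ A e L → 24 * L * A + e + (L + 24 * A * e) ≡ (1 + 24 * A) * (e + L)
  exponents = solve-∀

total≤ : ∀ a n e L → let s = coefficient totalClass; A = small-degree totalClass in
         s * ((4 * 2 ^ (24 * L)) ^ A * ((1 + 2 * a) * n * 2 ^ e) ^ large-degree totalClass) ≤
         s * 4 ^ A * (1 + 2 * a) * (2 ^ (1 + 24 * A)) ^ (e + L) * n
total≤ a n e L = subst (λ d → s * ((4 * 2 ^ (24 * L)) ^ A * ((1 + 2 * a) * n * 2 ^ e) ^ d) ≤
                              s * 4 ^ A * (1 + 2 * a) * (2 ^ (1 + 24 * A)) ^ (e + L) * n)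
  (sym large-degree-total) (class-bound s A a n e L)
  where
  s A : ℕ
  s = coefficient totalClass
  A = small-degree totalClass

theorem3p6 : ∃[ c ] ∃[ p ] ∀ (a : ℕ) → ∃[ C ]
    (∀ {n m : ℕ} (ℓ k : ℕ) (G : Graph n) (V′ : Subset n)
    (D : NiceTreeDecomposition G m) →
    let open NiceTreeDecomposition D in
    1 ≤ ℓ →
    HasTreeWidth G k →
    HasWidth decomposition k →
    m ≤ a * n →
    ∃[ S ] (IsMinimumDominating G ℓ V′ S ×
    OutputsWithin p (encode ℓ G V′ D) S
    (C * c ^ (maxBagEdges + k * log ℓ) * n)))
theorem3p6 = 2 ^ (1 + 24 * small-degree totalClass) , algorithm , λ a →
  coefficient totalClass * 4 ^ small-degree totalClass * (1 + 2 * a) ,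
  λ {n} ℓ k G V′ D 1≤ℓ _ hasWidth m≤an →
    let S , minimum-S , σ , t , run , t≤ , out = Timing.solved ℓ k a G V′ D 1≤ℓ hasWidth m≤an
    in S , minimum-S , σ , t , run
       , ≤-trans t≤ (total≤ a n (NiceTreeDecomposition.maxBagEdges D) (k * log ℓ))
       , out
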